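{- The counting Orthogonal Vectors problem $\#\mathsf{OV}$ on $n+n$ vectors in $\{0,1\}^d$ can be solved by a deterministic algorithm in time $\tilde O(n\cdot 1.26^d)$.
   Context: In $\#\mathsf{OV}$ one is given vectors $u_1,\dots,u_n,v_1,\dots,v_n\in\{0,1\}^d$ and must output the number of pairs $(i,j)\in[n]\times[n]$ with $\langle u_i,v_j\rangle=0$, the inner product being over $\mathbb{Z}$. $\tilde O$ hides factors polynomial in $d$ and $\log n$. -}

module Defs where

import Algebra.Definitions.RawSemiring
open import Data.Bool.Base using (if_then_else_)
open import Data.Fin.Base using (Fin; toℕ)
open import Data.Integer.Base as ℤ using (ℤ; 0ℤ; +_)
import Data.Integer.Properties as ℤ
open import Data.List.Base as List using (List; []; _∷_)
open import Data.Nat.Base using (ℕ; zero; suc; _+_; _*_; _∸_; _/_; _^_; _≤_)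
open import Data.Nat.Logarithm using (⌊log₂_⌋; ⌈log₂_⌉)
open import Data.Nat.Properties using (_≟_)
open import Data.Product.Base using (_×_; _,_; ∃-syntax)
open import Data.Rational.Unnormalised.Base as ℚᵘ using (ℚᵘ)
open import Data.Vec.Base as Vec using (Vec)
open import Relation.Binary.PropositionalEquality using (_≡_; _≢_; refl)
open import Relation.Nullary using (contradiction)
open import Relation.Nullary.Decidable using (does)

-- Counting Orthogonal Vectors

⟨_,_⟩ : ∀ {d} → Vec (Fin 2) d → Vec (Fin 2) d → ℤ
⟨ x , y ⟩ = Vec.foldr′ ℤ._+_ 0ℤ (Vec.zipWith (λ a b → (+ toℕ a) ℤ.* (+ toℕ b)) x y)

#OV : ∀ {n d} → Vec (Vec (Fin 2) d) n → Vec (Vec (Fin 2) d) n → ℕ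
#OV {n} u v = List.length (List.filter orthogonal? (List.cartesianProduct (List.allFin n) (List.allFin n)))
  where
  orthogonal? = λ ((i , j) : Fin n × Fin n) → ⟨ Vec.lookup u i , Vec.lookup v j ⟩ ℤ.≟ 0ℤ

-- Deterministic random access machines, with the logarithmic cost criterion
-- of Aho, Hopcroft and Ullman: every operation is charged the bit lengths of
-- the addresses and operands it handles.  Hence no word size has to be fixed
-- and long numbers give no free parallelism; up to factors polynomial in the
-- word size, this agrees with unit cost on a word RAM.  Register names are
-- not charged, since each program mentions only finitely many.

Reg : Set
Reg = ℕ

data Instr : Set where
  _≔_     : Reg → ℕ → Instr
  _≔ʳ_    : Reg → Reg → Instr
  add     : Reg → Reg → Reg → Instr
  sub     : Reg → Reg → Reg → Instr
  mul     : Reg → Reg → Reg → Instr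
  div     : Reg → Reg → Reg → Instr
  load    : Reg → Reg → Instr
  store   : Reg → Reg → Instr

infixr 5 _⨾_

data Program : Set where
  instr         : Instr → Program
  _⨾_           : Program → Program → Program
  ifNonzero     : Reg → Program → Program → Program
  whileNonzero  : Reg → Program → Program

record State : Set where
  constructor state
  field
    reg  : Reg → ℕ
    mem  : ℕ → ℕ

open State public

_[_↦_] : (ℕ → ℕ) → ℕ → ℕ → (ℕ → ℕ)
(f [ a ↦ x ]) b = if does (a ≟ b) then x else f b

-- Bit length, with ℓ 0 = 1 (as ⌊log₂ 0 ⌋ = 0).
ℓ : ℕ → ℕ
ℓ x = suc ⌊log₂ x ⌋

-- Rounded down; division by zero yields zero.
quotient : ℕ → ℕ → ℕ
quotient x zero     = 0
quotient x (suc y)  = x / suc y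

-- The destination register comes first, except that store a b writes the
-- contents of register b to the memory cell whose address is in register a.
effect : Instr → State → State
effect (r ≔ c)      (state R M) = state (R [ r ↦ c ]) M
effect (r ≔ʳ a)     (state R M) = state (R [ r ↦ R a ]) M
effect (add r a b)  (state R M) = state (R [ r ↦ R a + R b ]) M
effect (sub r a b)  (state R M) = state (R [ r ↦ R a ∸ R b ]) M
effect (mul r a b)  (state R M) = state (R [ r ↦ R a * R b ]) M
effect (div r a b)  (state R M) = state (R [ r ↦ quotient (R a) (R b) ]) M
effect (load r a)   (state R M) = state (R [ r ↦ M (R a) ]) M
effect (store a b)  (state R M) = state R (M [ R a ↦ R b ])

cost : Instr → State → ℕ
cost (r ≔ c)      _           = ℓ c
cost (r ≔ʳ a)     (state R M) = ℓ (R a)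
cost (add r a b)  (state R M) = ℓ (R a) + ℓ (R b)
cost (sub r a b)  (state R M) = ℓ (R a) + ℓ (R b)
cost (mul r a b)  (state R M) = ℓ (R a) + ℓ (R b)
cost (div r a b)  (state R M) = ℓ (R a) + ℓ (R b)
cost (load r a)   (state R M) = ℓ (R a) + ℓ (M (R a))
cost (store a b)  (state R M) = ℓ (R a) + ℓ (R b)

-- p ∣ s ⇓ s′ ∣ t : started in s, the program p halts in s′ after time t.
infix 4 _∣_⇓_∣_

data _∣_⇓_∣_ : Program → State → State → ℕ → Set where
  instr⇓     : ∀ {i s} → instr i ∣ s ⇓ effect i s ∣ cost i s
  seq⇓       : ∀ {p q s s′ s″ t t′} →
               p ∣ s ⇓ s′ ∣ t → q ∣ s′ ⇓ s″ ∣ t′ →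
               p ⨾ q ∣ s ⇓ s″ ∣ t + t′
  then⇓      : ∀ {r p q s s′ t} → reg s r ≢ 0 →
               p ∣ s ⇓ s′ ∣ t →
               ifNonzero r p q ∣ s ⇓ s′ ∣ ℓ (reg s r) + t
  else⇓      : ∀ {r p q s s′ t} → reg s r ≡ 0 →
               q ∣ s ⇓ s′ ∣ t →
               ifNonzero r p q ∣ s ⇓ s′ ∣ ℓ (reg s r) + t
  continue⇓  : ∀ {r p s s′ s″ t t′} → reg s r ≢ 0 →
               p ∣ s ⇓ s′ ∣ t → whileNonzero r p ∣ s′ ⇓ s″ ∣ t′ →
               whileNonzero r p ∣ s ⇓ s″ ∣ ℓ (reg s r) + (t + t′)
  exit⇓      : ∀ {r p s} → reg s r ≡ 0 →
               whileNonzero r p ∣ s ⇓ s ∣ ℓ (reg s r)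

⇓-deterministic : ∀ {p s s₁ s₂ t₁ t₂} →
                  p ∣ s ⇓ s₁ ∣ t₁ → p ∣ s ⇓ s₂ ∣ t₂ → s₁ ≡ s₂ × t₁ ≡ t₂
⇓-deterministic instr⇓ instr⇓ = refl , refl
⇓-deterministic (seq⇓ a b) (seq⇓ a′ b′) with ⇓-deterministic a a′
... | refl , refl with ⇓-deterministic b b′
... | refl , refl = refl , refl
⇓-deterministic (then⇓ _ a) (then⇓ _ a′) with ⇓-deterministic a a′
... | refl , refl = refl , refl
⇓-deterministic (then⇓ ≢0 _) (else⇓ ≡0 _) = contradiction ≡0 ≢0
⇓-deterministic (else⇓ ≡0 _) (then⇓ ≢0 _) = contradiction ≡0 ≢0
⇓-deterministic (else⇓ _ a) (else⇓ _ a′) with ⇓-deterministic a a′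
... | refl , refl = refl , refl
⇓-deterministic (continue⇓ _ a b) (continue⇓ _ a′ b′) with ⇓-deterministic a a′
... | refl , refl with ⇓-deterministic b b′
... | refl , refl = refl , refl
⇓-deterministic (continue⇓ ≢0 _ _) (exit⇓ ≡0) = contradiction ≡0 ≢0
⇓-deterministic (exit⇓ ≡0) (continue⇓ ≢0 _ _) = contradiction ≡0 ≢0
⇓-deterministic (exit⇓ _) (exit⇓ _) = refl , refl

nth : List ℕ → ℕ → ℕ
nth []        _        = 0
nth (x ∷ xs)  zero     = x
nth (x ∷ xs)  (suc a)  = nth xs a

-- Registers 0 and 1 hold n and d.  The coordinates of u₁,…,uₙ,v₁,…,vₙ, in
-- this order, occupy memory cells 0,…,2nd-1.  All else is zero.
input : ∀ {n d} → Vec (Vec (Fin 2) d) n → Vec (Vec (Fin 2) d) n → State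
input {n} {d} u v = state (nth (n ∷ d ∷ [])) (nth (coordinates u List.++ coordinates v))
  where
  coordinates : Vec (Vec (Fin 2) d) n → List ℕ
  coordinates w = Vec.toList (Vec.map toℕ (Vec.concat w))

-- One program serves all n and d; the count is left in register 0.
_Solves#OVInTime_ : Program → (ℕ → ℕ → ℕ) → Set
P Solves#OVInTime T =
  ∀ n d (u v : Vec (Vec (Fin 2) d) n) →
  ∃[ s ] ∃[ t ] (P ∣ input u v ⇓ s ∣ t) × reg s 0 ≡ #OV u v × t ≤ T n d

-- T n d ≤ poly (d , log n) · f n d for all n ≥ 1 and d ≥ 0.  Every polynomial
-- in d and log n is bounded by some C · (1 + d + log n) ^ k.
_∈Õ_ : (ℕ → ℕ → ℕ) → (ℕ → ℕ → ℚᵘ) → Set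
T ∈Õ f =
  ∃[ C ] ∃[ k ] ∀ n d → 1 ≤ n →
  (+ T n d) ℚᵘ./ 1 ℚᵘ.≤ ((+ (C * (1 + d + ⌈log₂ n ⌉) ^ k)) ℚᵘ./ 1) ℚᵘ.* f n d

open Algebra.Definitions.RawSemiring ℚᵘ.+-*-rawSemiring public
  using () renaming (_^_ to _^ℚ_)

-- Fix one coordinate.  The disjointness matrix of two bits decomposes over a
-- key bit z in three ways: x copies its bit to z and y may set z only if y = 0;
-- the same with x and y exchanged; or both may set z only where they have a
-- one, with sign (-1) ^ z.  The numbers of free bits of x are 0, [x = 0] and
-- [x = 1], so on average over the three ways each side has exactly 1/3 of a
-- free bit per coordinate, whatever x and y are.  If every vector writes down
-- all keys it can produce, the signed number of common keys of u and v is
-- 1 if u and v are orthogonal and 0 otherwise, and it remains to make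
-- both sides pay about 2 ^ (d / 3) < 1.26 ^ d keys simultaneously.
--
-- To this end the coordinates are cut into at most K blocks, K constant, and
-- both sides guess the numbers a and b of ones of either vector in each block
-- (polynomially many guesses, recorded in the key, so that exactly one
-- survives).  The way used in a block is a function of the guesses so far,
-- chosen so that the excesses of the two costs over s/3 in a block of size s,
-- weighted by the excesses w₁, w₂ accumulated before, have a nonpositive sum;
-- this is possible because it holds on average.  As in Blackwell's
-- approachability theorem, w₁² + w₂² then grows by at most 8 s² per block, so
-- that the final excess is O(√K) block sizes, an arbitrarily small part of d.
--
-- The machine runs through pairs (vector, choice number), the choice number
-- being the digits of all guesses and free bits.  Right vectors count their
-- keys in a table, left vectors sum the entries at their keys.
module Submission where

open import Defs

-- The cost estimate has to hold for every guess that a side lets through, not only for the true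
-- one. A side can verify the number of its own ones, but the number guessed for the other vector is
-- confirmed only later, by the equality of the keys. The balancing argument allows for this: it
-- bounds both excesses along every sequence of guesses between 0 and the block size.
--
-- The radix of each digit of the choice number depends on the digits before it, so the choices of a
-- vector have no simple product description.
--
-- A key has a digit in base `B` per coordinate and two per block, and it serves directly as an
-- address. The table is much sparser than its address range, but it is never initialised or
-- scanned, and the logarithmic criterion charges an address only for its length.
--
-- The same criterion forces a size bound for every register at every moment. These bounds come from
-- an abstract interpretation of the code, whose side conditions are decided by evaluation.

module Prelude where

  open import Data.Bool.Base public using (Bool; true; false; T; not; _∧_; _∨_; if_then_else_)
  open import Data.Bool.Properties public using (T-∧; ∧-zeroʳ; ∧-assoc; ∧-comm)
  open import Data.Fin.Base public using (Fin; zero; suc; toℕ)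
  open import Data.Integer.Base public using (ℤ; 0ℤ; 1ℤ; -1ℤ; +_; -_; +≤+) renaming (_+_ to _+ᶻ_; _*_ to _*ᶻ_; _-_ to _-ᶻ_)
  open import Data.Integer.Tactic.RingSolver public renaming (solve-∀ to solve-∀ᶻ)
  open import Data.List.Base public using (List; []; _∷_)
  open import Data.Nat.Base public
  open import Data.Nat.DivMod public using (m/n≤m; m*n/n≡m; m<n⇒m/n≡0; +-distrib-/-∣ˡ; m/n*n≤m; m%n<n; m%n≡m∸m/n*n; /-monoˡ-≤; m<n*o⇒m/o<n)
  open import Data.Nat.Divisibility public using (n∣m*n)
  open import Data.Nat.Logarithm public
  open import Data.Nat.Properties public
  open import Data.Nat.Tactic.RingSolver public using (solve-∀)
  open import Data.Product.Base public using (_×_; _,_; proj₁; proj₂; ∃-syntax)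
  open import Data.Sum.Base public using (inj₁; inj₂; _⊎_)
  open import Data.Unit.Base public using (⊤; tt)
  open import Data.Vec.Base public using (Vec; []; _∷_; lookup; replicate)
  open import Function.Base public using (_∘_)
  open import Function.Bundles public using (Equivalence)
  open import Relation.Binary.PropositionalEquality public
  open import Relation.Nullary public using (contradiction; yes; no; does)
  open import Relation.Unary public using (Decidable)

-- Counted-loop programs, their execution and the lengths of numbers

module Machine where

  open Prelude

  infixr 5 _⨟_

  -- The only loops are counted ones, so final state and running time are total functions defined by
  -- recursion on the code. The execution relation is needed only once, in `halts`.
  data Code : Set where
    ins   : Instr → Code
    _⨟_   : Code → Code → Code
    cond  : Reg → Code → Code → Code
    loop  : Reg → Code → Code

  -- loop r c runs c as often as r says, counting r down to zero; register 2
  -- serves as the constant one.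
  ⌜_⌝ : Code → Program
  ⌜ ins i ⌝       = instr i
  ⌜ c ⨟ c′ ⌝      = ⌜ c ⌝ ⨾ ⌜ c′ ⌝
  ⌜ cond r c c′ ⌝ = ifNonzero r ⌜ c ⌝ ⌜ c′ ⌝
  ⌜ loop r c ⌝    = whileNonzero r (⌜ c ⌝ ⨾ instr (2 ≔ 1) ⨾ instr (sub r r 2))

  round : Reg → Code → Code
  round r c = c ⨟ ins (2 ≔ 1) ⨟ ins (sub r r 2)

  branch : ∀ {a} {A : Set a} → ℕ → A → A → A
  branch zero     x y = y
  branch (suc _)  x y = x

  iter : ∀ {A : Set} → ℕ → (A → A) → A → A
  iter zero     f x = x
  iter (suc n)  f x = iter n f (f x)

  loopTime : Reg → ℕ → (State → State) → (State → ℕ) → State → ℕ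
  loopTime r zero     f t s = ℓ (reg s r)
  loopTime r (suc n)  f t s = ℓ (reg s r) + (t s + loopTime r n f t (f s))

  -- Opaque, since unfolding the execution of concrete code copies each
  -- intermediate state exponentially often.
  opaque
    exec : Code → State → State
    exec (ins i)        s = effect i s
    exec (c ⨟ c′)       s = exec c′ (exec c s)
    exec (cond r c c′)  s = branch (reg s r) (exec c s) (exec c′ s)
    exec (loop r c)     s = iter (reg s r) (λ s → effect (sub r r 2) (effect (2 ≔ 1) (exec c s))) s

    time : Code → State → ℕ
    time (ins i)        s = cost i s
    time (c ⨟ c′)       s = time c s + time c′ (exec c s)
    time (cond r c c′)  s = ℓ (reg s r) + branch (reg s r) (time c s) (time c′ s)
    time (loop r c)     s =
      loopTime r (reg s r) (exec (round r c))
        (λ s → time c s + (cost (2 ≔ 1) (exec c s) + cost (sub r r 2) (effect (2 ≔ 1) (exec c s)))) s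

  target : Instr → Reg → Bool
  target (r ≔ _)      x = r ≡ᵇ x
  target (r ≔ʳ _)     x = r ≡ᵇ x
  target (add r _ _)  x = r ≡ᵇ x
  target (sub r _ _)  x = r ≡ᵇ x
  target (mul r _ _)  x = r ≡ᵇ x
  target (div r _ _)  x = r ≡ᵇ x
  target (load r _)   x = r ≡ᵇ x
  target (store _ _)  x = false

  writes : Code → Reg → Bool
  writes (ins i)        x = target i x
  writes (c ⨟ c′)       x = writes c x ∨ writes c′ x
  writes (cond _ c c′)  x = writes c x ∨ writes c′ x
  writes (loop r c)     x = (r ≡ᵇ x) ∨ (2 ≡ᵇ x) ∨ writes c x

  -- Every round overwrites register 2 and decrements the counter; if the body leaves the counter
  -- alone and the counter is not register 2, the number of rounds is fixed on entry.
  wellFormed : Code → Bool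
  wellFormed (ins i)        = true
  wellFormed (c ⨟ c′)       = wellFormed c ∧ wellFormed c′
  wellFormed (cond _ c c′)  = wellFormed c ∧ wellFormed c′
  wellFormed (loop r c)     = not (writes c r) ∧ not (2 ≡ᵇ r) ∧ wellFormed c

  ∧-split : ∀ {x y} → T (x ∧ y) → T x × T y
  ∧-split = Equivalence.to T-∧

  ∨-false : ∀ {x y} → T (not (x ∨ y)) → T (not x) × T (not y)
  ∨-false {false} {false} _ = _ , _

  ∨-false₃ : ∀ {x y z} → T (not (x ∨ y ∨ z)) → T (not x) × T (not y) × T (not z)
  ∨-false₃ {false} {false} {false} _ = _ , _ , _

  put-other : ∀ f r v x → T (not (r ≡ᵇ x)) → (f [ r ↦ v ]) x ≡ f x
  put-other f r v x p with r ≡ᵇ x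
  ... | false = refl

  put-same : ∀ f r v → (f [ r ↦ v ]) r ≡ v
  put-same f r v with r ≡ᵇ r | ≡⇒≡ᵇ r r refl
  ... | true | _ = refl

  unwritten-instr : ∀ i s x → T (not (target i x)) → reg (effect i s) x ≡ reg s x
  unwritten-instr (r ≔ c)      s x p = put-other (reg s) r _ x p
  unwritten-instr (r ≔ʳ a)     s x p = put-other (reg s) r _ x p
  unwritten-instr (add r a b)  s x p = put-other (reg s) r _ x p
  unwritten-instr (sub r a b)  s x p = put-other (reg s) r _ x p
  unwritten-instr (mul r a b)  s x p = put-other (reg s) r _ x p
  unwritten-instr (div r a b)  s x p = put-other (reg s) r _ x p
  unwritten-instr (load r a)   s x p = put-other (reg s) r _ x p
  unwritten-instr (store a b)  s x p = refl

  iter-preserves : ∀ {A B : Set} (g : A → B) {f : A → A} → (∀ x → g (f x) ≡ g x) →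
                   ∀ n x → g (iter n f x) ≡ g x
  iter-preserves g h zero     x = refl
  iter-preserves g h (suc n)  x = trans (iter-preserves g h n _) (h x)

  branch-elim : ∀ {a p} {A : Set a} (P : A → Set p) n {x y} → (n ≢ 0 → P x) → (n ≡ 0 → P y) → P (branch n x y)
  branch-elim P zero     f g = g refl
  branch-elim P (suc n)  f g = f (λ ())

  opaque
    unfolding exec time

    -- The frame rule. For concrete code and a concrete register the Boolean condition evaluates, so
    -- that `tt` proves it.
    unwritten : ∀ c s x → T (not (writes c x)) → reg (exec c s) x ≡ reg s x
    unwritten (ins i) s x p = unwritten-instr i s x p
    unwritten (c ⨟ c′) s x p with p₁ , p₂ ← ∨-false {writes c x} p =
      trans (unwritten c′ (exec c s) x p₂) (unwritten c s x p₁)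
    unwritten (cond r c c′) s x p with p₁ , p₂ ← ∨-false {writes c x} p =
      branch-elim (λ t → reg t x ≡ reg s x) (reg s r) (λ _ → unwritten c s x p₁) (λ _ → unwritten c′ s x p₂)
    unwritten (loop r c) s x p with p₁ , p₂ , p₃ ← ∨-false₃ {r ≡ᵇ x} {2 ≡ᵇ x} p =
      iter-preserves (λ t → reg t x)
        (λ t → trans (unwritten-instr (sub r r 2) (effect (2 ≔ 1) (exec c t)) x p₁)
                 (trans (unwritten-instr (2 ≔ 1) (exec c t) x p₂) (unwritten c t x p₃)))
        (reg s r) s

    countdown : ∀ r c s → T (not (writes c r)) → T (not (2 ≡ᵇ r)) →
                reg (exec (round r c) s) r ≡ reg s r ∸ 1
    countdown r c s p q =
      trans (put-same (reg (exec c s) [ 2 ↦ 1 ]) r _)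
        (cong (_∸ 1) (trans (unwritten-instr (2 ≔ 1) (exec c s) r q) (unwritten c s r p)))

    -- For loops the derivation is built by induction on the value of the counter, since `countdown`
    -- says that a round lowers it by exactly one.
    halts : ∀ c s → T (wellFormed c) → ⌜ c ⌝ ∣ s ⇓ exec c s ∣ time c s
    halts-loop : ∀ r c n s → T (not (writes c r)) → T (not (2 ≡ᵇ r)) → T (wellFormed c) → reg s r ≡ n →
                 ⌜ loop r c ⌝ ∣ s ⇓ iter n (exec (round r c)) s ∣ loopTime r n (exec (round r c)) (time (round r c)) s

    halts (ins i)   s w = instr⇓
    halts (c ⨟ c′)  s w with w₁ , w₂ ← ∧-split {wellFormed c} w =
      seq⇓ (halts c s w₁) (halts c′ (exec c s) w₂)
    halts (cond r c c′) s w with w₁ , w₂ ← ∧-split {wellFormed c} w with reg s r in eq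
    ... | zero   = subst (λ t → ⌜ cond r c c′ ⌝ ∣ s ⇓ exec c′ s ∣ ℓ t + time c′ s) eq (else⇓ eq (halts c′ s w₂))
    ... | suc n  = subst (λ t → ⌜ cond r c c′ ⌝ ∣ s ⇓ exec c s ∣ ℓ t + time c s) eq
                     (then⇓ (λ z → contradiction (trans (sym eq) z) λ ()) (halts c s w₁))
    halts (loop r c) s w with w₁ , w₂ ← ∧-split {not (writes c r)} w with w₃ , w₄ ← ∧-split {not (2 ≡ᵇ r)} w₂ =
      halts-loop r c (reg s r) s w₁ w₃ w₄ refl

    halts-loop r c zero     s p q w eq = exit⇓ eq
    halts-loop r c (suc n)  s p q w eq =
      continue⇓ (λ z → contradiction (trans (sym eq) z) λ ())
        (seq⇓ (halts c s w) (seq⇓ instr⇓ instr⇓))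
        (halts-loop r c n (exec (round r c) s) p q w (trans (countdown r c s p q) (cong (_∸ 1) eq)))

  n<2^ℓn : ∀ n → n < 2 ^ ℓ n
  n<2^ℓn n = go n n ≤-refl
    where
    half : ∀ n → n < 2 * suc ⌊ n /2⌋
    half zero           = s≤s z≤n
    half (suc zero)     = s≤s (s≤s z≤n)
    half (suc (suc n))  = subst (suc (suc n) <_) (sym (*-suc 2 (suc ⌊ n /2⌋))) (s≤s (s≤s (half n)))
    go : ∀ b n → n ≤ b → n < 2 ^ ℓ n
    go b zero _ = s≤s z≤n
    go b (suc zero) _ = s≤s (s≤s z≤n)
    go (suc b) (suc (suc n)) (s≤s le) =
      subst (λ e → suc (suc n) < 2 ^ suc e) (trans (cong suc (⌊log₂⌊n/2⌋⌋≡⌊log₂n⌋∸1 (suc (suc n)))) (m+[n∸m]≡n pos))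
        (<-≤-trans (half (suc (suc n))) (*-monoʳ-≤ 2 (go b (suc ⌊ n /2⌋) (≤-trans (s≤s (⌊n/2⌋≤n n)) le))))
      where
      pos : 1 ≤ ⌊log₂ suc (suc n) ⌋
      pos = ⌊log₂⌋-mono-≤ {2} {suc (suc n)} (s≤s (s≤s z≤n))


  ℓ-least : ∀ h {n} → n < 2 ^ suc h → ℓ n ≤ suc h
  ℓ-least h {zero} _ = s≤s z≤n
  ℓ-least h {suc zero} _ = s≤s z≤n
  ℓ-least zero {suc (suc n)} (s≤s (s≤s ()))
  ℓ-least (suc h) {suc (suc n)} n< =
    s≤s (≤-trans (m≤n+m∸n _ 1) (s≤s (subst (_≤ h) (⌊log₂⌊n/2⌋⌋≡⌊log₂n⌋∸1 (suc (suc n))) (≤-pred (ℓ-least h {suc ⌊ n /2⌋} half<)))))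
    where
    half≤ : ∀ n → 2 * ⌊ n /2⌋ ≤ n
    half≤ zero = z≤n
    half≤ (suc zero) = z≤n
    half≤ (suc (suc n)) = subst (_≤ suc (suc n)) (sym (*-suc 2 ⌊ n /2⌋)) (s≤s (s≤s (half≤ n)))
    half< : suc ⌊ n /2⌋ < 2 ^ suc h
    half< = *-cancelˡ-< 2 _ _ (≤-<-trans (half≤ (suc (suc n))) n<)

  ℓ-mono : ∀ {m n} → m ≤ n → ℓ m ≤ ℓ n
  ℓ-mono p = s≤s (⌊log₂⌋-mono-≤ p)

  ℓ-* : ∀ m n → ℓ (m * n) ≤ ℓ m + ℓ n
  ℓ-* m n = ℓ-least _ (subst (m * n <_) (sym (^-distribˡ-+-* 2 (ℓ m) (ℓ n))) (*-mono-< (n<2^ℓn m) (n<2^ℓn n)))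

  ℓ-^ : ∀ m n → ℓ (m ^ n) ≤ suc (n * ℓ m)
  ℓ-^ m zero = s≤s z≤n
  ℓ-^ m (suc n) = ≤-trans (ℓ-* m (m ^ n)) (subst (ℓ m + ℓ (m ^ n) ≤_) (+-suc (ℓ m) (n * ℓ m)) (+-monoʳ-≤ (ℓ m) (ℓ-^ m n)))

  ^-distribʳ-* : ∀ n a b → (a * b) ^ n ≡ a ^ n * b ^ n
  ^-distribʳ-* zero a b = refl
  ^-distribʳ-* (suc n) a b =
    trans (cong (a * b *_) (^-distribʳ-* n a b)) (interchange a b (a ^ n) (b ^ n))
    where
    interchange : ∀ p q r t → (p * q) * (r * t) ≡ (p * r) * (q * t)
    interchange = solve-∀

  quotient≤ : ∀ m n → quotient m n ≤ m
  quotient≤ m zero    = z≤n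
  quotient≤ m (suc n) = m/n≤m m (suc n)

-- Abstract interpretation: bounds for register sizes and costs

module Sizes where

  open Prelude
  open Machine

  -- (a , b) stands for the bound Z ^ a * W ^ b.
  Size : Set
  Size = ℕ × ℕ

  _⊔ˢ_ _⊕ˢ_ : Size → Size → Size
  (a , b) ⊔ˢ (a′ , b′) = a ⊔ a′ , b ⊔ b′
  (a , b) ⊕ˢ (a′ , b′) = a + a′ , b + b′

  weight : Size → ℕ
  weight (a , b) = suc (a + b)

  record Env : Set where
    constructor env
    field
      regs : List Size
      cell : Size
  open Env

  -- The default `(0 , 0)` is the bound 1, not 0, which is harmless for registers holding zero.
  at : List Size → Reg → Size
  at []        _        = 0 , 0
  at (x ∷ xs)  zero     = x
  at (x ∷ xs)  (suc r)  = at xs r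

  put : List Size → Reg → Size → List Size
  put []        zero     v = v ∷ []
  put []        (suc r)  v = (0 , 0) ∷ put [] r v
  put (x ∷ xs)  zero     v = v ∷ xs
  put (x ∷ xs)  (suc r)  v = x ∷ put xs r v

  join : List Size → List Size → List Size
  join []        ys        = ys
  join (x ∷ xs)  []        = x ∷ xs
  join (x ∷ xs)  (y ∷ ys)  = (x ⊔ˢ y) ∷ join xs ys

  -- A sum is at most twice the larger operand, hence one factor W suffices for it, as W is at least
  -- 2. Differences and quotients do not exceed their first operand. All memory cells share one
  -- bound.
  effectSize : Instr → Env → Env
  effectSize (r ≔ c)      (env R μ) = env (put R r (0 , 1)) μ
  effectSize (r ≔ʳ a)     (env R μ) = env (put R r (at R a)) μ
  effectSize (add r a b)  (env R μ) = env (put R r ((at R a ⊔ˢ at R b) ⊕ˢ (0 , 1))) μ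
  effectSize (sub r a b)  (env R μ) = env (put R r (at R a)) μ
  effectSize (mul r a b)  (env R μ) = env (put R r (at R a ⊕ˢ at R b)) μ
  effectSize (div r a b)  (env R μ) = env (put R r (at R a)) μ
  effectSize (load r a)   (env R μ) = env (put R r μ) μ
  effectSize (store a b)  (env R μ) = env R (μ ⊔ˢ at R b)

  costSize : Instr → Env → ℕ
  costSize (r ≔ c)      (env R μ) = 1
  costSize (r ≔ʳ a)     (env R μ) = weight (at R a)
  costSize (add r a b)  (env R μ) = weight (at R a) + weight (at R b)
  costSize (sub r a b)  (env R μ) = weight (at R a) + weight (at R b)
  costSize (mul r a b)  (env R μ) = weight (at R a) + weight (at R b)
  costSize (div r a b)  (env R μ) = weight (at R a) + weight (at R b)
  costSize (load r a)   (env R μ) = weight (at R a) + weight μ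
  costSize (store a b)  (env R μ) = weight (at R a) + weight (at R b)

  -- The clause for `loop` is a placeholder and would be unsound: soundness is claimed for
  -- `loopFree` code only, and loops are treated by `loop-grows`.
  execSize : Code → Env → Env
  execSize (ins i)        E = effectSize i E
  execSize (c ⨟ c′)       E = execSize c′ (execSize c E)
  execSize (cond r c c′)  E =
    env (join (regs (execSize c E)) (regs (execSize c′ E))) (cell (execSize c E) ⊔ˢ cell (execSize c′ E))
  execSize (loop r c)     E = E

  timeSize : Code → Env → ℕ
  timeSize (ins i)        E = costSize i E
  timeSize (c ⨟ c′)       E = timeSize c E + timeSize c′ (execSize c E)
  timeSize (cond r c c′)  E = weight (at (regs E) r) + (timeSize c E + timeSize c′ E)
  timeSize (loop r c)     E = 0

  loopFree : Code → Bool
  loopFree (ins i)        = true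
  loopFree (c ⨟ c′)       = loopFree c ∧ loopFree c′
  loopFree (cond r c c′)  = loopFree c ∧ loopFree c′
  loopFree (loop r c)     = false

  Constants : ℕ → Code → Set
  Constants W (ins (_ ≔ c))   = c ≤ W
  Constants W (ins _)         = ⊤
  Constants W (c ⨟ c′)        = Constants W c × Constants W c′
  Constants W (cond _ c c′)   = Constants W c × Constants W c′
  Constants W (loop _ c)      = Constants W c

  _≤ˢ_by_ : Size → Size → ℕ → Bool
  (a′ , b′) ≤ˢ (a , b) by β = (a′ ≤ᵇ a) ∧ (b′ ≤ᵇ b + β * a)

  _⊑_by_ : List Size → List Size → ℕ → Bool
  []        ⊑ ys        by β = true
  (x ∷ xs)  ⊑ []        by β = (x ≤ˢ (0 , 0) by β) ∧ (xs ⊑ [] by β)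
  (x ∷ xs)  ⊑ (y ∷ ys)  by β = (x ≤ˢ y by β) ∧ (xs ⊑ ys by β)

  _⊑ᴱ_by_ : Env → Env → ℕ → Bool
  env R μ ⊑ᴱ env R′ μ′ by β = (R ⊑ R′ by β) ∧ (μ ≤ˢ μ′ by β)

  ⟦_⟧ : Size → ℕ → ℕ → ℕ
  ⟦ a , b ⟧ Z W = Z ^ a * W ^ b

  record Fits (Z W : ℕ) (E : Env) (s : State) : Set where
    constructor fits
    field
      reg≤ : ∀ r → reg s r ≤ ⟦ at (regs E) r ⟧ Z W
      mem≤ : ∀ a → mem s a ≤ ⟦ cell E ⟧ Z W
  open Fits

  at-put : ∀ R r v x → at (put R r v) x ≡ (if does (r ≟ x) then v else at R x)
  at-put [] zero v zero = refl
  at-put [] zero v (suc x) = refl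
  at-put [] (suc r) v zero = refl
  at-put [] (suc r) v (suc x) = at-put [] r v x
  at-put (y ∷ R) zero v zero = refl
  at-put (y ∷ R) zero v (suc x) = refl
  at-put (y ∷ R) (suc r) v zero = refl
  at-put (y ∷ R) (suc r) v (suc x) = at-put R r v x

  at-join : ∀ R R′ x → at (join R R′) x ≡ at R x ⊔ˢ at R′ x
  at-join [] R′ x = refl
  at-join (y ∷ R) [] zero = cong₂ _,_ (sym (⊔-identityʳ _)) (sym (⊔-identityʳ _))
  at-join (y ∷ R) [] (suc x) = cong₂ _,_ (sym (⊔-identityʳ _)) (sym (⊔-identityʳ _))
  at-join (y ∷ R) (z ∷ R′) zero = refl
  at-join (y ∷ R) (z ∷ R′) (suc x) = at-join R R′ x

  module _ {W : ℕ} (W≥2 : 2 ≤ W) where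

    private instance
      W≢0 : NonZero W
      W≢0 = >-nonZero (≤-trans (s≤s z≤n) W≥2)

    module _ {Z : ℕ} (Z≥1 : 1 ≤ Z) where

      private instance
        Z≢0 : NonZero Z
        Z≢0 = >-nonZero Z≥1

      ⟦⟧-mono : ∀ {a b a′ b′} → a ≤ a′ → b ≤ b′ → ⟦ a , b ⟧ Z W ≤ ⟦ a′ , b′ ⟧ Z W
      ⟦⟧-mono p q = *-mono-≤ (^-monoʳ-≤ Z p) (^-monoʳ-≤ W q)

      ⟦⟧-⊔ˡ : ∀ x y → ⟦ x ⟧ Z W ≤ ⟦ x ⊔ˢ y ⟧ Z W
      ⟦⟧-⊔ˡ (a , b) (a′ , b′) = ⟦⟧-mono (m≤m⊔n a a′) (m≤m⊔n b b′)

      ⟦⟧-⊔ʳ : ∀ x y → ⟦ y ⟧ Z W ≤ ⟦ x ⊔ˢ y ⟧ Z W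
      ⟦⟧-⊔ʳ (a , b) (a′ , b′) = ⟦⟧-mono (m≤n⊔m a a′) (m≤n⊔m b b′)

      ⟦⟧-⊕ : ∀ x y → ⟦ x ⟧ Z W * ⟦ y ⟧ Z W ≡ ⟦ x ⊕ˢ y ⟧ Z W
      ⟦⟧-⊕ (a , b) (a′ , b′) =
        trans (interchange (Z ^ a) (W ^ b) (Z ^ a′) (W ^ b′))
          (cong₂ _*_ (sym (^-distribˡ-+-* Z a a′)) (sym (^-distribˡ-+-* W b b′)))
        where
        interchange : ∀ p q r t → (p * q) * (r * t) ≡ (p * r) * (q * t)
        interchange = solve-∀

      ⟦⟧-W : ⟦ 0 , 1 ⟧ Z W ≡ W
      ⟦⟧-W = trans (+-identityʳ (W * 1)) (*-identityʳ W)

      ⟦⟧-+ : ∀ x y {m n} → m ≤ ⟦ x ⟧ Z W → n ≤ ⟦ y ⟧ Z W → m + n ≤ ⟦ (x ⊔ˢ y) ⊕ˢ (0 , 1) ⟧ Z W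
      ⟦⟧-+ x y {m} {n} p q = begin
        m + n                       ≤⟨ +-mono-≤ (≤-trans p (⟦⟧-⊔ˡ x y)) (≤-trans q (⟦⟧-⊔ʳ x y)) ⟩
        v + v                       ≡⟨ double v ⟩
        v * 2                       ≤⟨ *-monoʳ-≤ v W≥2 ⟩
        v * W                       ≡⟨ cong (v *_) ⟦⟧-W ⟨
        v * ⟦ 0 , 1 ⟧ Z W           ≡⟨ ⟦⟧-⊕ (x ⊔ˢ y) (0 , 1) ⟩
        ⟦ (x ⊔ˢ y) ⊕ˢ (0 , 1) ⟧ Z W ∎
        where
        open ≤-Reasoning
        v = ⟦ x ⊔ˢ y ⟧ Z W
        double : ∀ n → n + n ≡ n * 2
        double = solve-∀

      ℓ-⟦⟧ : ∀ x {n} → n ≤ ⟦ x ⟧ Z W → ℓ n ≤ weight x * (ℓ Z + ℓ W)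
      ℓ-⟦⟧ (a , b) {n} n≤ = begin
        ℓ n                            ≤⟨ ℓ-mono n≤ ⟩
        ℓ (Z ^ a * W ^ b)              ≤⟨ ℓ-* (Z ^ a) (W ^ b) ⟩
        ℓ (Z ^ a) + ℓ (W ^ b)          ≤⟨ +-mono-≤ (ℓ-^ Z a) (ℓ-^ W b) ⟩
        suc (a * ℓ Z) + suc (b * ℓ W)  ≤⟨ +-mono-≤ (+-mono-≤ (s≤s (z≤n {⌊log₂Z⌋})) (*-monoʳ-≤ a (m≤m+n (ℓ Z) (ℓ W))))
                                                   (+-mono-≤ (s≤s (z≤n {⌊log₂W⌋})) (*-monoʳ-≤ b (m≤n+m (ℓ W) (ℓ Z)))) ⟩
        (ℓ Z + a * (ℓ Z + ℓ W)) + (ℓ W + b * (ℓ Z + ℓ W)) ≡⟨ collect a b (ℓ Z) (ℓ W) ⟩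
        weight (a , b) * (ℓ Z + ℓ W)   ∎
        where
        open ≤-Reasoning
        ⌊log₂Z⌋ = pred (ℓ Z)
        ⌊log₂W⌋ = pred (ℓ W)
        collect : ∀ a b z w → (z + a * (z + w)) + (w + b * (z + w)) ≡ suc (a + b) * (z + w)
        collect = solve-∀

      ℓ-⟦⟧₂ : ∀ x y {m n} → m ≤ ⟦ x ⟧ Z W → n ≤ ⟦ y ⟧ Z W → ℓ m + ℓ n ≤ (weight x + weight y) * (ℓ Z + ℓ W)
      ℓ-⟦⟧₂ x y p q = ≤-trans (+-mono-≤ (ℓ-⟦⟧ x p) (ℓ-⟦⟧ y q))
                        (≤-reflexive (sym (*-distribʳ-+ (ℓ Z + ℓ W) (weight x) (weight y))))

      fits-put : ∀ {E s} r v x → Fits Z W E s → v ≤ ⟦ x ⟧ Z W →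
                 Fits Z W (env (put (regs E) r x) (cell E)) (state (reg s [ r ↦ v ]) (mem s))
      fits-put {E} {s} r v x (fits R≤ M≤) v≤ = fits R≤′ M≤
        where
        R≤′ : ∀ y → (reg s [ r ↦ v ]) y ≤ ⟦ at (put (regs E) r x) y ⟧ Z W
        R≤′ y rewrite at-put (regs E) r x y with does (r ≟ y)
        ... | true  = v≤
        ... | false = R≤ y

      effect-fits : ∀ i {E s} → Constants W (ins i) → Fits Z W E s → Fits Z W (effectSize i E) (effect i s)
      effect-fits (r ≔ c) k F = fits-put r c (0 , 1) F (subst (c ≤_) (sym ⟦⟧-W) k)
      effect-fits (r ≔ʳ a) _ F = fits-put r _ _ F (reg≤ F a)
      effect-fits (add r a b) {E} _ F = fits-put r _ _ F (⟦⟧-+ (at (regs E) a) (at (regs E) b) (reg≤ F a) (reg≤ F b))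
      effect-fits (sub r a b) {s = s} _ F = fits-put r _ _ F (≤-trans (m∸n≤m (reg s a) (reg s b)) (reg≤ F a))
      effect-fits (mul r a b) {E} _ F = fits-put r _ _ F
        (≤-trans (*-mono-≤ (reg≤ F a) (reg≤ F b)) (≤-reflexive (⟦⟧-⊕ (at (regs E) a) (at (regs E) b))))
      effect-fits (div r a b) {s = s} _ F = fits-put r _ _ F (≤-trans (quotient≤ (reg s a) (reg s b)) (reg≤ F a))
      effect-fits (load r a) {s = s} _ F = fits-put r _ _ F (mem≤ F (reg s a))
      effect-fits (store a b) {E} {s} _ F = fits (reg≤ F) M≤
        where
        M≤ : ∀ x → (mem s [ reg s a ↦ reg s b ]) x ≤ ⟦ cell E ⊔ˢ at (regs E) b ⟧ Z W
        M≤ x with does (reg s a ≟ x)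
        ... | true  = ≤-trans (reg≤ F b) (⟦⟧-⊔ʳ (cell E) (at (regs E) b))
        ... | false = ≤-trans (mem≤ F x) (⟦⟧-⊔ˡ (cell E) (at (regs E) b))

      cost≤ : ∀ i {E s} → Constants W (ins i) → Fits Z W E s → cost i s ≤ costSize i E * (ℓ Z + ℓ W)
      cost≤ (r ≔ c) k F = ≤-trans (ℓ-mono k) (≤-trans (m≤n+m (ℓ W) (ℓ Z)) (≤-reflexive (sym (+-identityʳ _))))
      cost≤ (r ≔ʳ a) {E} _ F = ℓ-⟦⟧ (at (regs E) a) (reg≤ F a)
      cost≤ (add r a b) {E} _ F = ℓ-⟦⟧₂ (at (regs E) a) (at (regs E) b) (reg≤ F a) (reg≤ F b)
      cost≤ (sub r a b) {E} _ F = ℓ-⟦⟧₂ (at (regs E) a) (at (regs E) b) (reg≤ F a) (reg≤ F b)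
      cost≤ (mul r a b) {E} _ F = ℓ-⟦⟧₂ (at (regs E) a) (at (regs E) b) (reg≤ F a) (reg≤ F b)
      cost≤ (div r a b) {E} _ F = ℓ-⟦⟧₂ (at (regs E) a) (at (regs E) b) (reg≤ F a) (reg≤ F b)
      cost≤ (load r a) {E} {s} _ F = ℓ-⟦⟧₂ (at (regs E) a) (cell E) (reg≤ F a) (mem≤ F (reg s a))
      cost≤ (store a b) {E} _ F = ℓ-⟦⟧₂ (at (regs E) a) (at (regs E) b) (reg≤ F a) (reg≤ F b)

      opaque
        unfolding exec time

        exec-fits : ∀ c {E s} → T (loopFree c) → Constants W c → Fits Z W E s → Fits Z W (execSize c E) (exec c s)
        exec-fits (ins i) _ k F = effect-fits i k F
        exec-fits (c ⨟ c′) l (k , k′) F with l₁ , l₂ ← ∧-split {loopFree c} l =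
          exec-fits c′ l₂ k′ (exec-fits c l₁ k F)
        exec-fits (cond r c c′) {E} {s} l (k , k′) F with l₁ , l₂ ← ∧-split {loopFree c} l =
          branch-elim (Fits Z W (execSize (cond r c c′) E)) (reg s r)
            (λ _ → let F₁ = exec-fits c l₁ k F in fits
              (λ x → ≤-trans (reg≤ F₁ x) (subst (λ z → ⟦ at (regs (execSize c E)) x ⟧ Z W ≤ ⟦ z ⟧ Z W) (sym (at-join (regs (execSize c E)) _ x)) (⟦⟧-⊔ˡ (at (regs (execSize c E)) x) _)))
              (λ x → ≤-trans (mem≤ F₁ x) (⟦⟧-⊔ˡ (cell (execSize c E)) _)))
            (λ _ → let F₁ = exec-fits c′ l₂ k′ F in fits
              (λ x → ≤-trans (reg≤ F₁ x) (subst (λ z → ⟦ at (regs (execSize c′ E)) x ⟧ Z W ≤ ⟦ z ⟧ Z W) (sym (at-join (regs (execSize c E)) _ x)) (⟦⟧-⊔ʳ (at (regs (execSize c E)) x) _)))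
              (λ x → ≤-trans (mem≤ F₁ x) (⟦⟧-⊔ʳ (cell (execSize c E)) (cell (execSize c′ E)))))

        time≤ : ∀ c {E s} → T (loopFree c) → Constants W c → Fits Z W E s → time c s ≤ timeSize c E * (ℓ Z + ℓ W)
        time≤ (ins i) _ k F = cost≤ i k F
        time≤ (c ⨟ c′) {E} l (k , k′) F with l₁ , l₂ ← ∧-split {loopFree c} l =
          ≤-trans (+-mono-≤ (time≤ c l₁ k F) (time≤ c′ l₂ k′ (exec-fits c l₁ k F)))
            (≤-reflexive (sym (*-distribʳ-+ (ℓ Z + ℓ W) (timeSize c E) (timeSize c′ (execSize c E)))))
        time≤ (cond r c c′) {E} {s} l (k , k′) F with l₁ , l₂ ← ∧-split {loopFree c} l =
          ≤-trans
            (+-mono-≤ (ℓ-⟦⟧ (at (regs E) r) (reg≤ F r))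
              (branch-elim (_≤ (timeSize c E + timeSize c′ E) * (ℓ Z + ℓ W)) (reg s r)
                (λ _ → ≤-trans (time≤ c l₁ k F) (*-monoˡ-≤ (ℓ Z + ℓ W) (m≤m+n (timeSize c E) (timeSize c′ E))))
                (λ _ → ≤-trans (time≤ c′ l₂ k′ F) (*-monoˡ-≤ (ℓ Z + ℓ W) (m≤n+m (timeSize c′ E) (timeSize c E))))))
            (≤-reflexive (sym (*-distribʳ-+ (ℓ Z + ℓ W) (weight (at (regs E) r)) (timeSize c E + timeSize c′ E))))

      -- A shift by β * a in the second exponent is the effect of replacing Z by
      -- Z * W ^ β.
      ≤ˢ-sound : ∀ β x y → T (x ≤ˢ y by β) → ⟦ x ⟧ Z W ≤ ⟦ y ⟧ (Z * W ^ β) W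
      ≤ˢ-sound β (a′ , b′) (a , b) p with p₁ , p₂ ← ∧-split {a′ ≤ᵇ a} p = begin
        Z ^ a′ * W ^ b′               ≤⟨ ⟦⟧-mono (≤ᵇ⇒≤ a′ a p₁) (≤ᵇ⇒≤ b′ (b + β * a) p₂) ⟩
        Z ^ a * W ^ (b + β * a)       ≡⟨ cong (Z ^ a *_) (^-distribˡ-+-* W b (β * a)) ⟩
        Z ^ a * (W ^ b * W ^ (β * a)) ≡⟨ cong (λ t → Z ^ a * (W ^ b * t)) (^-*-assoc W β a) ⟨
        Z ^ a * (W ^ b * (W ^ β) ^ a) ≡⟨ shuffle (Z ^ a) (W ^ b) ((W ^ β) ^ a) ⟩
        (Z ^ a * (W ^ β) ^ a) * W ^ b ≡⟨ cong (_* W ^ b) (^-distribʳ-* a Z (W ^ β)) ⟨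
        (Z * W ^ β) ^ a * W ^ b       ∎
        where
        open ≤-Reasoning
        shuffle : ∀ p q r → p * (q * r) ≡ (p * r) * q
        shuffle = solve-∀

      ⊑-sound : ∀ β R R′ → T (R ⊑ R′ by β) → ∀ x → ⟦ at R x ⟧ Z W ≤ ⟦ at R′ x ⟧ (Z * W ^ β) W
      ⊑-sound β [] R′ p x with at R′ x
      ... | a , b = *-mono-≤ (m^n>0 (Z * W ^ β) {{m*n≢0 Z (W ^ β) {{Z≢0}} {{m^n≢0 W β}}}} a) (m^n>0 W b)
      ⊑-sound β (y ∷ R) [] p x with p₁ , p₂ ← ∧-split {y ≤ˢ (0 , 0) by β} p with x
      ... | zero = ≤ˢ-sound β y (0 , 0) p₁
      ... | suc x = ⊑-sound β R [] p₂ x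
      ⊑-sound β (y ∷ R) (y′ ∷ R′) p x with p₁ , p₂ ← ∧-split {y ≤ˢ y′ by β} p with x
      ... | zero = ≤ˢ-sound β y y′ p₁
      ... | suc x = ⊑-sound β R R′ p₂ x

      ⊑ᴱ-sound : ∀ β E E′ {s} → T (E ⊑ᴱ E′ by β) → Fits Z W E s → Fits (Z * W ^ β) W E′ s
      ⊑ᴱ-sound β (env R μ) (env R′ μ′) p F with p₁ , p₂ ← ∧-split {R ⊑ R′ by β} p =
        fits (λ r → ≤-trans (reg≤ F r) (⊑-sound β R R′ p₁ r)) (λ a → ≤-trans (mem≤ F a) (≤ˢ-sound β μ μ′ p₂))

    opaque
      unfolding exec time

      -- A single symbolic round is enough: if its result fits `E` up to a shift by `β`, then `E`
      -- describes the state again once Z is replaced by Z * W ^ β. After n rounds numbers have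
      -- grown by a power of W linear in n, so their lengths stay polynomial. Every round is charged
      -- at the final, largest Z.
      loop-grows : ∀ r c E β → T (loopFree c) → Constants W c → T (execSize (round r c) E ⊑ᴱ E by β) →
                   ∀ n {Z s} → 1 ≤ Z → Fits Z W E s →
                   Fits (Z * W ^ (β * n)) W E (iter n (exec (round r c)) s) ×
                   loopTime r n (exec (round r c)) (time (round r c)) s ≤
                     suc n * ((weight (at (regs E) r) + timeSize (round r c) E) * (ℓ (Z * W ^ (β * n)) + ℓ W))
      loop-grows r c E β l k ok zero {Z} {s} Z≥1 F
        rewrite *-zeroʳ β | *-identityʳ Z =
          F , ≤-trans (ℓ-⟦⟧ Z≥1 (at (regs E) r) (reg≤ F r))
                (≤-trans (*-monoˡ-≤ (ℓ Z + ℓ W) (m≤m+n (weight (at (regs E) r)) _)) (m≤m+n _ 0))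
      loop-grows r c E β l k ok (suc n) {Z} {s} Z≥1 F =
        subst (λ z → Fits z W E (iter n (exec (round r c)) (exec (round r c) s))) same (proj₁ rest) ,
        (begin
          ℓ (reg s r) + (time (round r c) s + loopTime r n (exec (round r c)) (time (round r c)) (exec (round r c) s))
            ≡⟨ +-assoc (ℓ (reg s r)) (time (round r c) s) _ ⟨
          (ℓ (reg s r) + time (round r c) s) + loopTime r n (exec (round r c)) (time (round r c)) (exec (round r c) s)
            ≤⟨ +-mono-≤ here (proj₂ rest) ⟩
          κ * (ℓ (Z * W ^ β * W ^ (β * n)) + ℓ W) + suc n * (κ * (ℓ (Z * W ^ β * W ^ (β * n)) + ℓ W))
            ≡⟨ cong (λ z → suc (suc n) * (κ * (ℓ z + ℓ W))) same ⟩
          suc (suc n) * (κ * (ℓ (Z * W ^ (β * suc n)) + ℓ W)) ∎)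
        where
        open ≤-Reasoning
        κ : ℕ
        κ = weight (at (regs E) r) + timeSize (round r c) E
        same : Z * W ^ β * W ^ (β * n) ≡ Z * W ^ (β * suc n)
        same = trans (*-assoc Z (W ^ β) (W ^ (β * n)))
                 (cong (Z *_) (trans (sym (^-distribˡ-+-* W β (β * n))) (cong (W ^_) (sym (*-suc β n)))))
        l′ : T (loopFree (round r c))
        l′ with loopFree c
        ... | true = tt
        k′ : Constants W (round r c)
        k′ = k , ≤-trans (s≤s z≤n) W≥2 , tt
        rest : Fits (Z * W ^ β * W ^ (β * n)) W E (iter n (exec (round r c)) (exec (round r c) s)) ×
               loopTime r n (exec (round r c)) (time (round r c)) (exec (round r c) s) ≤
                 suc n * (κ * (ℓ (Z * W ^ β * W ^ (β * n)) + ℓ W))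
        rest = loop-grows r c E β l k ok n (*-mono-≤ Z≥1 (m^n>0 W β))
                 (⊑ᴱ-sound Z≥1 β (execSize (round r c) E) E ok (exec-fits Z≥1 (round r c) l′ k′ F))
        Z≤ : Z ≤ Z * W ^ β * W ^ (β * n)
        Z≤ = subst (Z ≤_) (sym same) (m≤m*n Z (W ^ (β * suc n)) {{m^n≢0 W (β * suc n)}})
        here : ℓ (reg s r) + time (round r c) s ≤ κ * (ℓ (Z * W ^ β * W ^ (β * n)) + ℓ W)
        here = ≤-trans
          (≤-trans (+-mono-≤ (ℓ-⟦⟧ Z≥1 (at (regs E) r) (reg≤ F r)) (time≤ Z≥1 (round r c) l′ k′ F))
            (≤-reflexive (sym (*-distribʳ-+ (ℓ Z + ℓ W) (weight (at (regs E) r)) (timeSize (round r c) E)))))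
          (*-monoʳ-≤ κ (+-monoˡ-≤ (ℓ W) (ℓ-mono Z≤)))

      loop-fits : ∀ r c E β → T (loopFree c) → Constants W c → T (execSize (round r c) E ⊑ᴱ E by β) →
                  ∀ {Z t} → 1 ≤ Z → Fits Z W E t →
                  Fits (Z * W ^ (β * reg t r)) W E (exec (loop r c) t) ×
                  time (loop r c) t ≤
                    suc (reg t r) * ((weight (at (regs E) r) + timeSize (round r c) E) * (ℓ (Z * W ^ (β * reg t r)) + ℓ W))
      loop-fits r c E β l k ok {t = t} Z≥1 F = loop-grows r c E β l k ok (reg t r) Z≥1 F

    ⊑ᴱ-sound₀ : ∀ E E′ {Z t} → 1 ≤ Z → T (E ⊑ᴱ E′ by 0) → Fits Z W E t → Fits Z W E′ t
    ⊑ᴱ-sound₀ E E′ {Z} {t} Z≥1 ok F = subst (λ z → Fits z W E′ t) (*-identityʳ Z) (⊑ᴱ-sound Z≥1 0 E E′ ok F)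

  opaque
    unfolding exec time

    time-⨟ : ∀ c c′ t → time (c ⨟ c′) t ≡ time c t + time c′ (exec c t)
    time-⨟ c c′ t = refl

    time-loop : ∀ r c t → time (loop r c) t ≡ loopTime r (reg t r) (exec (round r c)) (time (round r c)) t
    time-loop r c t = refl

-- Finite sums, digits and sums of finite support

module Sums where

  import Data.Integer.Properties as ℤ
  open Prelude
  open Machine

  ∑ : ℕ → (ℕ → ℤ) → ℤ
  ∑ zero     f = 0ℤ
  ∑ (suc n)  f = f n +ᶻ ∑ n f

  ∑-cong : ∀ n {f g} → (∀ i → i < n → f i ≡ g i) → ∑ n f ≡ ∑ n g
  ∑-cong zero     h = refl
  ∑-cong (suc n)  h = cong₂ _+ᶻ_ (h n ≤-refl) (∑-cong n (λ i i< → h i (m<n⇒m<1+n i<)))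

  ∑-zero : ∀ n {f} → (∀ i → i < n → f i ≡ 0ℤ) → ∑ n f ≡ 0ℤ
  ∑-zero zero     h = refl
  ∑-zero (suc n)  h = cong₂ _+ᶻ_ (h n ≤-refl) (∑-zero n (λ i i< → h i (m<n⇒m<1+n i<)))

  +-interchange : ∀ a b c d → (a +ᶻ b) +ᶻ (c +ᶻ d) ≡ (a +ᶻ c) +ᶻ (b +ᶻ d)
  +-interchange a b c d = trans (ℤ.+-assoc a b _) (trans (cong (a +ᶻ_)
    (trans (sym (ℤ.+-assoc b c d)) (trans (cong (_+ᶻ d) (ℤ.+-comm b c)) (ℤ.+-assoc c b d)))) (sym (ℤ.+-assoc a c _)))

  ∑-+ : ∀ n f g → ∑ n (λ i → f i +ᶻ g i) ≡ ∑ n f +ᶻ ∑ n g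
  ∑-+ zero f g = refl
  ∑-+ (suc n) f g = trans (cong ((f n +ᶻ g n) +ᶻ_) (∑-+ n f g)) (+-interchange (f n) (g n) _ _)

  ∑-swap : ∀ m n (f : ℕ → ℕ → ℤ) → ∑ m (λ i → ∑ n (f i)) ≡ ∑ n (λ j → ∑ m (λ i → f i j))
  ∑-swap zero     n f = sym (∑-zero n (λ _ _ → refl))
  ∑-swap (suc m)  n f = trans (cong (∑ n (f m) +ᶻ_) (∑-swap m n f)) (sym (∑-+ n (f m) _))

  ∑-*ˡ : ∀ n c f → c *ᶻ ∑ n f ≡ ∑ n (λ i → c *ᶻ f i)
  ∑-*ˡ zero c f = ℤ.*-zeroʳ c
  ∑-*ˡ (suc n) c f = trans (ℤ.*-distribˡ-+ c (f n) _) (cong (c *ᶻ f n +ᶻ_) (∑-*ˡ n c f))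

  ∑-split : ∀ m n f → ∑ (m + n) f ≡ ∑ m f +ᶻ ∑ n (λ i → f (m + i))
  ∑-split m zero f = trans (cong (λ k → ∑ k f) (+-identityʳ m)) (sym (ℤ.+-identityʳ _))
  ∑-split m (suc n) f = begin
    ∑ (m + suc n) f               ≡⟨ cong (λ k → ∑ k f) (+-suc m n) ⟩
    f (m + n) +ᶻ ∑ (m + n) f      ≡⟨ cong (f (m + n) +ᶻ_) (∑-split m n f) ⟩
    f (m + n) +ᶻ (∑ m f +ᶻ S)     ≡⟨ ℤ.+-assoc (f (m + n)) (∑ m f) S ⟨
    (f (m + n) +ᶻ ∑ m f) +ᶻ S     ≡⟨ cong (_+ᶻ S) (ℤ.+-comm (f (m + n)) (∑ m f)) ⟩
    (∑ m f +ᶻ f (m + n)) +ᶻ S     ≡⟨ ℤ.+-assoc (∑ m f) (f (m + n)) S ⟩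
    ∑ m f +ᶻ (f (m + n) +ᶻ S)     ∎
    where
    open ≡-Reasoning
    S = ∑ n (λ i → f (m + i))

  ∑-single : ∀ n {f} k → k < n → (∀ i → i < n → i ≢ k → f i ≡ 0ℤ) → ∑ n f ≡ f k
  ∑-single (suc n) {f} k k< h with k ≟ n
  ... | yes refl = trans (cong (f n +ᶻ_) (∑-zero n (λ i i< → h i (m<n⇒m<1+n i<) (<⇒≢ i<)))) (ℤ.+-identityʳ (f n))
  ... | no k≢n = trans (cong₂ _+ᶻ_ (h n ≤-refl (k≢n ∘ sym)) (∑-single n k (≤∧≢⇒< (≤-pred k<) k≢n) (λ i i< → h i (m<n⇒m<1+n i<)))) (ℤ.+-identityˡ (f k))

  ∑-pad : ∀ {m n f} → m ≤ n → (∀ i → m ≤ i → f i ≡ 0ℤ) → ∑ n f ≡ ∑ m f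
  ∑-pad {m} {n} {f} m≤n h = trans (cong (λ k → ∑ k f) (sym (m+[n∸m]≡n m≤n)))
    (trans (∑-split m (n ∸ m) f) (trans (cong (∑ m f +ᶻ_) (∑-zero (n ∸ m) (λ i _ → h (m + i) (m≤m+n m i)))) (ℤ.+-identityʳ _)))

  -- The remainder in the form in which the machine obtains it, by a division, a multiplication and
  -- a subtraction.
  digit : ℕ → ℕ → ℕ
  digit e b = e ∸ quotient e b * b

  digit< : ∀ e {b} → 1 ≤ b → digit e b < b
  digit< e {suc b} _ = subst (_< suc b) (m%n≡m∸m/n*n e (suc b)) (m%n<n e (suc b))

  quotient-digit : ∀ e {b} → 1 ≤ b → e ≡ digit e b + quotient e b * b
  quotient-digit e {suc b} _ = sym (m∸n+n≡m (m/n*n≤m e (suc b)))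

  quotient-unique : ∀ a {b i} → i < b → quotient (a * b + i) b ≡ a
  quotient-unique a {suc b} {i} i< = trans (+-distrib-/-∣ˡ i (n∣m*n a))
    (trans (cong₂ _+_ (m*n/n≡m a (suc b)) (m<n⇒m/n≡0 i<)) (+-identityʳ a))

  digit-unique : ∀ a {b i} → i < b → digit (a * b + i) b ≡ i
  digit-unique a {b} {i} i< = trans (cong (λ q → (a * b + i) ∸ q * b) (quotient-unique a i<)) (m+n∸m≡n (a * b) i)

  ∑-product : ∀ a b (g : ℕ → ℕ → ℤ) → ∑ (a * b) (λ e → g (quotient e b) (digit e b)) ≡ ∑ a (λ i → ∑ b (g i))
  ∑-product zero b g = refl
  ∑-product (suc a) b g =
    trans (cong (λ k → ∑ k h) (+-comm b (a * b)))
    (trans (∑-split (a * b) b h)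
    (trans (ℤ.+-comm (∑ (a * b) h) _)
    (cong₂ _+ᶻ_ (∑-cong b (λ i i< → cong₂ g (quotient-unique a i<) (digit-unique a i<))) (∑-product a b g))))
    where h = λ e → g (quotient e b) (digit e b)

  -- The function has finite support and total v. Where the support ends is left open, because it
  -- differs between the branches of a choice tree.
  _⇝_ : (ℕ → ℤ) → ℤ → Set
  f ⇝ v = ∃[ n ] (∀ i → n ≤ i → f i ≡ 0ℤ) × ∑ n f ≡ v

  ⇝-∑ : ∀ {f v m} → f ⇝ v → (∀ i → m ≤ i → f i ≡ 0ℤ) → ∑ m f ≡ v
  ⇝-∑ {m = m} (n , h , eq) h′ =
    trans (sym (∑-pad (m≤m⊔n m n) h′)) (trans (∑-pad (m≤n⊔m m n) h) eq)

  ⇝-widen : ∀ {f v} (p : f ⇝ v) m → proj₁ p ≤ m → ∑ m f ≡ v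
  ⇝-widen (n , h , eq) m n≤m = trans (∑-pad n≤m h) eq

  -- Numbers e correspond to pairs of a lowest digit δ and a quotient. The supports for the various
  -- δ are padded to their maximum `N β`, after which the double sum can be exchanged.
  ⇝-digit : ∀ β {F : ℕ → ℕ → ℤ} {v} → 1 ≤ β → (∀ δ → F δ ⇝ v δ) →
            (λ e → F (digit e β) (quotient e β)) ⇝ ∑ β v
  ⇝-digit β {F} {v} 1≤β p = N β * β , beyond , total
    where
    N : ℕ → ℕ
    N zero     = 0
    N (suc n)  = proj₁ (p n) ⊔ N n
    N-bound : ∀ n δ → δ < n → proj₁ (p δ) ≤ N n
    N-bound (suc n) δ δ< with δ ≟ n
    ... | yes refl = m≤m⊔n _ (N n)
    ... | no δ≢n = ≤-trans (N-bound n δ (≤∧≢⇒< (≤-pred δ<) δ≢n)) (m≤n⊔m (proj₁ (p n)) (N n))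
    beyond : ∀ e → N β * β ≤ e → F (digit e β) (quotient e β) ≡ 0ℤ
    beyond e le = proj₁ (proj₂ (p (digit e β))) (quotient e β)
      (≤-trans (N-bound β (digit e β) (digit< e 1≤β)) (N≤ 1≤β le))
      where
      N≤ : ∀ {β n e} → 1 ≤ β → n * β ≤ e → n ≤ quotient e β
      N≤ {suc β} {n} {e} _ le = subst (_≤ e / suc β) (m*n/n≡m n (suc β)) (/-monoˡ-≤ (suc β) le)
    total : ∑ (N β * β) (λ e → F (digit e β) (quotient e β)) ≡ ∑ β v
    total = trans (∑-product (N β) β (λ q δ → F δ q)) (trans (∑-swap (N β) β (λ q δ → F δ q))
      (∑-cong β (λ δ δ< → ⇝-widen (p δ) (N β) (N-bound β δ δ<))))

-- Keys, choice trees and the signed count of common keys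

module Decomposition where

  import Data.Integer.Properties as ℤ
  open Prelude
  open Machine
  open Sums

  data Role : Set where
    left right : Role

  pick : ∀ {A : Set} → Role → A → A → A
  pick left   x y = x
  pick right  x y = y

  -- How one side treats a coordinate of its vector: copy it into the key, or
  -- choose a bit that is free only where the coordinate is zero (one).
  data Mode : Set where
    copy free₀ free₁ : Mode

  f₀ f₁ copies : Mode → ℕ
  f₀ free₀ = 1
  f₀ _     = 0
  f₁ free₁ = 1
  f₁ _     = 0
  copies m = 1 ∸ f₀ m ∸ f₁ m

  -- Three decompositions of the disjointness matrix of one coordinate.  The
  -- first two have entries (x = z) (y z = 0) and (y = z) (x z = 0), summed over
  -- the bit z; the last one is the signed sum (-1) ^ z (z ≤ x) (z ≤ y).
  data Option : Set where
    copyLeft copyRight signed : Option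

  modeOf : Role → Option → Mode
  modeOf left   copyLeft   = copy
  modeOf left   copyRight  = free₀
  modeOf right  copyLeft   = free₀
  modeOf right  copyRight  = copy
  modeOf _      signed     = free₁

  -- The state of a walk along one vector: `k` coordinates remain in the block; `w₁`, `w₂` are the
  -- excesses of the two sides, three times the bits minus the block sizes, cut off at zero; `rem`
  -- ones of the own guess are still to come; `bad` is positive once a guess has been refuted; `sg`
  -- is the parity of the sign.
  record Ctl : Set where
    constructor ctl
    field
      k w₁ w₂  : ℕ
      mode     : Mode
      rem bad  : ℕ
      key sg   : ℕ
  open Ctl public

  radix : Mode → ℕ → ℕ
  radix m x = branch x (f₁ m) (f₀ m) + 1

  sign : ℕ → ℤ
  sign sg = branch sg -1ℤ 1ℤ

  ∑-cong′ : ∀ n {f g : ℕ → ℤ} → (∀ i → f i ≡ g i) → ∑ n f ≡ ∑ n g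
  ∑-cong′ n h = ∑-cong n (λ i _ → h i)

  ≢⇒≡ᵇ-false : ∀ {m n} → m ≢ n → (m ≡ᵇ n) ≡ false
  ≢⇒≡ᵇ-false {m} {n} m≢n with m ≡ᵇ n in eq
  ... | false = refl
  ... | true = contradiction (≡ᵇ⇒≡ m n (subst T (sym eq) _)) m≢n

  ≡ᵇ-refl : ∀ m → (m ≡ᵇ m) ≡ true
  ≡ᵇ-refl zero    = refl
  ≡ᵇ-refl (suc m) = ≡ᵇ-refl m

  orthogonal : ∀ {d} → Vec (Fin 2) d → Vec (Fin 2) d → Bool
  orthogonal [] [] = true
  orthogonal (zero ∷ xs)     (_ ∷ ys)         = orthogonal xs ys
  orthogonal (suc zero ∷ xs) (zero ∷ ys)      = orthogonal xs ys
  orthogonal (suc zero ∷ xs) (suc zero ∷ ys)  = false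

  fine : ℕ → ℕ → ℕ → Bool
  fine bd r c = (bd ≡ᵇ 0) ∧ (r ≡ᵇ c)

  -- The truncated difference `x ∸ r` is 1 exactly when a one arrives although the guess is
  -- exhausted, and then both sides are false. Otherwise reading x lowers the announced and the
  -- actual number of ones alike.
  fine-coord : ∀ bd r (x : Fin 2) c → fine (bd + (toℕ x ∸ r)) (r ∸ toℕ x) c ≡ fine bd r (toℕ x + c)
  fine-coord bd r       zero       c rewrite 0∸n≡0 r | +-identityʳ bd = refl
  fine-coord bd zero    (suc zero) c rewrite +-comm bd 1 | ∧-zeroʳ (bd ≡ᵇ 0) = refl
  fine-coord bd (suc r) (suc zero) c rewrite 0∸n≡0 r | +-identityʳ bd = refl

  fine-block : ∀ bd r → (bd + r ≡ᵇ 0) ≡ fine bd r 0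
  fine-block zero r = refl
  fine-block (suc bd) r = refl

  data Compatible : Mode → Mode → Set where
    copyLeft   : Compatible copy free₀
    copyRight  : Compatible free₀ copy
    signed     : Compatible free₁ free₁

  compatible : ∀ o → Compatible (modeOf left o) (modeOf right o)
  compatible copyLeft   = copyLeft
  compatible copyRight  = copyRight
  compatible signed     = signed

  value : Bool → ℕ → ℤ
  value g sg = if g then sign sg else 0ℤ

  value-flip : ∀ g sg → value g (1 ∸ sg) +ᶻ value g sg ≡ 0ℤ
  value-flip false sg       = refl
  value-flip true  zero     = refl
  value-flip true  (suc sg) rewrite 0∸n≡0 sg = refl

  module Walk (s-1 : ℕ) where

    -- With s minus one as parameter, s is positive by construction. A digit in base `B` then holds
    -- any count from 0 to s, and also any bit.
    s B : ℕ
    s = suc s-1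
    B = suc s

    -- The number of free bits in a block with a and b ones.
    left-cost right-cost : Option → ℕ → ℕ → ℕ
    left-cost copyLeft   a b = 0
    left-cost copyRight  a b = s ∸ a
    left-cost signed     a b = a
    right-cost copyLeft   a b = s ∸ b
    right-cost copyRight  a b = 0
    right-cost signed     a b = b

    -- On average over the options, 3 (w₁ left-cost + w₂ right-cost) equals
    -- s (w₁ + w₂), so some option does not exceed this.
    choose : ℕ → ℕ → ℕ → ℕ → Option
    choose w₁ w₂ a b =
      branch ((s ∸ b) * w₂ * 3 ∸ (w₁ + w₂) * s)
        (branch ((s ∸ a) * w₁ * 3 ∸ (w₁ + w₂) * s) signed copyRight)
        copyLeft

    -- Ones announced for the previous block that never came are moved from `rem` to `bad`. Both
    -- guesses enter the key, but only the own one is kept for verification. Both sides update both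
    -- excesses from the same guesses, so equal keys imply equal options.
    block : Role → ℕ → ℕ → Ctl → Ctl
    block ρ a b (ctl k w₁ w₂ m r bd κ sg) =
      ctl s (w₁ + left-cost o a b * 3 ∸ s) (w₂ + right-cost o a b * 3 ∸ s) (modeOf ρ o)
        (pick ρ a b) (bd + r) ((κ * B + a) * B + b) sg
      where o = choose w₁ w₂ a b

    -- The digit `δ + copies m * x` is the bit z of the decomposition: in mode `copy` the radix is
    -- 1, so δ is 0 and z is x; otherwise z is δ. The sign flips only for z = 1 in mode `free₁`.
    coord : ℕ → ℕ → Ctl → Ctl
    coord x δ (ctl k w₁ w₂ m r bd κ sg) =
      ctl (k ∸ 1) w₁ w₂ m (r ∸ x) (bd + (x ∸ r)) (κ * B + (δ + copies m * x)) (branch (f₁ m * δ) (1 ∸ sg) sg)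

    -- A block is opened just before its first coordinate is read, so no guesses are spent after the
    -- end of the vector.
    open-block : Role → Ctl → ℕ → Ctl × ℕ
    open-block ρ σ e = branch (k σ) (σ , e)
      (block ρ (digit e B) (digit (quotient e B) B) σ , quotient (quotient e B) B)

    walk-coord : ℕ → Ctl × ℕ → Ctl × ℕ
    walk-coord x (σ , e) = coord x (digit e (radix (mode σ) x)) σ , quotient e (radix (mode σ) x)

    walk : ∀ {d} → Role → Vec (Fin 2) d → Ctl × ℕ → Ctl × ℕ
    walk ρ []        p = p
    walk ρ (x ∷ xs)  p = walk ρ xs (walk-coord (toℕ x) (open-block ρ (proj₁ p) (proj₂ p)))

    opens : Role → Ctl → (Ctl → ℤ) → ℤ
    opens ρ σ f = branch (k σ) (f σ) (∑ B λ a → ∑ B λ b → f (block ρ a b σ))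

    paths : ∀ {d} → Role → Vec (Fin 2) d → Ctl → (Ctl → ℤ) → ℤ
    paths ρ []        σ f = f σ
    paths ρ (x ∷ xs)  σ f = opens ρ σ λ τ → ∑ (radix (mode τ) (toℕ x)) λ δ → paths ρ xs (coord (toℕ x) δ τ) f

    settle : (Ctl → ℤ) → Ctl × ℕ → ℤ
    settle f (σ , e) = branch e 0ℤ (f σ)

    1≤radix : ∀ m x → 1 ≤ radix m x
    1≤radix m x = m≤n+m 1 _

    -- A path is written in mixed radix, lowest digit first, where the digits read so far determine
    -- the next radix. This is why the sum is assembled digit by digit rather than from a product of
    -- ranges.
    walk-paths : ∀ {d} ρ (xs : Vec (Fin 2) d) σ f → (λ e → settle f (walk ρ xs (σ , e))) ⇝ paths ρ xs σ f
    walk-paths ρ [] σ f = 1 , (λ { (suc _) _ → refl }) , ℤ.+-identityʳ (f σ)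
    walk-paths ρ (x ∷ xs) σ@(ctl (suc _) _ _ _ _ _ _ _) f =
      ⇝-digit (radix (mode σ) (toℕ x)) (1≤radix (mode σ) (toℕ x)) (λ δ → walk-paths ρ xs (coord (toℕ x) δ σ) f)
    walk-paths ρ (x ∷ xs) σ@(ctl zero _ _ _ _ _ _ _) f = ⇝-digit B (s≤s z≤n) λ a → ⇝-digit B (s≤s z≤n) λ b →
            ⇝-digit (radix (mode (block ρ a b σ)) (toℕ x)) (1≤radix (mode (block ρ a b σ)) (toℕ x))
              (λ δ → walk-paths ρ xs (coord (toℕ x) δ (block ρ a b σ)) f)

    opens-cong : ∀ ρ σ {f g : Ctl → ℤ} → (∀ τ → f τ ≡ g τ) → opens ρ σ f ≡ opens ρ σ g
    opens-cong ρ σ h with k σ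
    ... | zero   = ∑-cong′ B λ a → ∑-cong′ B λ b → h _
    ... | suc _  = h σ

    ∑-opens : ∀ n ρ σ (h : ℕ → Ctl → ℤ) → ∑ n (λ i → opens ρ σ (h i)) ≡ opens ρ σ (λ τ → ∑ n (λ i → h i τ))
    ∑-opens n ρ σ h with k σ
    ... | suc _  = refl
    ... | zero   = trans (∑-swap n B (λ i a → ∑ B λ b → h i (block ρ a b σ))) (∑-cong′ B λ a → ∑-swap n B (λ i b → h i (block ρ a b σ)))

    paths-∑ : ∀ {d} ρ (xs : Vec (Fin 2) d) σ n (h : ℕ → Ctl → ℤ) →
              paths ρ xs σ (λ o → ∑ n (λ i → h i o)) ≡ ∑ n (λ i → paths ρ xs σ (h i))
    paths-∑ ρ [] σ n h = refl
    paths-∑ ρ (x ∷ xs) σ n h = trans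
      (opens-cong ρ σ λ τ → trans (∑-cong′ (radix (mode τ) (toℕ x)) λ δ → paths-∑ ρ xs (coord (toℕ x) δ τ) n h) (∑-swap (radix (mode τ) (toℕ x)) n (λ δ i → paths ρ xs (coord (toℕ x) δ τ) (h i))))
      (sym (∑-opens n ρ σ (λ i τ → ∑ (radix (mode τ) (toℕ x)) λ δ → paths ρ xs (coord (toℕ x) δ τ) (h i))))

    valid : Ctl → Bool
    valid o = bad o + rem o ≡ᵇ 0

    -- Only the left sign is used: equal keys contain the same bits z, and each factor (-1) ^ z must
    -- be counted once.
    match : Ctl → Ctl → ℤ
    match o o′ = if (valid o ∧ valid o′) ∧ (key o ≡ᵇ key o′) then sign (sg o) else 0ℤ

    pair : ∀ {d} → Vec (Fin 2) d → Vec (Fin 2) d → Ctl → Ctl → ℤ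
    pair xs ys σ τ = paths left xs σ λ o → paths right ys τ (match o)

    pair-coord : ∀ {d} x y (xs ys : Vec (Fin 2) d) σ τ k₁ k₂ → k σ ≡ suc k₁ → k τ ≡ suc k₂ →
      pair (x ∷ xs) (y ∷ ys) σ τ ≡
        ∑ (radix (mode σ) (toℕ x)) λ δ → ∑ (radix (mode τ) (toℕ y)) λ δ′ →
          pair xs ys (coord (toℕ x) δ σ) (coord (toℕ y) δ′ τ)
    pair-coord x y xs ys σ@(ctl _ _ _ m _ _ _ _) τ@(ctl _ _ _ m′ _ _ _ _) k₁ k₂ refl refl =
      ∑-cong′ (radix m (toℕ x)) λ δ → paths-∑ left xs (coord (toℕ x) δ σ) (radix m′ (toℕ y)) (λ δ′ o → paths right ys (coord (toℕ y) δ′ τ) (match o))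

    pair-block : ∀ {d} x y (xs ys : Vec (Fin 2) d) σ τ → k σ ≡ 0 → k τ ≡ 0 →
      pair (x ∷ xs) (y ∷ ys) σ τ ≡
        ∑ B λ a → ∑ B λ b → ∑ B λ a′ → ∑ B λ b′ →
          pair (x ∷ xs) (y ∷ ys) (block left a b σ) (block right a′ b′ τ)
    pair-block x y xs ys σ@(ctl _ _ _ _ _ _ _ _) τ@(ctl _ _ _ _ _ _ _ _) refl refl =
      ∑-cong′ B λ a → ∑-cong′ B λ b →
        trans (paths-∑ left (x ∷ xs) (block left a b σ) B (λ a′ o → ∑ B λ b′ → g a′ b′ o))
          (∑-cong′ B λ a′ → paths-∑ left (x ∷ xs) (block left a b σ) B (g a′))
      where g = λ a′ b′ o → paths right (y ∷ ys) (block right a′ b′ τ) (match o)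

    digits-injective : ∀ κ κ′ {z z′} → z < B → z′ < B → κ * B + z ≡ κ′ * B + z′ → κ ≡ κ′ × z ≡ z′
    digits-injective κ κ′ z< z′< eq =
      trans (sym (quotient-unique κ z<)) (trans (cong (λ e → quotient e B) eq) (quotient-unique κ′ z′<)) ,
      trans (sym (digit-unique κ z<)) (trans (cong (λ e → digit e B) eq) (digit-unique κ′ z′<))

    bit< : ∀ m (x : Fin 2) δ → δ < radix m (toℕ x) → δ + copies m * toℕ x < B
    bit< copy   zero       zero       _ = s≤s z≤n
    bit< copy   (suc zero) zero       _ = s≤s (s≤s z≤n)
    bit< free₀  zero       zero       _ = s≤s z≤n
    bit< free₀  zero       (suc zero) _ = s≤s (s≤s z≤n)
    bit< free₀  (suc zero) zero       _ = s≤s z≤n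
    bit< free₁  zero       zero       _ = s≤s z≤n
    bit< free₁  (suc zero) zero       _ = s≤s z≤n
    bit< free₁  (suc zero) (suc zero) _ = s≤s (s≤s z≤n)
    bit< copy   zero       (suc δ) (s≤s ())
    bit< copy   (suc zero) (suc δ) (s≤s ())
    bit< free₀  zero       (suc (suc δ)) (s≤s (s≤s ()))
    bit< free₀  (suc zero) (suc δ) (s≤s ())
    bit< free₁  zero       (suc δ) (s≤s ())
    bit< free₁  (suc zero) (suc (suc δ)) (s≤s (s≤s ()))

    -- With equal `k` both sides append digits below `B` at the same moments, so a difference
    -- between the keys can never be repaired.
    pair-distinct : ∀ {d} (xs ys : Vec (Fin 2) d) σ τ → k σ ≡ k τ → key σ ≢ key τ → pair xs ys σ τ ≡ 0ℤ
    pair-distinct-coord : ∀ {d} x y (xs ys : Vec (Fin 2) d) σ τ k₁ → k σ ≡ suc k₁ → k τ ≡ suc k₁ →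
                          key σ ≢ key τ → pair (x ∷ xs) (y ∷ ys) σ τ ≡ 0ℤ

    pair-distinct [] [] σ τ _ h rewrite ≢⇒≡ᵇ-false h | ∧-zeroʳ (valid σ ∧ valid τ) = refl
    pair-distinct (x ∷ xs) (y ∷ ys) σ@(ctl (suc _) _ _ _ _ _ _ _) τ refl h = pair-distinct-coord x y xs ys σ τ _ refl refl h
    pair-distinct (x ∷ xs) (y ∷ ys) σ@(ctl zero _ _ _ _ _ κ _) τ@(ctl zero _ _ _ _ _ κ′ _) refl h =
      trans (pair-block x y xs ys σ τ refl refl)
        (∑-zero B λ a a< → ∑-zero B λ b b< → ∑-zero B λ a′ a′< → ∑-zero B λ b′ b′< →
          pair-distinct-coord x y xs ys (block left a b σ) (block right a′ b′ τ) s-1 refl refl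
            λ eq → h (proj₁ (digits-injective κ κ′ a< a′< (proj₁ (digits-injective (κ * B + a) (κ′ * B + a′) b< b′< eq)))))

    pair-distinct-coord x y xs ys σ@(ctl _ _ _ m _ _ κ _) τ@(ctl _ _ _ m′ _ _ κ′ _) k₁ refl refl h =
      trans (pair-coord x y xs ys σ τ k₁ k₁ refl refl)
        (∑-zero (radix m (toℕ x)) λ δ δ< → ∑-zero (radix m′ (toℕ y)) λ δ′ δ′< →
          pair-distinct xs ys (coord (toℕ x) δ σ) (coord (toℕ y) δ′ τ) refl
            λ eq → h (proj₁ (digits-injective κ κ′ (bit< m x δ δ<) (bit< m′ y δ′ δ′<) eq)))

    ones : ∀ {d} → ℕ → Vec (Fin 2) d → ℕ
    ones zero     xs        = 0
    ones (suc k)  []        = 0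
    ones (suc k)  (x ∷ xs)  = toℕ x + ones k xs

    ones-[] : ∀ k → ones k [] ≡ 0
    ones-[] zero = refl
    ones-[] (suc k) = refl

    ones< : ∀ {d} (xs : Vec (Fin 2) d) → ones s xs < B
    ones< xs = s≤s (go s xs)
      where
      go : ∀ {d} k (xs : Vec (Fin 2) d) → ones k xs ≤ k
      go zero    xs              = z≤n
      go (suc k) []              = z≤n
      go (suc k) (zero ∷ xs)     = m≤n⇒m≤1+n (go k xs)
      go (suc k) (suc zero ∷ xs) = s≤s (go k xs)

    -- The induction keeps key and excesses equal on both sides. Modes have to fit together only
    -- inside a block: at a block boundary they are about to be replaced by those of a common
    -- option, and the initial modes are not compatible.
    pair-equal : ∀ {d} (xs ys : Vec (Fin 2) d) k {w₁ w₂ m m′} r bd r′ bd′ κ sg {sg′} → (k ≢ 0 → Compatible m m′) →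
      pair xs ys (ctl k w₁ w₂ m r bd κ sg) (ctl k w₁ w₂ m′ r′ bd′ κ sg′) ≡
        value (fine bd r (ones k xs) ∧ fine bd′ r′ (ones k ys) ∧ orthogonal xs ys) sg
    pair-equal-coord : ∀ {d} x y (xs ys : Vec (Fin 2) d) k {w₁ w₂ m m′} r bd r′ bd′ κ sg {sg′} → Compatible m m′ →
      pair (x ∷ xs) (y ∷ ys) (ctl (suc k) w₁ w₂ m r bd κ sg) (ctl (suc k) w₁ w₂ m′ r′ bd′ κ sg′) ≡
        value (fine bd r (toℕ x + ones k xs) ∧ fine bd′ r′ (toℕ y + ones k ys) ∧ orthogonal (x ∷ xs) (y ∷ ys)) sg

    pair-equal [] [] k r bd r′ bd′ κ sg c
      rewrite ones-[] k | ≡ᵇ-refl κ | fine-block bd r | fine-block bd′ r′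
            | ∧-assoc (fine bd r 0) (fine bd′ r′ 0) true = refl
    pair-equal (x ∷ xs) (y ∷ ys) (suc k) r bd r′ bd′ κ sg c = pair-equal-coord x y xs ys k r bd r′ bd′ κ sg (c λ ())
    pair-equal (x ∷ xs) (y ∷ ys) zero {w₁} {w₂} {m} {m′} r bd r′ bd′ κ sg {sg′} c = begin
      pair (x ∷ xs) (y ∷ ys) σ τ
        ≡⟨ pair-block x y xs ys σ τ refl refl ⟩
      (∑ B λ a → ∑ B λ b → ∑ B λ a′ → ∑ B λ b′ → P a b a′ b′)
        -- Different guesses on the two sides would leave different keys, so only the diagonal
        -- remains.
        ≡⟨ (∑-cong B λ a a< → ∑-cong B λ b b< →
             trans (∑-single B a a< λ a′ a′< a′≢a → ∑-zero B λ b′ b′< → off a b a′ b′ a< b< a′< b′< λ eq _ → a′≢a (sym eq))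
               (∑-single B b b< λ b′ b′< b′≢b → off a b a b′ a< b< a< b′< λ _ eq → b′≢b (sym eq))) ⟩
      (∑ B λ a → ∑ B λ b → P a b a b)
        ≡⟨ (∑-cong′ B λ a → ∑-cong′ B λ b →
             pair-equal-coord x y xs ys s-1 a (bd + r) b (bd′ + r′) ((κ * B + a) * B + b) sg (compatible (choose w₁ w₂ a b))) ⟩
      (∑ B λ a → ∑ B λ b → V a b)
        -- The left side refutes every a except its true count; in the next step the right side does
        -- the same for b.
        ≡⟨ (∑-single B {λ a → ∑ B (V a)} ca (ones< (x ∷ xs)) λ a _ a≢ → ∑-zero B λ b _ →
             cong (λ g → value (g ∧ fine (bd′ + r′) b cb ∧ orthogonal (x ∷ xs) (y ∷ ys)) sg)
               (trans (cong ((bd + r ≡ᵇ 0) ∧_) (≢⇒≡ᵇ-false a≢)) (∧-zeroʳ (bd + r ≡ᵇ 0)))) ⟩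
      (∑ B λ b → V ca b)
        ≡⟨ (∑-single B {V ca} cb (ones< (y ∷ ys)) λ b _ b≢ →
             trans (cong (λ g → value (fine (bd + r) ca ca ∧ g ∧ orthogonal (x ∷ xs) (y ∷ ys)) sg)
                      (trans (cong ((bd′ + r′ ≡ᵇ 0) ∧_) (≢⇒≡ᵇ-false b≢)) (∧-zeroʳ (bd′ + r′ ≡ᵇ 0))))
               (cong (λ g → value g sg) (∧-zeroʳ (fine (bd + r) ca ca)))) ⟩
      value (fine (bd + r) ca ca ∧ fine (bd′ + r′) cb cb ∧ orthogonal (x ∷ xs) (y ∷ ys)) sg
        ≡⟨ cong₂ (λ g g′ → value (g ∧ g′ ∧ orthogonal (x ∷ xs) (y ∷ ys)) sg) (full bd r ca) (full bd′ r′ cb) ⟩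
      value (fine bd r 0 ∧ fine bd′ r′ 0 ∧ orthogonal (x ∷ xs) (y ∷ ys)) sg ∎
      where
      open ≡-Reasoning
      σ = ctl 0 w₁ w₂ m r bd κ sg
      τ = ctl 0 w₁ w₂ m′ r′ bd′ κ sg′
      P = λ a b a′ b′ → pair (x ∷ xs) (y ∷ ys) (block left a b σ) (block right a′ b′ τ)
      ca = toℕ x + ones s-1 xs
      cb = toℕ y + ones s-1 ys
      V = λ a b → value (fine (bd + r) a ca ∧ fine (bd′ + r′) b cb ∧ orthogonal (x ∷ xs) (y ∷ ys)) sg
      off : ∀ a b a′ b′ → a < B → b < B → a′ < B → b′ < B → (a ≡ a′ → b ≢ b′) → P a b a′ b′ ≡ 0ℤ
      off a b a′ b′ a< b< a′< b′< h = pair-distinct (x ∷ xs) (y ∷ ys) (block left a b σ) (block right a′ b′ τ) refl λ eq →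
        let (eq₁ , eq₂) = digits-injective (κ * B + a) (κ * B + a′) b< b′< eq
        in h (proj₂ (digits-injective κ κ a< a′< eq₁)) eq₂
      full : ∀ bd r c → fine (bd + r) c c ≡ fine bd r 0
      full bd r c rewrite ≡ᵇ-refl c | ∧-comm (bd + r ≡ᵇ 0) true = fine-block bd r

    pair-equal-coord x y xs ys k {w₁} {w₂} {m} {m′} r bd r′ bd′ κ sg {sg′} c =
      trans (pair-coord x y xs ys σ τ k k refl refl) (cases x y c)
      where
      σ = ctl (suc k) w₁ w₂ m r bd κ sg
      τ = ctl (suc k) w₁ w₂ m′ r′ bd′ κ sg′
      Q = λ x y δ δ′ → pair xs ys (coord (toℕ x) δ σ) (coord (toℕ y) δ′ τ)
      G = λ x y → fine bd r (toℕ x + ones k xs) ∧ fine bd′ r′ (toℕ y + ones k ys) ∧ orthogonal xs ys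
      agree : ∀ (x y : Fin 2) δ δ′ → δ + copies m * toℕ x ≡ δ′ + copies m′ * toℕ y →
              Q x y δ δ′ ≡ value (G x y) (branch (f₁ m * δ) (1 ∸ sg) sg)
      agree x y δ δ′ eq = begin
        Q x y δ δ′
          ≡⟨ cong (λ z → pair xs ys (ctl k w₁ w₂ m (r ∸ toℕ x) (bd + (toℕ x ∸ r)) (κ * B + z) (branch (f₁ m * δ) (1 ∸ sg) sg))
                           (coord (toℕ y) δ′ τ)) eq ⟩
        pair xs ys _ (coord (toℕ y) δ′ τ)
          ≡⟨ pair-equal xs ys k (r ∸ toℕ x) (bd + (toℕ x ∸ r)) (r′ ∸ toℕ y) (bd′ + (toℕ y ∸ r′)) _ (branch (f₁ m * δ) (1 ∸ sg) sg) (λ _ → c) ⟩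
        value (fine (bd + (toℕ x ∸ r)) (r ∸ toℕ x) (ones k xs) ∧ fine (bd′ + (toℕ y ∸ r′)) (r′ ∸ toℕ y) (ones k ys) ∧ orthogonal xs ys) _
          ≡⟨ cong₂ (λ g g′ → value (g ∧ g′ ∧ orthogonal xs ys) _) (fine-coord bd r x _) (fine-coord bd′ r′ y _) ⟩
        value (G x y) (branch (f₁ m * δ) (1 ∸ sg) sg) ∎
        where open ≡-Reasoning
      differ : ∀ (x y : Fin 2) δ δ′ → δ + copies m * toℕ x ≢ δ′ + copies m′ * toℕ y → Q x y δ δ′ ≡ 0ℤ
      differ x y δ δ′ h = pair-distinct xs ys (coord (toℕ x) δ σ) (coord (toℕ y) δ′ τ) refl (h ∘ +-cancelˡ-≡ (κ * B) _ _)
      ∑₁₁ : ∀ (q : ℕ → ℕ → ℤ) {v} → q 0 0 ≡ v → ∑ 1 (λ δ → ∑ 1 (q δ)) ≡ v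
      ∑₁₁ q p = trans (ℤ.+-identityʳ _) (trans (ℤ.+-identityʳ (q 0 0)) p)
      ∑₁₂ : ∀ (q : ℕ → ℕ → ℤ) {v w} → q 0 1 ≡ v → q 0 0 ≡ w → ∑ 1 (λ δ → ∑ 2 (q δ)) ≡ v +ᶻ w
      ∑₁₂ q p p′ = trans (ℤ.+-identityʳ _) (cong₂ _+ᶻ_ p (trans (ℤ.+-identityʳ (q 0 0)) p′))
      ∑₂₁ : ∀ (q : ℕ → ℕ → ℤ) {v w} → q 1 0 ≡ v → q 0 0 ≡ w → ∑ 2 (λ δ → ∑ 1 (q δ)) ≡ v +ᶻ w
      ∑₂₁ q p p′ = cong₂ _+ᶻ_ (trans (ℤ.+-identityʳ (q 1 0)) p) (∑₁₁ q p′)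
      ∑₂₂ : ∀ (q : ℕ → ℕ → ℤ) {v w v′ w′} → q 1 1 ≡ v → q 1 0 ≡ w → q 0 1 ≡ v′ → q 0 0 ≡ w′ →
            ∑ 2 (λ δ → ∑ 2 (q δ)) ≡ (v +ᶻ w) +ᶻ (v′ +ᶻ w′)
      ∑₂₂ q p₁ p₂ p₃ p₄ = cong₂ _+ᶻ_ (cong₂ _+ᶻ_ p₁ (trans (ℤ.+-identityʳ (q 1 0)) p₂)) (∑₁₂ q p₃ p₄)
      clash : ∀ g g′ → value (g ∧ g′ ∧ false) sg ≡ 0ℤ
      clash g g′ rewrite ∧-zeroʳ g′ | ∧-zeroʳ g = refl
      cases : ∀ x y → Compatible m m′ →
        (∑ (radix m (toℕ x)) λ δ → ∑ (radix m′ (toℕ y)) λ δ′ → Q x y δ δ′) ≡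
          value (fine bd r (toℕ x + ones k xs) ∧ fine bd′ r′ (toℕ y + ones k ys) ∧ orthogonal (x ∷ xs) (y ∷ ys)) sg
      -- Each case checks one entry of the disjointness matrix of a coordinate: pairs of choices
      -- with different bits z vanish by `differ`, those with equal bits are passed on by `agree`.
      cases zero zero copyLeft =
        trans (∑₁₂ (Q zero zero) (differ zero zero 0 1 λ ()) (agree zero zero 0 0 refl)) (ℤ.+-identityˡ _)
      cases zero (suc zero) copyLeft = ∑₁₁ (Q zero (suc zero)) (agree zero (suc zero) 0 0 refl)
      cases (suc zero) zero copyLeft =
        trans (∑₁₂ (Q (suc zero) zero) (agree (suc zero) zero 0 1 refl) (differ (suc zero) zero 0 0 λ ())) (ℤ.+-identityʳ _)
      cases (suc zero) (suc zero) copyLeft =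
        trans (∑₁₁ (Q (suc zero) (suc zero)) (differ (suc zero) (suc zero) 0 0 λ ())) (sym (clash (fine bd r _) (fine bd′ r′ _)))
      cases zero zero copyRight =
        trans (∑₂₁ (Q zero zero) (differ zero zero 1 0 λ ()) (agree zero zero 0 0 refl)) (ℤ.+-identityˡ _)
      cases (suc zero) zero copyRight = ∑₁₁ (Q (suc zero) zero) (agree (suc zero) zero 0 0 refl)
      cases zero (suc zero) copyRight =
        trans (∑₂₁ (Q zero (suc zero)) (agree zero (suc zero) 1 0 refl) (differ zero (suc zero) 0 0 λ ())) (ℤ.+-identityʳ _)
      cases (suc zero) (suc zero) copyRight =
        trans (∑₁₁ (Q (suc zero) (suc zero)) (differ (suc zero) (suc zero) 0 0 λ ())) (sym (clash (fine bd r _) (fine bd′ r′ _)))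
      cases zero zero signed = ∑₁₁ (Q zero zero) (agree zero zero 0 0 refl)
      cases (suc zero) zero signed =
        trans (∑₂₁ (Q (suc zero) zero) (differ (suc zero) zero 1 0 λ ()) (agree (suc zero) zero 0 0 refl)) (ℤ.+-identityˡ _)
      cases zero (suc zero) signed =
        trans (∑₁₂ (Q zero (suc zero)) (differ zero (suc zero) 0 1 λ ()) (agree zero (suc zero) 0 0 refl)) (ℤ.+-identityˡ _)
      -- Both values of z are possible on both sides; the two agreeing pairs carry opposite signs
      -- and cancel.
      cases (suc zero) (suc zero) signed =
        trans (∑₂₂ (Q (suc zero) (suc zero))
                 (agree (suc zero) (suc zero) 1 1 refl) (differ (suc zero) (suc zero) 1 0 λ ())
                 (differ (suc zero) (suc zero) 0 1 λ ()) (agree (suc zero) (suc zero) 0 0 refl))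
          (trans (cong₂ _+ᶻ_ (ℤ.+-identityʳ (value (G (suc zero) (suc zero)) (1 ∸ sg))) (ℤ.+-identityˡ (value (G (suc zero) (suc zero)) sg)))
            (trans (value-flip (G (suc zero) (suc zero)) sg) (sym (clash (fine bd r _) (fine bd′ r′ _)))))

-- The potential argument bounding the number of free bits

module Balance where

  open Prelude
  open Machine
  open Sums
  open Decomposition

  -- This is (w + h)² = w² + 2wh + h² for h = 3p - s, with h² at most 4s² and the negative part of
  -- 2wh moved to the left. Cutting the new excess off at zero only decreases its square below that
  -- of w + h. The cases are: cut off, h nonnegative, h negative.
  square-step : ∀ s w p → p ≤ s →
    (w + p * 3 ∸ s) * (w + p * 3 ∸ s) + 2 * (w * s) ≤ w * w + 6 * (p * w) + 4 * (s * s)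
  square-step s w p p≤s with w + p * 3 ≤? s
  ... | yes le rewrite m≤n⇒m∸n≡0 le = begin
    2 * (w * s)                             ≤⟨ *-monoʳ-≤ 2 (*-monoˡ-≤ s (m+n≤o⇒m≤o w le)) ⟩
    2 * (s * s)                             ≤⟨ *-monoˡ-≤ (s * s) (s≤s (s≤s (z≤n {2}))) ⟩
    4 * (s * s)                             ≤⟨ m≤n+m (4 * (s * s)) (w * w + 6 * (p * w)) ⟩
    w * w + 6 * (p * w) + 4 * (s * s)       ∎
    where open ≤-Reasoning
  ... | no nle with ≤-total s (p * 3)
  ... | inj₁ le = begin
    (w + p * 3 ∸ s) * (w + p * 3 ∸ s) + 2 * (w * s)   ≡⟨ cong (λ t → t * t + 2 * (w * s)) (+-∸-assoc w le) ⟩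
    (w + h) * (w + h) + 2 * (w * s)                   ≡⟨ e₁ w h s ⟩
    w * w + 2 * ((h + s) * w) + h * h                 ≤⟨ +-monoʳ-≤ (w * w + 2 * ((h + s) * w)) (*-mono-≤ h≤ h≤) ⟩
    w * w + 2 * ((h + s) * w) + (s * 2) * (s * 2)     ≡⟨ cong (λ t → w * w + 2 * (t * w) + (s * 2) * (s * 2)) (m∸n+n≡m le) ⟩
    w * w + 2 * ((p * 3) * w) + (s * 2) * (s * 2)     ≡⟨ e₂ w p s ⟩
    w * w + 6 * (p * w) + 4 * (s * s)                 ∎
    where
    open ≤-Reasoning
    h = p * 3 ∸ s
    h≤ : h ≤ s * 2
    h≤ = ≤-trans (∸-monoˡ-≤ s (*-monoˡ-≤ 3 p≤s)) (≤-reflexive (trans (cong (_∸ s) (e s)) (m+n∸m≡n s (s * 2))))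
      where
      e : ∀ s → s * 3 ≡ s + s * 2
      e = solve-∀
    e₁ : ∀ w h s → (w + h) * (w + h) + 2 * (w * s) ≡ w * w + 2 * ((h + s) * w) + h * h
    e₁ = solve-∀
    e₂ : ∀ w p s → w * w + 2 * ((p * 3) * w) + (s * 2) * (s * 2) ≡ w * w + 6 * (p * w) + 4 * (s * s)
    e₂ = solve-∀
  ... | inj₂ ge = begin
    (w + p * 3 ∸ s) * (w + p * 3 ∸ s) + 2 * (w * s)   ≡⟨ cong₂ (λ t z → t * t + 2 * (w * z)) t≡ (sym s≡) ⟩
    t * t + 2 * (w * (p * 3 + h))                     ≡⟨ cong (λ z → t * t + 2 * (z * (p * 3 + h))) w≡ ⟩
    t * t + 2 * ((t + h) * (p * 3 + h))               ≡⟨ e₁ t h p ⟩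
    (t + h) * (t + h) + 6 * (p * (t + h)) + h * h     ≤⟨ +-monoʳ-≤ ((t + h) * (t + h) + 6 * (p * (t + h))) (*-mono-≤ h≤ h≤) ⟩
    (t + h) * (t + h) + 6 * (p * (t + h)) + s * s     ≤⟨ +-monoʳ-≤ ((t + h) * (t + h) + 6 * (p * (t + h))) (m≤m+n (s * s) _) ⟩
    (t + h) * (t + h) + 6 * (p * (t + h)) + 4 * (s * s) ≡⟨ cong (λ z → z * z + 6 * (p * z) + 4 * (s * s)) w≡ ⟨
    w * w + 6 * (p * w) + 4 * (s * s)                 ∎
    where
    open ≤-Reasoning
    h = s ∸ p * 3
    s≡ : p * 3 + h ≡ s
    s≡ = m+[n∸m]≡n ge
    h≤ : h ≤ s
    h≤ = m∸n≤m s (p * 3)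
    h≤w : h ≤ w
    h≤w = +-cancelʳ-≤ (p * 3) h w (≤-trans (≤-reflexive (m∸n+n≡m ge)) (<⇒≤ (≰⇒> nle)))
    t = w ∸ h
    w≡ : w ≡ t + h
    w≡ = sym (m∸n+n≡m h≤w)
    t≡ : w + p * 3 ∸ s ≡ t
    t≡ = trans (cong₂ _∸_ (+-comm w (p * 3)) (sym s≡)) ([m+n]∸[m+o]≡n∸o (p * 3) w h)
    e₁ : ∀ t h p → t * t + 2 * ((t + h) * (p * 3 + h)) ≡ (t + h) * (t + h) + 6 * (p * (t + h)) + h * h
    e₁ = solve-∀

  ^-cancel-≤ : ∀ n a b → a ^ suc n ≤ b ^ suc n → a ≤ b
  ^-cancel-≤ n a b le with a ≤? b
  ... | yes p = p
  ... | no ¬p = contradiction (^-monoˡ-< (suc n) (≰⇒> ¬p)) (≤⇒≯ le)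

  module Cost (s-1 : ℕ) where
    open Walk s-1

    -- The number of blocks still to be opened when k of the d remaining coordinates, or all of them
    -- if there are fewer, belong to the current block. An incomplete last block counts fully.
    blocks : ℕ → ℕ → ℕ
    blocks k       zero     = 0
    blocks zero    (suc d)  = suc (blocks s-1 d)
    blocks (suc k) (suc d)  = blocks k d

    blocks-bound : ∀ k d → k ≤ s → blocks k d * s + k ≤ d + s
    blocks-bound k zero k≤ = k≤
    blocks-bound zero (suc d) _ = begin
      (s + blocks s-1 d * s) + 0       ≡⟨ e s-1 (blocks s-1 d * s) ⟩
      suc (blocks s-1 d * s + s-1)     ≤⟨ s≤s (blocks-bound s-1 d (n≤1+n s-1)) ⟩
      suc d + s                        ∎
      where
      open ≤-Reasoning
      e : ∀ a x → (suc a + x) + 0 ≡ suc (x + a)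
      e = solve-∀
    blocks-bound (suc k) (suc d) k≤ = ≤-trans (≤-reflexive (+-suc (blocks k d * s) k)) (s≤s (blocks-bound k d (<⇒≤ k≤)))

    -- The free bits left in the current block if r of its remaining k coordinates are ones; in an
    -- incomplete last block an upper estimate.
    free : Mode → ℕ → ℕ → ℕ
    free copy  k r = 0
    free free₀ k r = k ∸ r
    free free₁ k r = r

    free-own : ∀ ρ o a b → free (modeOf ρ o) s (pick ρ a b) ≡ pick ρ (left-cost o a b) (right-cost o a b)
    free-own left  copyLeft   a b = refl
    free-own left  copyRight  a b = refl
    free-own left  signed     a b = refl
    free-own right copyLeft   a b = refl
    free-own right copyRight  a b = refl
    free-own right signed     a b = refl

    left-cost≤ : ∀ o {a} b → a ≤ s → left-cost o a b ≤ s
    left-cost≤ copyLeft   b a≤ = z≤n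
    left-cost≤ copyRight  {a} b a≤ = m∸n≤m s a
    left-cost≤ signed     b a≤ = a≤

    right-cost≤ : ∀ o a {b} → b ≤ s → right-cost o a b ≤ s
    right-cost≤ copyLeft   a {b} b≤ = m∸n≤m s b
    right-cost≤ copyRight  a b≤ = z≤n
    right-cost≤ signed     a b≤ = b≤

    choose-balanced : ∀ w₁ w₂ a b → a ≤ s → b ≤ s → let o = choose w₁ w₂ a b in
      3 * (left-cost o a b * w₁ + right-cost o a b * w₂) ≤ (w₁ + w₂) * s
    choose-balanced w₁ w₂ a b a≤ b≤ with (s ∸ b) * w₂ * 3 ∸ (w₁ + w₂) * s in eq₁
    ... | zero = ≤-trans (≤-reflexive (*-comm 3 ((s ∸ b) * w₂))) (m∸n≡0⇒m≤n eq₁)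
    ... | suc _ with (s ∸ a) * w₁ * 3 ∸ (w₁ + w₂) * s in eq₂
    ... | zero = ≤-trans (≤-reflexive (trans (cong (3 *_) (+-identityʳ ((s ∸ a) * w₁))) (*-comm 3 ((s ∸ a) * w₁)))) (m∸n≡0⇒m≤n eq₂)
    -- The three weighted costs P, Q, R add up to 3S. The first two have been found to be at least
    -- S, so the third is at most S.
    ... | suc _ = +-cancelˡ-≤ (S + S) R S (begin
      S + S + R    ≤⟨ +-monoˡ-≤ R (+-mono-≤ {S} {P} {S} {Q} (over S P eq₁) (over S Q eq₂)) ⟩
      P + Q + R    ≡⟨ e (s ∸ a) (s ∸ b) a b w₁ w₂ ⟩
      3 * (((s ∸ a) + a) * w₁ + ((s ∸ b) + b) * w₂) ≡⟨ cong₂ (λ y z → 3 * (y * w₁ + z * w₂)) (m∸n+n≡m a≤) (m∸n+n≡m b≤) ⟩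
      3 * (s * w₁ + s * w₂)   ≡⟨ e′ s w₁ w₂ ⟩
      S + S + S    ∎)
      where
      open ≤-Reasoning
      S = (w₁ + w₂) * s
      P = (s ∸ b) * w₂ * 3
      Q = (s ∸ a) * w₁ * 3
      R = 3 * (a * w₁ + b * w₂)
      over : ∀ y x {z} → x ∸ y ≡ suc z → y ≤ x
      over y x eq with ≤-total y x
      ... | inj₁ le = le
      ... | inj₂ ge = contradiction (trans (sym (m≤n⇒m∸n≡0 ge)) eq) λ ()
      e : ∀ a′ b′ a b w₁ w₂ → b′ * w₂ * 3 + a′ * w₁ * 3 + 3 * (a * w₁ + b * w₂) ≡ 3 * ((a′ + a) * w₁ + (b′ + b) * w₂)
      e = solve-∀
      e′ : ∀ s w₁ w₂ → 3 * (s * w₁ + s * w₂) ≡ (w₁ + w₂) * s + (w₁ + w₂) * s + (w₁ + w₂) * s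
      e′ = solve-∀

    potential : Ctl → ℕ
    potential σ = w₁ σ * w₁ σ + w₂ σ * w₂ σ

    -- Adding `square-step` for both sides leaves the cross terms 6 (p w₁ + q w₂) against 2 (w₁ +
    -- w₂) s, and `choose-balanced` says exactly that the former do not exceed the latter.
    potential-block : ∀ ρ a b σ → a ≤ s → b ≤ s → potential (block ρ a b σ) ≤ potential σ + 8 * (s * s)
    potential-block ρ a b (ctl _ w₁ w₂ _ _ _ _ _) a≤ b≤ = +-cancelʳ-≤ (2 * ((w₁ + w₂) * s)) _ _ (begin
      (u₁ * u₁ + u₂ * u₂) + 2 * ((w₁ + w₂) * s)
        ≡⟨ e₁ (u₁ * u₁) (u₂ * u₂) w₁ w₂ s ⟩
      (u₁ * u₁ + 2 * (w₁ * s)) + (u₂ * u₂ + 2 * (w₂ * s))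
        ≤⟨ +-mono-≤ (square-step s w₁ p (left-cost≤ o b a≤)) (square-step s w₂ q (right-cost≤ o a b≤)) ⟩
      (w₁ * w₁ + 6 * (p * w₁) + 4 * (s * s)) + (w₂ * w₂ + 6 * (q * w₂) + 4 * (s * s))
        ≡⟨ e₂ (w₁ * w₁) (p * w₁) (w₂ * w₂) (q * w₂) (s * s) ⟩
      ((w₁ * w₁ + w₂ * w₂) + 8 * (s * s)) + 2 * (3 * (p * w₁ + q * w₂))
        ≤⟨ +-monoʳ-≤ ((w₁ * w₁ + w₂ * w₂) + 8 * (s * s)) (*-monoʳ-≤ 2 (choose-balanced w₁ w₂ a b a≤ b≤)) ⟩
      ((w₁ * w₁ + w₂ * w₂) + 8 * (s * s)) + 2 * ((w₁ + w₂) * s) ∎)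
      where
      open ≤-Reasoning
      o = choose w₁ w₂ a b
      p = left-cost o a b
      q = right-cost o a b
      u₁ = w₁ + p * 3 ∸ s
      u₂ = w₂ + q * 3 ∸ s
      e₁ : ∀ a b w₁ w₂ s → (a + b) + 2 * ((w₁ + w₂) * s) ≡ (a + 2 * (w₁ * s)) + (b + 2 * (w₂ * s))
      e₁ = solve-∀
      e₂ : ∀ a b c d s → (a + 6 * b + 4 * s) + (c + 6 * d + 4 * s) ≡ ((a + c) + 8 * s) + 2 * (3 * (b + d))
      e₂ = solve-∀

    own : Role → Ctl → ℕ
    own ρ σ = pick ρ (w₁ σ) (w₂ σ)

    -- An estimate seen from inside the walk: `later` counts the free bits of blocks not yet opened.
    -- In `cheap` the excess so far and three times the later bits share one budget, so that the
    -- excess telescopes. The fields `bad≡0` and `rem≤k` are inferred backwards from the validity of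
    -- the end.
    record Bounded (U : ℕ) (ρ : Role) (d : ℕ) (σ : Ctl) (e : ℕ) : Set where
      constructor bounded
      field
        bad≡0  : bad σ ≡ 0
        rem≤k  : rem σ ≤ k σ
        later  : ℕ
        cheap  : 3 * later + own ρ σ ≤ blocks (k σ) d * s + U
        small  : suc e ≤ (B * B) ^ blocks (k σ) d * 2 ^ (free (mode σ) (k σ) (rem σ) + later)

    digit-bound : ∀ e {b n} → 1 ≤ b → suc (quotient e b) ≤ n → suc e ≤ b * n
    digit-bound e {b} {n} 1≤b le = begin
      suc e                              ≡⟨ cong suc (quotient-digit e 1≤b) ⟩
      suc (digit e b) + quotient e b * b ≤⟨ +-monoˡ-≤ (quotient e b * b) (digit< e 1≤b) ⟩
      suc (quotient e b) * b             ≤⟨ *-monoˡ-≤ b le ⟩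
      n * b                              ≡⟨ *-comm n b ⟩
      b * n                              ∎
      where open ≤-Reasoning

    radix-free : ∀ m (x : Fin 2) k r → toℕ x ∸ r ≡ 0 → r ∸ toℕ x ≤ k →
                 radix m (toℕ x) * 2 ^ free m k (r ∸ toℕ x) ≤ 2 ^ free m (suc k) r
    radix-free copy  zero       k r       _ _ = ≤-refl
    radix-free copy  (suc zero) k r       _ _ = ≤-refl
    radix-free free₀ zero       k r       _ le = ≤-reflexive (cong (2 ^_) (sym (+-∸-assoc 1 le)))
    radix-free free₀ (suc zero) k (suc r) _ _ = ≤-reflexive (+-identityʳ _)
    radix-free free₁ zero       k r       _ _ = ≤-reflexive (+-identityʳ _)
    radix-free free₁ (suc zero) k (suc r) _ _ = ≤-refl

    -- Seen from before the block, its c free bits belong to `later`, and the two guesses contribute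
    -- the factor `B * B`. Truncation of the new excess errs upwards, so w + 3c is at most the new
    -- excess plus s.
    bounded-block : ∀ U ρ d σ e → k σ ≡ 0 → let a = digit e B; b = digit (quotient e B) B in
      Bounded U ρ (suc d) (block ρ a b σ) (quotient (quotient e B) B) → Bounded U ρ (suc d) σ e
    bounded-block U ρ d σ@(ctl zero w₁ w₂ m r bd κ sg) e refl (bounded bad≡0 _ later cheap small) =
      bounded (m+n≡0⇒m≡0 bd bad≡0) (≤-reflexive r≡0) (c + later) cheap′ small′
      where
      open ≤-Reasoning
      n = blocks s-1 d
      a = digit e B
      b = digit (quotient e B) B
      o = choose w₁ w₂ a b
      c = pick ρ (left-cost o a b) (right-cost o a b)
      ≤∸+ : ∀ m → m ≤ m ∸ s + s
      ≤∸+ m = ≤-trans (m≤n+m∸n m s) (≤-reflexive (+-comm s (m ∸ s)))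
      r≡0 : r ≡ 0
      r≡0 = m+n≡0⇒n≡0 bd bad≡0
      own-step : ∀ ρ → pick ρ (left-cost o a b) (right-cost o a b) * 3 + own ρ σ ≤ own ρ (block ρ a b σ) + s
      own-step left   = ≤-trans (≤-reflexive (+-comm (left-cost o a b * 3) w₁)) (≤∸+ (w₁ + left-cost o a b * 3))
      own-step right  = ≤-trans (≤-reflexive (+-comm (right-cost o a b * 3) w₂)) (≤∸+ (w₂ + right-cost o a b * 3))
      cheap′ : 3 * (c + later) + own ρ σ ≤ suc n * s + U
      cheap′ = begin
        3 * (c + later) + own ρ σ                        ≡⟨ e₁ c later (own ρ σ) ⟩
        3 * later + (c * 3 + own ρ σ)                    ≤⟨ +-monoʳ-≤ (3 * later) (own-step ρ) ⟩
        3 * later + (own ρ (block ρ a b σ) + s)          ≡⟨ +-assoc (3 * later) _ s ⟨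
        3 * later + own ρ (block ρ a b σ) + s            ≤⟨ +-monoˡ-≤ s cheap ⟩
        n * s + U + s                                    ≡⟨ e₂ (n * s) U s ⟩
        suc n * s + U ∎
        where
        e₁ : ∀ c l w → 3 * (c + l) + w ≡ 3 * l + (c * 3 + w)
        e₁ = solve-∀
        e₂ : ∀ x u s → x + u + s ≡ (s + x) + u
        e₂ = solve-∀
      free-none : ∀ m → free m 0 r ≡ 0
      free-none copy = refl
      free-none free₀ = 0∸n≡0 r
      free-none free₁ = r≡0
      small′ : suc e ≤ (B * B) ^ suc n * 2 ^ (free m 0 r + (c + later))
      small′ = begin
        suc e
          ≤⟨ digit-bound e (s≤s z≤n) (digit-bound (quotient e B) (s≤s z≤n) small) ⟩
        B * (B * ((B * B) ^ n * 2 ^ (free (modeOf ρ o) s (pick ρ a b) + later)))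
          ≡⟨ e₃ B ((B * B) ^ n) _ ⟩
        (B * B) * (B * B) ^ n * 2 ^ (free (modeOf ρ o) s (pick ρ a b) + later)
          ≡⟨ cong (λ z → (B * B) * (B * B) ^ n * 2 ^ z)
               (trans (cong (_+ later) (free-own ρ o a b)) (cong (_+ (c + later)) (sym (free-none m)))) ⟩
        (B * B) ^ suc n * 2 ^ (free m 0 r + (c + later)) ∎
        where
        e₃ : ∀ b x y → b * (b * (x * y)) ≡ (b * b) * x * y
        e₃ = solve-∀

    -- The potential is controlled on the way down, each block to come reserving 8s². At the end
    -- this bounds the excess by U, and on the way back the bits are counted.
    valid-bounded : ∀ {d} U ρ (xs : Vec (Fin 2) d) σ e → let (σ′ , e′) = walk ρ xs (σ , e) in
      e′ ≡ 0 → bad σ′ + rem σ′ ≡ 0 → potential σ + blocks (k σ) d * (8 * (s * s)) ≤ U * U → Bounded U ρ d σ e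
    valid-bounded-coord : ∀ {d} U ρ x (xs : Vec (Fin 2) d) k σ e → Ctl.k σ ≡ suc k →
      let (σ′ , e′) = walk ρ xs (walk-coord (toℕ x) (σ , e)) in
      e′ ≡ 0 → bad σ′ + rem σ′ ≡ 0 → potential σ + blocks k d * (8 * (s * s)) ≤ U * U → Bounded U ρ (suc d) σ e

    valid-bounded U ρ [] σ@(ctl k w₁ w₂ m r bd _ _) .0 refl ok pot =
      bounded (m+n≡0⇒m≡0 bd ok) (≤-trans (≤-reflexive (m+n≡0⇒n≡0 bd ok)) z≤n) 0 (own≤ ρ)
        (≤-trans (m^n>0 2 (free m k r + 0)) (≤-reflexive (sym (+-identityʳ _))))
      where
      root : ∀ {a b} → a * a ≤ b * b → a ≤ b
      root {a} {b} le = ^-cancel-≤ 1 a b (subst₂ _≤_ (cong (a *_) (sym (*-identityʳ a))) (cong (b *_) (sym (*-identityʳ b))) le)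
      pot′ : w₁ * w₁ + w₂ * w₂ ≤ U * U
      pot′ = ≤-trans (≤-reflexive (sym (+-identityʳ _))) pot
      own≤ : ∀ ρ → own ρ σ ≤ U
      own≤ left   = root (m+n≤o⇒m≤o _ pot′)
      own≤ right  = root (m+n≤o⇒n≤o (w₁ * w₁) pot′)
    valid-bounded U ρ (x ∷ xs) σ@(ctl (suc k) _ _ _ _ _ _ _) e z ok pot =
      valid-bounded-coord U ρ x xs k σ e refl z ok pot
    valid-bounded {suc d} U ρ (x ∷ xs) σ@(ctl zero w₁ w₂ m r bd κ sg) e z ok pot =
      bounded-block U ρ d σ e refl
        (valid-bounded-coord U ρ x xs s-1 (block ρ a b σ) (quotient (quotient e B) B) refl z ok
          (begin
            potential (block ρ a b σ) + n * (8 * (s * s))    ≤⟨ +-monoˡ-≤ (n * (8 * (s * s))) (potential-block ρ a b σ a≤ b≤) ⟩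
            (potential σ + 8 * (s * s)) + n * (8 * (s * s))  ≡⟨ +-assoc (potential σ) (8 * (s * s)) (n * (8 * (s * s))) ⟩
            potential σ + suc n * (8 * (s * s))              ≤⟨ pot ⟩
            U * U                                            ∎))
      where
      open ≤-Reasoning
      n = blocks s-1 d
      a = digit e B
      b = digit (quotient e B) B
      a≤ : a ≤ s
      a≤ = ≤-pred (digit< e (s≤s z≤n))
      b≤ : b ≤ s
      b≤ = ≤-pred (digit< (quotient e B) (s≤s z≤n))

    valid-bounded-coord {d} U ρ x xs k σ@(ctl _ w₁ w₂ m r bd κ sg) e refl z ok pot
      with valid-bounded U ρ xs (coord (toℕ x) (digit e (radix m (toℕ x))) σ) (quotient e (radix m (toℕ x))) z ok pot
    ... | bounded bad≡0 rem≤k later cheap small =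
      bounded (m+n≡0⇒m≡0 bd bad≡0) (rem≤ x r x∸r≡0 rem≤k) later cheap (begin
        suc e
          ≤⟨ digit-bound e (1≤radix m (toℕ x)) small ⟩
        radix m (toℕ x) * (N * 2 ^ (free m k (r ∸ toℕ x) + later))
          ≡⟨ cong (λ t → radix m (toℕ x) * (N * t)) (^-distribˡ-+-* 2 (free m k (r ∸ toℕ x)) later) ⟩
        radix m (toℕ x) * (N * (2 ^ free m k (r ∸ toℕ x) * 2 ^ later))
          ≡⟨ e₁ (radix m (toℕ x)) N _ (2 ^ later) ⟩
        N * (radix m (toℕ x) * 2 ^ free m k (r ∸ toℕ x) * 2 ^ later)
          ≤⟨ *-monoʳ-≤ N (*-monoˡ-≤ (2 ^ later) (radix-free m x k r x∸r≡0 rem≤k)) ⟩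
        N * (2 ^ free m (suc k) r * 2 ^ later)
          ≡⟨ cong (N *_) (^-distribˡ-+-* 2 (free m (suc k) r) later) ⟨
        N * 2 ^ (free m (suc k) r + later) ∎)
      where
      open ≤-Reasoning
      N = (B * B) ^ blocks k d
      x∸r≡0 = m+n≡0⇒n≡0 bd bad≡0
      rem≤ : ∀ (x : Fin 2) r → toℕ x ∸ r ≡ 0 → r ∸ toℕ x ≤ k → r ≤ suc k
      rem≤ zero       r       _ le = m≤n⇒m≤1+n le
      rem≤ (suc zero) (suc r) _ le = s≤s le
      e₁ : ∀ a n p q → a * (n * (p * q)) ≡ n * (a * p * q)
      e₁ = solve-∀

-- Number of blocks and number of choices

module Parameters where

  open Prelude
  open Machine
  open Sums
  open Decomposition
  open Balance

  opaque
    -- Half of 1.26³ is 1.000188, and 5320 * 0.000188 exceeds 1, so Bernoulli's inequality already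
    -- explains `ratio`. In the code it is decided by evaluating the powers. The choice of `K` makes
    -- the final excess at most a 1/κ part of the K blocks. Everything else treats the two numbers
    -- as abstract.
    κ K : ℕ
    κ = 5320
    K = 8 * (κ * κ)

    K≡ : K ≡ 8 * (κ * κ)
    K≡ = refl

    1≤κ : 1 ≤ κ
    1≤κ = s≤s z≤n

    1≤K : 1 ≤ K
    1≤K = s≤s z≤n

    -- 1.26 slightly exceeds the cube root of 2.
    ratio : 2 ^ suc κ * 100 ^ (3 * κ) ≤ 126 ^ (3 * κ)
    ratio = ≤ᵇ⇒≤ (2 ^ suc 5320 * 100 ^ (3 * 5320)) (126 ^ (3 * 5320)) tt

  quotient*≤ : ∀ m n → quotient m n * n ≤ m
  quotient*≤ m zero = z≤n
  quotient*≤ m (suc n) = m/n*n≤m m (suc n)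

  *≤⇒≤quotient : ∀ m n {o} → 1 ≤ n → m * n ≤ o → m ≤ quotient o n
  *≤⇒≤quotient m n {o} 1≤n le with m ≤? quotient o n
  ... | yes p = p
  ... | no ¬p = contradiction le (<⇒≱ (begin-strict
    o                             ≡⟨ quotient-digit o 1≤n ⟩
    digit o n + quotient o n * n  <⟨ +-monoˡ-< (quotient o n * n) (digit< o 1≤n) ⟩
    suc (quotient o n) * n        ≤⟨ *-monoˡ-≤ n (≰⇒> ¬p) ⟩
    m * n                         ∎))
    where
    open ≤-Reasoning

  -- Raising both sides to the power 3κ makes the exponent (d + K)(κ + 1)/(3κ) integral. The part of
  -- it belonging to d is absorbed by `ratio`, the part belonging to K by 2 ^ K.
  free-bits-bound : ∀ F d → F * (3 * κ) ≤ (d + K) * suc κ → 2 ^ F * 100 ^ d ≤ 2 ^ K * 126 ^ d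
  free-bits-bound F d le = ^-cancel-≤ (pred n) (2 ^ F * 100 ^ d) (2 ^ K * 126 ^ d) (subst (λ n → (2 ^ F * 100 ^ d) ^ n ≤ (2 ^ K * 126 ^ d) ^ n) (sym n≡) (begin
    (2 ^ F * 100 ^ d) ^ n                        ≡⟨ ^-distribʳ-* n (2 ^ F) (100 ^ d) ⟩
    (2 ^ F) ^ n * (100 ^ d) ^ n                  ≡⟨ cong₂ _*_ (^-*-assoc 2 F n) (swap-^ 100 d) ⟩
    2 ^ (F * n) * (100 ^ n) ^ d                  ≤⟨ *-monoˡ-≤ ((100 ^ n) ^ d) (^-monoʳ-≤ 2 le) ⟩
    2 ^ ((d + K) * suc κ) * (100 ^ n) ^ d        ≡⟨ cong (λ z → 2 ^ z * (100 ^ n) ^ d) (*-comm (d + K) (suc κ)) ⟩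
    2 ^ (suc κ * (d + K)) * (100 ^ n) ^ d        ≡⟨ cong (_* (100 ^ n) ^ d) (^-*-assoc 2 (suc κ) (d + K)) ⟨
    (2 ^ suc κ) ^ (d + K) * (100 ^ n) ^ d        ≡⟨ cong (_* (100 ^ n) ^ d) (^-distribˡ-+-* (2 ^ suc κ) d K) ⟩
    (2 ^ suc κ) ^ d * (2 ^ suc κ) ^ K * (100 ^ n) ^ d ≡⟨ shuffle ((2 ^ suc κ) ^ d) ((2 ^ suc κ) ^ K) ((100 ^ n) ^ d) ⟩
    (2 ^ suc κ) ^ K * ((2 ^ suc κ) ^ d * (100 ^ n) ^ d) ≡⟨ cong ((2 ^ suc κ) ^ K *_) (^-distribʳ-* d (2 ^ suc κ) (100 ^ n)) ⟨
    (2 ^ suc κ) ^ K * (2 ^ suc κ * 100 ^ n) ^ d  ≤⟨ *-mono-≤ (^-monoˡ-≤ K (^-monoʳ-≤ 2 κ<n)) (^-monoˡ-≤ d ratio) ⟩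
    (2 ^ n) ^ K * (126 ^ n) ^ d                  ≡⟨ cong₂ _*_ (swap-^ 2 K) (swap-^ 126 d) ⟨
    (2 ^ K) ^ n * (126 ^ d) ^ n                  ≡⟨ ^-distribʳ-* n (2 ^ K) (126 ^ d) ⟨
    (2 ^ K * 126 ^ d) ^ n                        ∎))
    where
    open ≤-Reasoning
    n = 3 * κ
    κ<n : suc κ ≤ n
    κ<n = ≤-trans (+-mono-≤ 1≤κ (m≤m+n κ κ)) (≤-reflexive (e κ))
      where
      e : ∀ k → k + (k + k) ≡ 3 * k
      e = solve-∀
    n≡ : suc (pred n) ≡ n
    n≡ = suc-pred n {{>-nonZero (≤-trans (s≤s z≤n) κ<n)}}
    swap-^ : ∀ b d → (b ^ d) ^ n ≡ (b ^ n) ^ d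
    swap-^ b d = trans (^-*-assoc b d n) (trans (cong (b ^_) (*-comm d n)) (sym (^-*-assoc b n d)))
    shuffle : ∀ a b c → a * b * c ≡ b * (a * c)
    shuffle = solve-∀

  initially : Ctl
  initially = ctl 0 0 0 copy 0 0 0 0

  -- The block size is 1 + ⌊d/K⌋, so `base d` is its `B`. In `prefactor`, each of at most K blocks
  -- contributes B² for the two guesses, and 2 ^ K pays for rounding d up to K full blocks.
  -- `choices d` is the integer part of `prefactor d` times 1.26 ^ d.
  base prefactor choices : ℕ → ℕ
  base d = suc (suc (quotient d K))
  prefactor d = (2 * (base d * base d)) ^ K
  choices d = quotient (prefactor d * 126 ^ d) (100 ^ d)

  valid-small : ∀ {d} ρ (xs : Vec (Fin 2) d) e → let open Walk (quotient d K); (σ′ , e′) = walk ρ xs (initially , e) in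
                e′ ≡ 0 → bad σ′ + rem σ′ ≡ 0 → e < choices d
  valid-small {d} ρ xs e z ok = finish (valid-bounded U ρ xs initially e z ok initial)
    where
    open ≤-Reasoning
    open Walk (quotient d K)
    open Cost (quotient d K)
    -- The square of U is K * 8s², the possible growth of the potential over K blocks; on the other
    -- hand κ * U = K * s.
    U = 8 * κ * s
    m = blocks 0 d
    d< : d < K * s
    d< = begin
      suc d                                       ≡⟨ cong suc (quotient-digit d 1≤K) ⟩
      suc (digit d K) + quotient d K * K          ≤⟨ +-monoˡ-≤ (quotient d K * K) (digit< d 1≤K) ⟩
      s * K                                       ≡⟨ *-comm s K ⟩
      K * s                                       ∎
    m≤K : m ≤ K
    m≤K = ≤-pred (*-cancelʳ-< s m (suc K) (begin-strict
      m * s        ≡⟨ +-identityʳ (m * s) ⟨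
      m * s + 0    ≤⟨ blocks-bound 0 d z≤n ⟩
      d + s        <⟨ +-monoˡ-< s d< ⟩
      K * s + s    ≡⟨ +-comm (K * s) s ⟩
      suc K * s    ∎))
    initial : 0 + m * (8 * (s * s)) ≤ U * U
    initial = begin
      m * (8 * (s * s))            ≤⟨ *-monoˡ-≤ (8 * (s * s)) m≤K ⟩
      K * (8 * (s * s))            ≡⟨ cong (_* (8 * (s * s))) K≡ ⟩
      8 * (κ * κ) * (8 * (s * s))  ≡⟨ e₁ κ s ⟩
      U * U                        ∎
      where
      e₁ : ∀ k s → 8 * (k * k) * (8 * (s * s)) ≡ (8 * k * s) * (8 * k * s)
      e₁ = solve-∀
    finish : Bounded U ρ d initially e → e < choices d
    finish (bounded _ _ F cheap small) = *≤⇒≤quotient (suc e) (100 ^ d) (m^n>0 100 d) (begin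
      suc e * 100 ^ d                      ≤⟨ *-monoˡ-≤ (100 ^ d) small ⟩
      (B * B) ^ m * 2 ^ F * 100 ^ d        ≡⟨ *-assoc ((B * B) ^ m) (2 ^ F) (100 ^ d) ⟩
      (B * B) ^ m * (2 ^ F * 100 ^ d)      ≤⟨ *-mono-≤ (^-monoʳ-≤ (B * B) m≤K) (free-bits-bound F d F≤) ⟩
      (B * B) ^ K * (2 ^ K * 126 ^ d)      ≡⟨ e₂ ((B * B) ^ K) (2 ^ K) (126 ^ d) ⟩
      2 ^ K * (B * B) ^ K * 126 ^ d        ≡⟨ cong (_* 126 ^ d) (^-distribʳ-* K 2 (B * B)) ⟨
      prefactor d * 126 ^ d                ∎)
      where
      e₂ : ∀ x y z → x * (y * z) ≡ y * x * z
      e₂ = solve-∀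
      e₃ : ∀ k s → k * (8 * (k * k) * s + 8 * k * s) ≡ 8 * (k * k) * s * suc k
      e₃ = solve-∀
      3F≤ : 3 * F ≤ 8 * (κ * κ) * s + U
      3F≤ = begin
        3 * F                     ≡⟨ +-identityʳ (3 * F) ⟨
        3 * F + 0                 ≡⟨ cong (λ z → 3 * F + z) (own-start ρ) ⟨
        3 * F + own ρ initially       ≤⟨ cheap ⟩
        m * s + U                 ≤⟨ +-monoˡ-≤ U (*-monoˡ-≤ s m≤K) ⟩
        K * s + U                 ≡⟨ cong (λ k → k * s + U) K≡ ⟩
        8 * (κ * κ) * s + U       ∎
        where
        own-start : ∀ ρ → own ρ initially ≡ 0
        own-start left = refl
        own-start right = refl
      F≤ : F * (3 * κ) ≤ (d + K) * suc κ
      F≤ = begin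
        F * (3 * κ)                          ≡⟨ e₄ F κ ⟩
        κ * (3 * F)                          ≤⟨ *-monoʳ-≤ κ 3F≤ ⟩
        κ * (8 * (κ * κ) * s + 8 * κ * s)    ≡⟨ e₃ κ s ⟩
        8 * (κ * κ) * s * suc κ              ≡⟨ cong (λ k → k * s * suc κ) K≡ ⟨
        K * s * suc κ                        ≤⟨ *-monoˡ-≤ (suc κ) Ks≤ ⟩
        (d + K) * suc κ                      ∎
        where
        e₄ : ∀ f k → f * (3 * k) ≡ k * (3 * f)
        e₄ = solve-∀
        Ks≤ : K * s ≤ d + K
        Ks≤ = begin
          K * s                ≡⟨ *-comm K s ⟩
          K + quotient d K * K ≤⟨ +-monoʳ-≤ K (quotient*≤ d K) ⟩
          K + d                ≡⟨ +-comm K d ⟩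
          d + K                ∎

-- The table of hits yields the number of orthogonal pairs

module Counting where

  import Data.Integer.Properties as ℤ
  import Data.List.Base as List
  import Data.List.Properties as List
  open Prelude
  open Machine
  open Sums
  open Decomposition
  open Parameters

  indicator : Bool → ℤ
  indicator b = if b then 1ℤ else 0ℤ

  -- It vanishes exactly if the guesses were right and the choice number is used up, so the machine
  -- needs one test only.
  undone : Ctl × ℕ → ℕ
  undone (σ , e) = bad σ + rem σ + e

  hit : ℕ → Ctl × ℕ → ℤ
  hit κ p = branch (undone p) 0ℤ (indicator (key (proj₁ p) ≡ᵇ κ))

  gain : (ℕ → ℤ) → Ctl × ℕ → ℤ
  gain t p = branch (undone p) 0ℤ (sign (sg (proj₁ p)) *ᶻ t (key (proj₁ p)))

  ≡ᵇ-comm : ∀ m n → (m ≡ᵇ n) ≡ (n ≡ᵇ m)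
  ≡ᵇ-comm zero    zero    = refl
  ≡ᵇ-comm zero    (suc n) = refl
  ≡ᵇ-comm (suc m) zero    = refl
  ≡ᵇ-comm (suc m) (suc n) = ≡ᵇ-comm m n

  module Count (d : ℕ) where
    open Walk (quotient d K)

    M : ℕ
    M = choices d

    leaf : Role → Vec (Fin 2) d → ℕ → Ctl × ℕ
    leaf ρ x e = walk ρ x (initially , e)

    total : ∀ ρ (x : Vec (Fin 2) d) f → (∀ o → valid o ≡ false → f o ≡ 0ℤ) →
            ∑ M (λ e → settle f (leaf ρ x e)) ≡ paths ρ x initially f
    total ρ x f h = ⇝-∑ (walk-paths ρ x initially f) beyond
      where
      beyond : ∀ e → M ≤ e → settle f (leaf ρ x e) ≡ 0ℤ
      beyond e M≤e with leaf ρ x e in eq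
      ... | o , suc _ = refl
      ... | o , zero with bad o + rem o in ok
      ... | suc _ = h o (cong (_≡ᵇ 0) ok)
      ... | zero = contradiction M≤e (<⇒≱ (valid-small ρ x e (cong proj₂ eq)
                     (trans (cong (λ p → bad (proj₁ p) + rem (proj₁ p)) eq) ok)))

    match-invalidˡ : ∀ o o′ → valid o ≡ false → match o o′ ≡ 0ℤ
    match-invalidˡ o o′ p rewrite p = refl

    match-invalidʳ : ∀ o o′ → valid o′ ≡ false → match o o′ ≡ 0ℤ
    match-invalidʳ o o′ p rewrite p | ∧-zeroʳ (valid o) = refl

    settle-zero : ∀ {f : Ctl → ℤ} p → (∀ o → f o ≡ 0ℤ) → settle f p ≡ 0ℤ
    settle-zero (o , zero)  h = h o
    settle-zero (o , suc _) h = refl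

    right-total : ∀ (y : Vec (Fin 2) d) o →
                  ∑ M (λ e → settle (match o) (leaf right y e)) ≡ paths right y initially (match o)
    right-total y o = total right y (match o) (match-invalidʳ o)

    pair-total : ∀ x y →
      ∑ M (λ e → settle (λ o → ∑ M λ e′ → settle (match o) (leaf right y e′)) (leaf left x e)) ≡ indicator (orthogonal x y)
    pair-total x y = trans
      (∑-cong M (λ e _ → settle-cong (leaf left x e) (right-total y)))
      (trans (total left x (λ o → paths right y initially (match o)) vanish)
        (pair-equal x y 0 0 0 0 0 0 0 (λ p → contradiction refl p)))
      where
      settle-cong : ∀ {f g : Ctl → ℤ} p → (∀ o → f o ≡ g o) → settle f p ≡ settle g p
      settle-cong (o , zero)  h = h o
      settle-cong (o , suc _) h = refl
      vanish : ∀ o → valid o ≡ false → paths right y initially (match o) ≡ 0ℤ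
      vanish o p = trans (sym (right-total y o)) (∑-zero M λ e _ → settle-zero {match o} (leaf right y e) λ o′ → match-invalidˡ o o′ p)

    -- The sign distributes over the table entry, which is a sum over all right leaves; each summand
    -- then is a single match of a left leaf with a right leaf.
    gain-hits : ∀ n (q : ℕ → ℕ → Ctl × ℕ) p →
      gain (λ κ → ∑ n λ j → ∑ M λ e → hit κ (q j e)) p ≡ ∑ n λ j → settle (λ o → ∑ M λ e → settle (match o) (q j e)) p
    gain-hits n q (o , suc e) rewrite +-comm (bad o + rem o) (suc e) = sym (∑-zero n λ _ _ → refl)
    gain-hits n q (o , zero) = cases (bad o + rem o) refl
      where
      F = λ κ → ∑ n λ j → ∑ M λ e → hit κ (q j e)
      each : bad o + rem o ≡ 0 → ∀ p → sign (sg o) *ᶻ hit (key o) p ≡ settle (match o) p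
      each ok (o′ , suc e) rewrite +-comm (bad o′ + rem o′) (suc e) = ℤ.*-zeroʳ (sign (sg o))
      each ok (o′ , zero) rewrite ok | +-identityʳ (bad o′ + rem o′) with bad o′ + rem o′
      ... | suc _ = ℤ.*-zeroʳ (sign (sg o))
      ... | zero rewrite ≡ᵇ-comm (key o′) (key o) with key o ≡ᵇ key o′
      ...   | true  = ℤ.*-identityʳ (sign (sg o))
      ...   | false = ℤ.*-zeroʳ (sign (sg o))
      cases : ∀ b → bad o + rem o ≡ b → gain F (o , 0) ≡ ∑ n λ j → settle (λ o → ∑ M λ e → settle (match o) (q j e)) (o , 0)
      cases (suc b) ok = trans (cong (λ t → branch t 0ℤ (sign (sg o) *ᶻ F (key o))) (trans (+-identityʳ _) ok))
        (sym (∑-zero n λ j _ → ∑-zero M λ e _ → settle-zero {match o} (q j e) λ o′ → match-invalidˡ o o′ (cong (_≡ᵇ 0) ok)))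
      cases zero ok = trans (cong (λ t → branch t 0ℤ (sign (sg o) *ᶻ F (key o))) (trans (+-identityʳ _) ok))
        (trans (∑-*ˡ n (sign (sg o)) (λ j → ∑ M λ e → hit (key o) (q j e))) (∑-cong n λ j _ →
          trans (∑-*ˡ M (sign (sg o)) (λ e → hit (key o) (q j e))) (∑-cong M λ e _ → each ok (q j e))))

    gain-total : ∀ n (x y : ℕ → Vec (Fin 2) d) →
      ∑ n (λ i → ∑ M λ e → gain (λ κ → ∑ n λ j → ∑ M λ e′ → hit κ (leaf right (y j) e′)) (leaf left (x i) e)) ≡
      ∑ n (λ i → ∑ n λ j → indicator (orthogonal (x i) (y j)))
    gain-total n x y = ∑-cong n λ i _ →
      trans (∑-cong M λ e _ → gain-hits n (λ j → leaf right (y j)) (leaf left (x i) e))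
        (trans (∑-swap M n (λ e j → settle (λ o → ∑ M λ e′ → settle (match o) (leaf right (y j) e′)) (leaf left (x i) e)))
          (∑-cong n λ j _ → pair-total (x i) (y j)))

  -- Over the integers this excludes that a common one is cancelled by the other coordinates.
  inner-nonneg : ∀ {d} (x y : Vec (Fin 2) d) → ∃[ m ] ⟨ x , y ⟩ ≡ + m
  inner-nonneg [] [] = 0 , refl
  inner-nonneg (a ∷ x) (b ∷ y) with inner-nonneg x y
  ... | m , eq = toℕ a * toℕ b + m , trans (cong₂ _+ᶻ_ (sym (ℤ.pos-* (toℕ a) (toℕ b))) eq) refl

  inner-zero : ∀ {d} (x y : Vec (Fin 2) d) → does (⟨ x , y ⟩ ℤ.≟ 0ℤ) ≡ orthogonal x y
  inner-zero [] [] = refl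
  inner-zero (zero ∷ x) (b ∷ y) = trans (cong (λ z → does (z ℤ.≟ 0ℤ)) (ℤ.+-identityˡ ⟨ x , y ⟩)) (inner-zero x y)
  inner-zero (suc zero ∷ x) (zero ∷ y) = trans (cong (λ z → does (z ℤ.≟ 0ℤ)) (ℤ.+-identityˡ ⟨ x , y ⟩)) (inner-zero x y)
  inner-zero (suc zero ∷ x) (suc zero ∷ y) with inner-nonneg x y
  ... | m , eq = cong (λ z → does ((1ℤ +ᶻ z) ℤ.≟ 0ℤ)) eq

  -- Total indexing by natural numbers, as the machine counts; the zero vector beyond the end is an
  -- arbitrary default.
  row : ∀ {n d} → Vec (Vec (Fin 2) d) n → ℕ → Vec (Fin 2) d
  row []        _        = replicate _ zero
  row (x ∷ xs)  zero     = x
  row (x ∷ xs)  (suc i)  = row xs i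

  row-lookup : ∀ {n d} (w : Vec (Vec (Fin 2) d) n) i → row w (toℕ i) ≡ lookup w i
  row-lookup (x ∷ w) zero = refl
  row-lookup (x ∷ w) (suc i) = row-lookup w i

  total-list : ∀ {A : Set} → (A → ℤ) → List A → ℤ
  total-list f = List.foldr (λ x → f x +ᶻ_) 0ℤ

  total-++ : ∀ {A : Set} (f : A → ℤ) xs ys → total-list f (xs List.++ ys) ≡ total-list f xs +ᶻ total-list f ys
  total-++ f [] ys = sym (ℤ.+-identityˡ _)
  total-++ f (x ∷ xs) ys = trans (cong (f x +ᶻ_) (total-++ f xs ys)) (sym (ℤ.+-assoc (f x) _ _))

  total-map : ∀ {A B : Set} (f : B → ℤ) (g : A → B) xs → total-list f (List.map g xs) ≡ total-list (f ∘ g) xs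
  total-map f g [] = refl
  total-map f g (x ∷ xs) = cong (f (g x) +ᶻ_) (total-map f g xs)

  total-tabulate : ∀ {A : Set} n (f : A → ℤ) (g : Fin n → A) h → (∀ i → f (g i) ≡ h (toℕ i)) →
                   total-list f (List.tabulate g) ≡ ∑ n h
  total-tabulate zero f g h eq = refl
  total-tabulate (suc n) f g h eq =
    trans (cong₂ _+ᶻ_ (trans (eq zero) (sym (ℤ.+-identityʳ (h 0)))) (total-tabulate n f (g ∘ suc) (h ∘ suc) (eq ∘ suc)))
      (sym (∑-split 1 n h))

  total-product : ∀ {A B : Set} (f : A × B → ℤ) xs ys →
                  total-list f (List.cartesianProduct xs ys) ≡ total-list (λ x → total-list (λ y → f (x , y)) ys) xs
  total-product f [] ys = refl
  total-product f (x ∷ xs) ys = trans (total-++ f (List.map (x ,_) ys) _)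
    (cong₂ _+ᶻ_ (total-map f (x ,_) ys) (total-product f xs ys))

  length-filter : ∀ {A : Set} {P : A → Set} (P? : Decidable P) xs →
                  + List.length (List.filter P? xs) ≡ total-list (λ x → indicator (does (P? x))) xs
  length-filter P? [] = refl
  length-filter P? (x ∷ xs) with does (P? x)
  ... | true  = cong (1ℤ +ᶻ_) (length-filter P? xs)
  ... | false = trans (length-filter P? xs) (sym (ℤ.+-identityˡ _))

  #OV-total : ∀ {n d} (u v : Vec (Vec (Fin 2) d) n) →
    + #OV u v ≡ ∑ n λ i → ∑ n λ j → indicator (orthogonal (row u i) (row v j))
  #OV-total {n} {d} u v = trans (length-filter _ (List.cartesianProduct (List.allFin n) (List.allFin n)))
    (trans (total-product f (List.allFin n) (List.allFin n))
      (total-tabulate n (λ i → total-list (λ j → f (i , j)) (List.allFin n)) (λ i → i) _ λ i →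
        total-tabulate n (λ j → f (i , j)) (λ j → j) _ λ j →
          cong indicator (trans (inner-zero (lookup u i) (lookup v j)) (sym (cong₂ orthogonal (row-lookup u i) (row-lookup v j))))))
    where
    f : Fin n × Fin n → ℤ
    f (i , j) = indicator (does (⟨ lookup u i , lookup v j ⟩ ℤ.≟ 0ℤ))

-- Code for one coordinate and its symbolic execution

module WalkCode where

  open Prelude
  open Machine
  open Sums using (digit)
  open Decomposition
  open Parameters

  -- Registers: 0 n; 1 d; 2 the constant one; 3 s; 4 B; 5 the number of choices;
  -- 6 the start of the table; 7 the main counter; 8, 9 the gains of either sign;
  -- 10 e; 11 nonzero for the left role; 12 the address of the next coordinate;
  -- 13-15 k, w₁, w₂; 16, 17 f₀, f₁ of the mode; 18-21 rem, bad, key, sg;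
  -- 22 the inner counter; 23-31 scratch.

  skip : Code
  skip = ins (2 ≔ 1)

  pop : Reg → Reg → Code
  pop r b = ins (div 25 10 b) ⨟ ins (mul r 25 b) ⨟ ins (sub r 10 r) ⨟ ins (10 ≔ʳ 25)

  -- The code is cut at the conditionals, since symbolic execution handles straight-line pieces.
  -- Registers 27 and 28 first hold the guesses a and b, then the costs of the option, which for
  -- `signed` coincide. Registers 25 and 29 hold the truncated differences that `choose` tests, and
  -- 31 holds the constant 3.
  guessPre guessCode signedCode copyRightPre copyRightCode copyLeftPre copyLeftCode weighCode blockCode : Code
  readPre readCode consumePre keyCode coordCode walkCode : Code
  guessPre =
    ins (13 ≔ʳ 3) ⨟ ins (add 19 19 18) ⨟ pop 27 4 ⨟ pop 28 4 ⨟
    ins (mul 20 20 4) ⨟ ins (add 20 20 27) ⨟ ins (mul 20 20 4) ⨟ ins (add 20 20 28) ⨟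
    ins (31 ≔ 3) ⨟ ins (add 23 14 15) ⨟ ins (mul 23 23 3) ⨟
    ins (sub 24 3 28) ⨟ ins (mul 25 24 15) ⨟ ins (mul 25 25 31) ⨟ ins (sub 25 25 23) ⨟
    ins (sub 26 3 27) ⨟ ins (mul 29 26 14) ⨟ ins (mul 29 29 31) ⨟ ins (sub 29 29 23)
  guessCode     = guessPre ⨟ cond 11 (ins (18 ≔ʳ 27)) (ins (18 ≔ʳ 28))
  signedCode    = ins (16 ≔ 0) ⨟ ins (17 ≔ 1)
  copyRightPre  = ins (27 ≔ʳ 26) ⨟ ins (28 ≔ 0) ⨟ ins (17 ≔ 0)
  copyRightCode = copyRightPre ⨟ cond 11 (ins (16 ≔ 1)) (ins (16 ≔ 0))
  copyLeftPre   = ins (27 ≔ 0) ⨟ ins (28 ≔ʳ 24) ⨟ ins (17 ≔ 0)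
  copyLeftCode  = copyLeftPre ⨟ cond 11 (ins (16 ≔ 0)) (ins (16 ≔ 1))
  weighCode =
    ins (mul 27 27 31) ⨟ ins (add 14 14 27) ⨟ ins (sub 14 14 3) ⨟
    ins (mul 28 28 31) ⨟ ins (add 15 15 28) ⨟ ins (sub 15 15 3) ⨟ ins (29 ≔ 0)
  blockCode = guessCode ⨟ cond 25 (cond 29 signedCode copyRightCode) copyLeftCode ⨟ weighCode
  readPre =
    ins (load 23 12) ⨟ ins (add 12 12 2) ⨟ ins (sub 13 13 2) ⨟
    ins (sub 25 23 18) ⨟ ins (add 19 19 25) ⨟ ins (sub 18 18 23)
  readCode = readPre ⨟ cond 23 (ins (24 ≔ʳ 17)) (ins (24 ≔ʳ 16))
  consumePre = ins (add 24 24 2) ⨟ pop 26 24 ⨟ ins (mul 25 17 26)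
  keyCode =
    ins (sub 25 2 16) ⨟ ins (sub 25 25 17) ⨟ ins (mul 25 25 23) ⨟ ins (add 26 26 25) ⨟
    ins (mul 20 20 4) ⨟ ins (add 20 20 26)
  coordCode = readCode ⨟ consumePre ⨟ cond 25 (ins (sub 21 2 21)) skip ⨟ keyCode
  walkCode = cond 13 skip blockCode ⨟ coordCode

  -- Registers are described by expressions over the initial state. The expression for a concrete
  -- register is found by evaluation, and what remains of a correctness proof is a congruence over
  -- its leaves.
  data Expr : Set where
    var lit : ℕ → Expr
    cell : Expr → Expr
    _:+_ _:∸_ _:*_ _:/_ : Expr → Expr → Expr

  ⟦_⟧ᴱ : Expr → State → ℕ
  ⟦ var r ⟧ᴱ   t = reg t r
  ⟦ lit c ⟧ᴱ   t = c
  ⟦ cell x ⟧ᴱ  t = mem t (⟦ x ⟧ᴱ t)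
  ⟦ x :+ y ⟧ᴱ  t = ⟦ x ⟧ᴱ t + ⟦ y ⟧ᴱ t
  ⟦ x :∸ y ⟧ᴱ  t = ⟦ x ⟧ᴱ t ∸ ⟦ y ⟧ᴱ t
  ⟦ x :* y ⟧ᴱ  t = ⟦ x ⟧ᴱ t * ⟦ y ⟧ᴱ t
  ⟦ x :/ y ⟧ᴱ  t = quotient (⟦ x ⟧ᴱ t) (⟦ y ⟧ᴱ t)

  assign : Reg → Expr → (Reg → Expr) → Reg → Expr
  assign r x f y = if r ≡ᵇ y then x else f y

  -- Every `cell` refers to the memory at the start, which is sound because `straight` excludes
  -- stores. The last clause is never reached by straight code.
  symbolic : Code → (Reg → Expr) → Reg → Expr
  symbolic (ins (r ≔ c))      f = assign r (lit c) f
  symbolic (ins (r ≔ʳ a))     f = assign r (f a) f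
  symbolic (ins (add r a b))  f = assign r (f a :+ f b) f
  symbolic (ins (sub r a b))  f = assign r (f a :∸ f b) f
  symbolic (ins (mul r a b))  f = assign r (f a :* f b) f
  symbolic (ins (div r a b))  f = assign r (f a :/ f b) f
  symbolic (ins (load r a))   f = assign r (cell (f a)) f
  symbolic (c ⨟ c′)           f = symbolic c′ (symbolic c f)
  symbolic _                  f = f

  straight : Code → Bool
  straight (ins (store _ _))  = false
  straight (ins _)            = true
  straight (c ⨟ c′)           = straight c ∧ straight c′
  straight _                  = false

  record Run (c : Code) (t t′ : State) : Set where
    constructor run
    field val : ∀ r → reg t′ r ≡ ⟦ symbolic c var r ⟧ᴱ t
  open Run public

  module _ (t₀ : State) where

    Denotes : (Reg → Expr) → State → Set
    Denotes f t = (∀ r → reg t r ≡ ⟦ f r ⟧ᴱ t₀) × mem t ≡ mem t₀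

    assigned : ∀ {f t} r {x v} → Denotes f t → v ≡ ⟦ x ⟧ᴱ t₀ → Denotes (assign r x f) (state (reg t [ r ↦ v ]) (mem t))
    assigned {f} {t} r {x} {v} (h , h′) eq = h₁ , h′
      where
      h₁ : ∀ y → (reg t [ r ↦ v ]) y ≡ ⟦ assign r x f y ⟧ᴱ t₀
      h₁ y with r ≡ᵇ y
      ... | true  = eq
      ... | false = h y

    opaque
      unfolding exec

      denotes : ∀ c {f t} → T (straight c) → Denotes f t → Denotes (symbolic c f) (exec c t)
      denotes (ins (r ≔ c))      _ h = assigned r h refl
      denotes (ins (r ≔ʳ a))     _ h = assigned r h (proj₁ h a)
      denotes (ins (add r a b))  _ h = assigned r h (cong₂ _+_ (proj₁ h a) (proj₁ h b))
      denotes (ins (sub r a b))  _ h = assigned r h (cong₂ _∸_ (proj₁ h a) (proj₁ h b))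
      denotes (ins (mul r a b))  _ h = assigned r h (cong₂ _*_ (proj₁ h a) (proj₁ h b))
      denotes (ins (div r a b))  _ h = assigned r h (cong₂ quotient (proj₁ h a) (proj₁ h b))
      denotes (ins (load r a))   _ h = assigned r h (cong₂ (λ M x → M x) (proj₂ h) (proj₁ h a))
      denotes (c ⨟ c′) p h with p₁ , p₂ ← ∧-split {straight c} p = denotes c′ p₂ (denotes c p₁ h)

  evaluate : ∀ {c t t′} → Run c t t′ → ∀ r x {v} → symbolic c var r ≡ x → ⟦ x ⟧ᴱ t ≡ v → reg t′ r ≡ v
  evaluate {t = t} h r x p q = trans (val h r) (trans (cong (λ y → ⟦ y ⟧ᴱ t) p) q)

  runs : ∀ c t → T (straight c) → Run c t (exec c t)
  runs c t p = run (proj₁ (denotes t c p ((λ _ → refl) , refl)))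

  infixl 6 _⟨+⟩_ _⟨∸⟩_
  infixl 7 _⟨*⟩_ _⟨/⟩_

  _⟨+⟩_ : ∀ {a b c d : ℕ} → a ≡ b → c ≡ d → a + c ≡ b + d
  _⟨+⟩_ = cong₂ _+_
  _⟨∸⟩_ : ∀ {a b c d : ℕ} → a ≡ b → c ≡ d → a ∸ c ≡ b ∸ d
  _⟨∸⟩_ = cong₂ _∸_
  _⟨*⟩_ : ∀ {a b c d : ℕ} → a ≡ b → c ≡ d → a * c ≡ b * d
  _⟨*⟩_ = cong₂ _*_
  _⟨/⟩_ : ∀ {a b c d : ℕ} → a ≡ b → c ≡ d → quotient a c ≡ quotient b d
  _⟨/⟩_ = cong₂ quotient

  IsRole : Role → ℕ → Set
  IsRole left   n = n ≢ 0
  IsRole right  n = n ≡ 0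

  opaque
    unfolding exec

    in-sequence : ∀ (Q : State → Set) c c′ t → Q (exec c′ (exec c t)) → Q (exec (c ⨟ c′) t)
    in-sequence Q c c′ t q = q

    -- A conditional followed by `c` is replaced by two programs without the conditional. The
    -- specification branches on the same number, so it need not be known which way the machine
    -- goes.
    by-branch : ∀ {A : Set} (Q : A → State → Set) r x y c {n a a′} t → reg t r ≡ n →
                Q a (exec (x ⨟ c) t) → Q a′ (exec (y ⨟ c) t) → Q (branch n a a′) (exec (cond r x y ⨟ c) t)
    by-branch Q r x y c t refl p q with reg t r
    ... | zero   = q
    ... | suc _  = p

    by-branch-last : ∀ {A : Set} (Q : A → State → Set) r x y {n a a′} t → reg t r ≡ n →
                     Q a (exec x t) → Q a′ (exec y t) → Q (branch n a a′) (exec (cond r x y) t)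
    by-branch-last Q r x y t refl p q with reg t r
    ... | zero   = q
    ... | suc _  = p

    by-branch-after : ∀ {A : Set} (Q : A → State → Set) p r x y c {n a a′} t → reg (exec p t) r ≡ n →
                      Q a (exec (p ⨟ x ⨟ c) t) → Q a′ (exec (p ⨟ y ⨟ c) t) → Q (branch n a a′) (exec (p ⨟ cond r x y ⨟ c) t)
    by-branch-after Q p r x y c t = by-branch Q r x y c (exec p t)

    by-zero-after : ∀ (Q : State → Set) p r x y t →
                    (reg (exec p t) r ≢ 0 → Q (exec (p ⨟ x) t)) → (reg (exec p t) r ≡ 0 → Q (exec (p ⨟ y) t)) →
                    Q (exec (p ⨟ cond r x y) t)
    by-zero-after Q p r x y t = branch-elim Q (reg (exec p t) r)

    by-role : ∀ (Q : State → Set) ρ p x y t → IsRole ρ (reg (exec p t) 11) →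
              Q (exec (p ⨟ pick ρ x y) t) → Q (exec (p ⨟ cond 11 x y) t)
    by-role Q left   p x y t r q = branch-elim Q (reg (exec p t) 11) (λ _ → q) (λ z → contradiction z r)
    by-role Q right  p x y t r q = branch-elim Q (reg (exec p t) 11) (λ z → contradiction r z) (λ _ → q)

    by-role-then : ∀ (Q : State → Set) ρ p x y c t → IsRole ρ (reg (exec p t) 11) →
                   Q (exec ((p ⨟ pick ρ x y) ⨟ c) t) → Q (exec ((p ⨟ cond 11 x y) ⨟ c) t)
    by-role-then Q ρ p x y c t = by-role (λ t → Q (exec c t)) ρ p x y t

  module Refine (s-1 : ℕ) where
    open Walk s-1

    record Rep (ρ : Role) (p : Ctl × ℕ) (t : State) : Set where
      constructor rep
      σ = proj₁ p
      field
        r₂   : reg t 2 ≡ 1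
        r₃   : reg t 3 ≡ s
        r₄   : reg t 4 ≡ B
        r₁₀  : reg t 10 ≡ proj₂ p
        r₁₁  : IsRole ρ (reg t 11)
        r₁₃  : reg t 13 ≡ k σ
        r₁₄  : reg t 14 ≡ w₁ σ
        r₁₅  : reg t 15 ≡ w₂ σ
        r₁₆  : reg t 16 ≡ f₀ (mode σ)
        r₁₇  : reg t 17 ≡ f₁ (mode σ)
        r₁₈  : reg t 18 ≡ rem σ
        r₁₉  : reg t 19 ≡ bad σ
        r₂₀  : reg t 20 ≡ key σ
        r₂₁  : reg t 21 ≡ sg σ

    record Guessed (ρ : Role) (σ : Ctl) (e : ℕ) (t : State) : Set where
      constructor guessed
      a = digit e B
      b = digit (quotient e B) B
      field
        r₂   : reg t 2 ≡ 1
        r₃   : reg t 3 ≡ s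
        r₄   : reg t 4 ≡ B
        r₁₀  : reg t 10 ≡ quotient (quotient e B) B
        r₁₁  : IsRole ρ (reg t 11)
        r₁₃  : reg t 13 ≡ s
        r₁₄  : reg t 14 ≡ w₁ σ
        r₁₅  : reg t 15 ≡ w₂ σ
        r₁₈  : reg t 18 ≡ pick ρ a b
        r₁₉  : reg t 19 ≡ bad σ + rem σ
        r₂₀  : reg t 20 ≡ (key σ * B + a) * B + b
        r₂₁  : reg t 21 ≡ sg σ
        r₂₄  : reg t 24 ≡ s ∸ b
        r₂₅  : reg t 25 ≡ (s ∸ b) * w₂ σ * 3 ∸ (w₁ σ + w₂ σ) * s
        r₂₆  : reg t 26 ≡ s ∸ a
        r₂₇  : reg t 27 ≡ a
        r₂₈  : reg t 28 ≡ b
        r₂₉  : reg t 29 ≡ (s ∸ a) * w₁ σ * 3 ∸ (w₁ σ + w₂ σ) * s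
        r₃₁  : reg t 31 ≡ 3

    guess-rep : ∀ ρ {σ e t t′} → Rep ρ (σ , e) t → Run (guessPre ⨟ pick ρ (ins (18 ≔ʳ 27)) (ins (18 ≔ʳ 28))) t t′ → Guessed ρ σ e t′
    guess-rep ρ {σ} {e} {t} {t′} (rep r₂ r₃ r₄ r₁₀ r₁₁ r₁₃ r₁₄ r₁₅ r₁₆ r₁₇ r₁₈ r₁₉ r₂₀ r₂₁) = go ρ r₁₁
      where
      A B′ D S W₁ W₂ X : Expr
      A = var 10 :∸ ((var 10 :/ var 4) :* var 4)
      D = var 10 :/ var 4
      B′ = D :∸ ((D :/ var 4) :* var 4)
      S = (var 14 :+ var 15) :* var 3
      W₁ = (((var 3 :∸ A) :* var 14) :* lit 3) :∸ S
      W₂ = (((var 3 :∸ B′) :* var 15) :* lit 3) :∸ S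
      X = (((var 20 :* var 4) :+ A) :* var 4) :+ B′
      d₁ : ⟦ A ⟧ᴱ t ≡ digit e B
      d₁ = r₁₀ ⟨∸⟩ (r₁₀ ⟨/⟩ r₄) ⟨*⟩ r₄
      d₂ : ⟦ B′ ⟧ᴱ t ≡ digit (quotient e B) B
      d₂ = (r₁₀ ⟨/⟩ r₄) ⟨∸⟩ (r₁₀ ⟨/⟩ r₄ ⟨/⟩ r₄) ⟨*⟩ r₄
      q₂ : ⟦ D :/ var 4 ⟧ᴱ t ≡ quotient (quotient e B) B
      q₂ = r₁₀ ⟨/⟩ r₄ ⟨/⟩ r₄
      key-eq : ⟦ X ⟧ᴱ t ≡ (key σ * B + digit e B) * B + digit (quotient e B) B
      key-eq = (r₂₀ ⟨*⟩ r₄ ⟨+⟩ d₁) ⟨*⟩ r₄ ⟨+⟩ d₂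
      S-eq : ⟦ S ⟧ᴱ t ≡ (w₁ σ + w₂ σ) * s
      S-eq = (r₁₄ ⟨+⟩ r₁₅) ⟨*⟩ r₃
      W₂-eq : ⟦ W₂ ⟧ᴱ t ≡ (s ∸ digit (quotient e B) B) * w₂ σ * 3 ∸ (w₁ σ + w₂ σ) * s
      W₂-eq = (r₃ ⟨∸⟩ d₂) ⟨*⟩ r₁₅ ⟨*⟩ refl ⟨∸⟩ S-eq
      W₁-eq : ⟦ W₁ ⟧ᴱ t ≡ (s ∸ digit e B) * w₁ σ * 3 ∸ (w₁ σ + w₂ σ) * s
      W₁-eq = (r₃ ⟨∸⟩ d₁) ⟨*⟩ r₁₄ ⟨*⟩ refl ⟨∸⟩ S-eq
      go : ∀ ρ → IsRole ρ (reg t 11) → Run (guessPre ⨟ pick ρ (ins (18 ≔ʳ 27)) (ins (18 ≔ʳ 28))) t t′ → Guessed ρ σ e t′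
      go left r₁₁ h = guessed (trans (val h 2) r₂) (trans (val h 3) r₃) (trans (val h 4) r₄) (evaluate h 10 (D :/ var 4) refl q₂) (subst (IsRole left) (sym (val h 11)) r₁₁)
        (trans (val h 13) r₃) (trans (val h 14) r₁₄) (trans (val h 15) r₁₅) (evaluate h 18 A refl d₁) (trans (val h 19) (r₁₉ ⟨+⟩ r₁₈))
        (evaluate h 20 X refl key-eq) (trans (val h 21) r₂₁)
        (evaluate h 24 (var 3 :∸ B′) refl (r₃ ⟨∸⟩ d₂)) (evaluate h 25 W₂ refl W₂-eq)
        (evaluate h 26 (var 3 :∸ A) refl (r₃ ⟨∸⟩ d₁)) (evaluate h 27 A refl d₁) (evaluate h 28 B′ refl d₂)
        (evaluate h 29 W₁ refl W₁-eq) (val h 31)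
      go right r₁₁ h = guessed (trans (val h 2) r₂) (trans (val h 3) r₃) (trans (val h 4) r₄) (evaluate h 10 (D :/ var 4) refl q₂) (subst (IsRole right) (sym (val h 11)) r₁₁)
        (trans (val h 13) r₃) (trans (val h 14) r₁₄) (trans (val h 15) r₁₅) (evaluate h 18 B′ refl d₂) (trans (val h 19) (r₁₉ ⟨+⟩ r₁₈))
        (evaluate h 20 X refl key-eq) (trans (val h 21) r₂₁)
        (evaluate h 24 (var 3 :∸ B′) refl (r₃ ⟨∸⟩ d₂)) (evaluate h 25 W₂ refl W₂-eq)
        (evaluate h 26 (var 3 :∸ A) refl (r₃ ⟨∸⟩ d₁)) (evaluate h 27 A refl d₁) (evaluate h 28 B′ refl d₂)
        (evaluate h 29 W₁ refl W₁-eq) (val h 31)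

    guessed-state : ∀ ρ {σ e t} → Rep ρ (σ , e) t → Guessed ρ σ e (exec guessCode t)
    guessed-state ρ {σ} {e} {t} h =
      by-role (Guessed ρ σ e) ρ guessPre (ins (18 ≔ʳ 27)) (ins (18 ≔ʳ 28)) t
        (subst (IsRole ρ) (sym (unwritten guessPre t 11 tt)) (Rep.r₁₁ h))
        (guess-rep ρ h (runs (guessPre ⨟ pick ρ (ins (18 ≔ʳ 27)) (ins (18 ≔ʳ 28))) t (flat ρ)))
      where
      flat : ∀ ρ → T (straight (guessPre ⨟ pick ρ (ins (18 ≔ʳ 27)) (ins (18 ≔ʳ 28))))
      flat left  = tt
      flat right = tt

    -- Here the option is an argument, so that each can be verified separately; since `choose`
    -- consists of branches, `by-branch` reassembles `block` from the three cases.
    block-as : Role → Option → ℕ → ℕ → Ctl → Ctl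
    block-as ρ o a b (ctl k w₁ w₂ m r bd κ sg) =
      ctl s (w₁ + left-cost o a b * 3 ∸ s) (w₂ + right-cost o a b * 3 ∸ s) (modeOf ρ o)
        (pick ρ a b) (bd + r) ((κ * B + a) * B + b) sg

    optionCode : Role → Option → Code
    optionCode ρ signed     = signedCode
    optionCode ρ copyRight  = copyRightPre ⨟ pick ρ (ins (16 ≔ 1)) (ins (16 ≔ 0))
    optionCode ρ copyLeft   = copyLeftPre ⨟ pick ρ (ins (16 ≔ 0)) (ins (16 ≔ 1))

    option-flat : ∀ ρ o → T (straight (optionCode ρ o ⨟ weighCode))
    option-flat left  copyLeft   = tt
    option-flat left  copyRight  = tt
    option-flat left  signed     = tt
    option-flat right copyLeft   = tt
    option-flat right copyRight  = tt
    option-flat right signed     = tt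

    After : Role → Ctl → ℕ → Option → State → Set
    After ρ σ e o = Rep ρ (block-as ρ o (digit e B) (digit (quotient e B) B) σ , quotient (quotient e B) B)

    option-rep : ∀ ρ o {σ e t t′} → Guessed ρ σ e t → Run (optionCode ρ o ⨟ weighCode) t t′ → After ρ σ e o t′
    option-rep ρ o {σ@(ctl _ _ _ _ _ _ _ _)} {e} {t} {t′} (guessed r₂ r₃ r₄ r₁₀ r₁₁ r₁₃ r₁₄ r₁₅ r₁₈ r₁₉ r₂₀ r₂₁ r₂₄ r₂₅ r₂₆ r₂₇ r₂₈ r₂₉ r₃₁) =
      go ρ o r₁₁ r₁₈
      where
      w : ∀ {x y z u a b} → x ≡ y → z ≡ u → a ≡ b → x + z * a ∸ reg t 3 ≡ y + u * b ∸ s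
      w p q p′ = p ⟨+⟩ q ⟨*⟩ p′ ⟨∸⟩ r₃
      go : ∀ ρ o → IsRole ρ (reg t 11) → reg t 18 ≡ pick ρ (digit e B) (digit (quotient e B) B) →
           Run (optionCode ρ o ⨟ weighCode) t t′ → After ρ σ e o t′
      go left signed r₁₁ r₁₈ h = rep (trans (val h 2) r₂) (trans (val h 3) r₃) (trans (val h 4) r₄) (trans (val h 10) r₁₀) (subst (IsRole left) (sym (val h 11)) r₁₁)
        (trans (val h 13) r₁₃) (trans (val h 14) (w r₁₄ r₂₇ r₃₁)) (trans (val h 15) (w r₁₅ r₂₈ r₃₁)) (val h 16) (val h 17)
        (trans (val h 18) r₁₈) (trans (val h 19) r₁₉) (trans (val h 20) r₂₀) (trans (val h 21) r₂₁)
      go right signed r₁₁ r₁₈ h = rep (trans (val h 2) r₂) (trans (val h 3) r₃) (trans (val h 4) r₄) (trans (val h 10) r₁₀) (subst (IsRole right) (sym (val h 11)) r₁₁)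
        (trans (val h 13) r₁₃) (trans (val h 14) (w r₁₄ r₂₇ r₃₁)) (trans (val h 15) (w r₁₅ r₂₈ r₃₁)) (val h 16) (val h 17)
        (trans (val h 18) r₁₈) (trans (val h 19) r₁₉) (trans (val h 20) r₂₀) (trans (val h 21) r₂₁)
      go left copyRight r₁₁ r₁₈ h = rep (trans (val h 2) r₂) (trans (val h 3) r₃) (trans (val h 4) r₄) (trans (val h 10) r₁₀) (subst (IsRole left) (sym (val h 11)) r₁₁)
        (trans (val h 13) r₁₃) (trans (val h 14) (w r₁₄ r₂₆ r₃₁)) (trans (val h 15) (w {z = 0} {0} {reg t 31} r₁₅ refl r₃₁)) (val h 16) (val h 17)
        (trans (val h 18) r₁₈) (trans (val h 19) r₁₉) (trans (val h 20) r₂₀) (trans (val h 21) r₂₁)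
      go right copyRight r₁₁ r₁₈ h = rep (trans (val h 2) r₂) (trans (val h 3) r₃) (trans (val h 4) r₄) (trans (val h 10) r₁₀) (subst (IsRole right) (sym (val h 11)) r₁₁)
        (trans (val h 13) r₁₃) (trans (val h 14) (w r₁₄ r₂₆ r₃₁)) (trans (val h 15) (w {z = 0} {0} {reg t 31} r₁₅ refl r₃₁)) (val h 16) (val h 17)
        (trans (val h 18) r₁₈) (trans (val h 19) r₁₉) (trans (val h 20) r₂₀) (trans (val h 21) r₂₁)
      go left copyLeft r₁₁ r₁₈ h = rep (trans (val h 2) r₂) (trans (val h 3) r₃) (trans (val h 4) r₄) (trans (val h 10) r₁₀) (subst (IsRole left) (sym (val h 11)) r₁₁)
        (trans (val h 13) r₁₃) (trans (val h 14) (w {z = 0} {0} {reg t 31} r₁₄ refl r₃₁)) (trans (val h 15) (w r₁₅ r₂₄ r₃₁)) (val h 16) (val h 17)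
        (trans (val h 18) r₁₈) (trans (val h 19) r₁₉) (trans (val h 20) r₂₀) (trans (val h 21) r₂₁)
      go right copyLeft r₁₁ r₁₈ h = rep (trans (val h 2) r₂) (trans (val h 3) r₃) (trans (val h 4) r₄) (trans (val h 10) r₁₀) (subst (IsRole right) (sym (val h 11)) r₁₁)
        (trans (val h 13) r₁₃) (trans (val h 14) (w {z = 0} {0} {reg t 31} r₁₄ refl r₃₁)) (trans (val h 15) (w r₁₅ r₂₄ r₃₁)) (val h 16) (val h 17)
        (trans (val h 18) r₁₈) (trans (val h 19) r₁₉) (trans (val h 20) r₂₀) (trans (val h 21) r₂₁)

    option-state : ∀ ρ o {σ e t} → Guessed ρ σ e t → After ρ σ e o (exec (optionCode ρ o ⨟ weighCode) t)
    option-state ρ o {t = t} h = option-rep ρ o h (runs (optionCode ρ o ⨟ weighCode) t (option-flat ρ o))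

    block-rep : ∀ ρ {σ e t} → Rep ρ (σ , e) t →
                Rep ρ (block ρ (digit e B) (digit (quotient e B) B) σ , quotient (quotient e B) B) (exec blockCode t)
    block-rep ρ {σ@(ctl _ _ _ _ _ _ _ _)} {e} {t} h =
      in-sequence (Rep ρ _) guessCode (cond 25 (cond 29 signedCode copyRightCode) copyLeftCode ⨟ weighCode) t
        (by-branch Q 25 (cond 29 signedCode copyRightCode) copyLeftCode weighCode t₁ (Guessed.r₂₅ g)
          (by-branch Q 29 signedCode copyRightCode weighCode t₁ (Guessed.r₂₉ g)
            (option-state ρ signed g)
            (by-role-then (Q copyRight) ρ copyRightPre (ins (16 ≔ 1)) (ins (16 ≔ 0)) weighCode t₁
              (subst (IsRole ρ) (sym (unwritten copyRightPre t₁ 11 tt)) (Guessed.r₁₁ g)) (option-state ρ copyRight g)))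
          (by-role-then (Q copyLeft) ρ copyLeftPre (ins (16 ≔ 0)) (ins (16 ≔ 1)) weighCode t₁
            (subst (IsRole ρ) (sym (unwritten copyLeftPre t₁ 11 tt)) (Guessed.r₁₁ g)) (option-state ρ copyLeft g)))
      where
      Q = After ρ σ e
      t₁ = exec guessCode t
      g : Guessed ρ σ e t₁
      g = guessed-state ρ h

    record Read (ρ : Role) (σ : Ctl) (e x : ℕ) (t : State) : Set where
      constructor read
      field
        r₂   : reg t 2 ≡ 1
        r₃   : reg t 3 ≡ s
        r₄   : reg t 4 ≡ B
        r₁₀  : reg t 10 ≡ e
        r₁₁  : IsRole ρ (reg t 11)
        r₁₃  : reg t 13 ≡ k σ ∸ 1
        r₁₄  : reg t 14 ≡ w₁ σ
        r₁₅  : reg t 15 ≡ w₂ σ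
        r₁₆  : reg t 16 ≡ f₀ (mode σ)
        r₁₇  : reg t 17 ≡ f₁ (mode σ)
        r₁₈  : reg t 18 ≡ rem σ ∸ x
        r₁₉  : reg t 19 ≡ bad σ + (x ∸ rem σ)
        r₂₀  : reg t 20 ≡ key σ
        r₂₁  : reg t 21 ≡ sg σ
        r₂₃  : reg t 23 ≡ x
        r₂₄  : reg t 24 ≡ branch x (f₁ (mode σ)) (f₀ (mode σ))

    read-rep : ∀ ρ {σ e x t t′} r → Rep ρ (σ , e) t → mem t (reg t 12) ≡ x →
               r ≡ 16 × x ≡ 0 ⊎ r ≡ 17 × x ≢ 0 → Run (readPre ⨟ ins (24 ≔ʳ r)) t t′ → Read ρ σ e x t′
    read-rep ρ {σ} .16 (rep r₂ r₃ r₄ r₁₀ r₁₁ r₁₃ r₁₄ r₁₅ r₁₆ r₁₇ r₁₈ r₁₉ r₂₀ r₂₁) r₂₃ (inj₁ (refl , refl)) h =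
      read (trans (val h 2) r₂) (trans (val h 3) r₃) (trans (val h 4) r₄) (trans (val h 10) r₁₀) (subst (IsRole ρ) (sym (val h 11)) r₁₁)
        (trans (val h 13) (r₁₃ ⟨∸⟩ r₂)) (trans (val h 14) r₁₄) (trans (val h 15) r₁₅) (trans (val h 16) r₁₆) (trans (val h 17) r₁₇)
        (trans (val h 18) (r₁₈ ⟨∸⟩ r₂₃)) (trans (val h 19) (r₁₉ ⟨+⟩ (r₂₃ ⟨∸⟩ r₁₈))) (trans (val h 20) r₂₀) (trans (val h 21) r₂₁)
        (trans (val h 23) r₂₃) (trans (val h 24) r₁₆)
    read-rep ρ {σ} {x = zero}   .17 h₀ r₂₃ (inj₂ (refl , x≢0)) h = contradiction refl x≢0
    read-rep ρ {σ} {x = suc x}  .17 (rep r₂ r₃ r₄ r₁₀ r₁₁ r₁₃ r₁₄ r₁₅ r₁₆ r₁₇ r₁₈ r₁₉ r₂₀ r₂₁) r₂₃ (inj₂ (refl , _)) h =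
      read (trans (val h 2) r₂) (trans (val h 3) r₃) (trans (val h 4) r₄) (trans (val h 10) r₁₀) (subst (IsRole ρ) (sym (val h 11)) r₁₁)
        (trans (val h 13) (r₁₃ ⟨∸⟩ r₂)) (trans (val h 14) r₁₄) (trans (val h 15) r₁₅) (trans (val h 16) r₁₆) (trans (val h 17) r₁₇)
        (trans (val h 18) (r₁₈ ⟨∸⟩ r₂₃)) (trans (val h 19) (r₁₉ ⟨+⟩ (r₂₃ ⟨∸⟩ r₁₈))) (trans (val h 20) r₂₀) (trans (val h 21) r₂₁)
        (trans (val h 23) r₂₃) (trans (val h 24) r₁₇)

    read-state : ∀ ρ {σ e x t} → Rep ρ (σ , e) t → mem t (reg t 12) ≡ x → Read ρ σ e x (exec readCode t)
    read-state ρ {σ} {e} {x} {t} h r₂₃ =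
      by-zero-after (Read ρ σ e x) readPre 23 (ins (24 ≔ʳ 17)) (ins (24 ≔ʳ 16)) t
        (λ x≢0 → read-rep ρ 17 h r₂₃ (inj₂ (refl , λ x≡0 → x≢0 (trans loaded x≡0))) (runs (readPre ⨟ ins (24 ≔ʳ 17)) t tt))
        (λ x≡0 → read-rep ρ 16 h r₂₃ (inj₁ (refl , trans (sym loaded) x≡0)) (runs (readPre ⨟ ins (24 ≔ʳ 16)) t tt))
      where
      loaded : reg (exec readPre t) 23 ≡ x
      loaded = trans (val (runs readPre t tt) 23) r₂₃

    consume-rep : ∀ ρ {σ e x t t′} c y → Read ρ σ e x t → let g = radix (mode σ) x in
      c ≡ ins (sub 21 2 21) × y ≡ 1 ∸ sg σ ⊎ c ≡ skip × y ≡ sg σ →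
      Run (consumePre ⨟ c ⨟ keyCode) t t′ → Rep ρ (record (coord x (digit e g) σ) { sg = y } , quotient e g) t′
    consume-rep ρ {σ@(ctl _ _ _ m _ _ _ sg)} {e} {x} {t} {t′} c y (read r₂ r₃ r₄ r₁₀ r₁₁ r₁₃ r₁₄ r₁₅ r₁₆ r₁₇ r₁₈ r₁₉ r₂₀ r₂₁ r₂₃ r₂₄) = go
      where
      G D F Z : Expr
      G = var 24 :+ var 2
      D = var 10 :∸ ((var 10 :/ G) :* G)
      -- There are two forms of `copies`: `skip` stores a literal one in register 2, whereas the
      -- sign change leaves the register as a variable.
      Z = (var 2 :∸ var 16) :∸ var 17
      F = (lit 1 :∸ var 16) :∸ var 17
      g : ⟦ G ⟧ᴱ t ≡ radix m x
      g = r₂₄ ⟨+⟩ r₂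
      q : ⟦ var 10 :/ G ⟧ᴱ t ≡ quotient e (radix m x)
      q = r₁₀ ⟨/⟩ g
      δ : ⟦ D ⟧ᴱ t ≡ digit e (radix m x)
      δ = r₁₀ ⟨∸⟩ q ⟨*⟩ g
      Z-eq : ⟦ Z ⟧ᴱ t ≡ copies m
      Z-eq = r₂ ⟨∸⟩ r₁₆ ⟨∸⟩ r₁₇
      F-eq : ⟦ F ⟧ᴱ t ≡ copies m
      F-eq = refl ⟨∸⟩ r₁₆ ⟨∸⟩ r₁₇
      new-key : ∀ X → ⟦ X ⟧ᴱ t ≡ copies m → ⟦ (var 20 :* var 4) :+ (D :+ (X :* var 23)) ⟧ᴱ t ≡ key σ * B + (digit e (radix m x) + copies m * x)
      new-key X X-eq = r₂₀ ⟨*⟩ r₄ ⟨+⟩ (δ ⟨+⟩ X-eq ⟨*⟩ r₂₃)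
      go : c ≡ ins (sub 21 2 21) × y ≡ 1 ∸ sg ⊎ c ≡ skip × y ≡ sg →
        Run (consumePre ⨟ c ⨟ keyCode) t t′ → Rep ρ (record (coord x (digit e (radix m x)) σ) { sg = y } , quotient e (radix m x)) t′
      go (inj₁ (refl , refl)) h =
        rep (trans (val h 2) r₂) (trans (val h 3) r₃) (trans (val h 4) r₄) (evaluate h 10 (var 10 :/ G) refl q) (subst (IsRole ρ) (sym (val h 11)) r₁₁)
          (trans (val h 13) r₁₃) (trans (val h 14) r₁₄) (trans (val h 15) r₁₅) (trans (val h 16) r₁₆) (trans (val h 17) r₁₇) (trans (val h 18) r₁₈) (trans (val h 19) r₁₉)
          (evaluate h 20 ((var 20 :* var 4) :+ (D :+ (Z :* var 23))) refl (new-key Z Z-eq)) (trans (val h 21) (r₂ ⟨∸⟩ r₂₁))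
      go (inj₂ (refl , refl)) h =
        rep (val h 2) (trans (val h 3) r₃) (trans (val h 4) r₄) (evaluate h 10 (var 10 :/ G) refl q) (subst (IsRole ρ) (sym (val h 11)) r₁₁)
          (trans (val h 13) r₁₃) (trans (val h 14) r₁₄) (trans (val h 15) r₁₅) (trans (val h 16) r₁₆) (trans (val h 17) r₁₇) (trans (val h 18) r₁₈) (trans (val h 19) r₁₉)
          (evaluate h 20 ((var 20 :* var 4) :+ (D :+ (F :* var 23))) refl (new-key F F-eq)) (trans (val h 21) r₂₁)

    consume-state : ∀ ρ {σ e x t} → Read ρ σ e x t →
      Rep ρ (walk-coord x (σ , e)) (exec (consumePre ⨟ cond 25 (ins (sub 21 2 21)) skip ⨟ keyCode) t)
    consume-state ρ {σ@(ctl _ _ _ m _ _ _ sg)} {e} {x} {t} h =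
      by-branch-after (λ y → Rep ρ (record (coord x (digit e (radix m x)) σ) { sg = y } , quotient e (radix m x)))
        consumePre 25 (ins (sub 21 2 21)) skip keyCode t flips
        (consume-rep ρ (ins (sub 21 2 21)) (1 ∸ sg) h (inj₁ (refl , refl)) (runs (consumePre ⨟ ins (sub 21 2 21) ⨟ keyCode) t tt))
        (consume-rep ρ skip sg h (inj₂ (refl , refl)) (runs (consumePre ⨟ skip ⨟ keyCode) t tt))
      where
      open Read h
      flips : reg (exec consumePre t) 25 ≡ f₁ m * digit e (radix m x)
      flips = evaluate (runs consumePre t tt) 25 (var 17 :* (var 10 :∸ ((var 10 :/ (var 24 :+ var 2)) :* (var 24 :+ var 2)))) refl
        (r₁₇ ⟨*⟩ (r₁₀ ⟨∸⟩ r₁₀ ⟨/⟩ (r₂₄ ⟨+⟩ r₂) ⟨*⟩ (r₂₄ ⟨+⟩ r₂)))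

    coord-rep : ∀ ρ {p t x} → Rep ρ p t → mem t (reg t 12) ≡ x → Rep ρ (walk-coord x p) (exec coordCode t)
    coord-rep ρ {p} {t} {x} h r₂₃ = in-sequence (Rep ρ (walk-coord x p)) readCode _ t (consume-state ρ (read-state ρ h r₂₃))

-- One round of the main loop: walking along a vector and tallying

module MainCode where

  import Data.Integer.Properties as ℤ
  open Prelude
  open Machine
  open Sums using (digit)
  open Decomposition
  open Parameters
  open Counting
  open WalkCode

  storeless : Code → Bool
  storeless (ins (store _ _))  = false
  storeless (ins _)            = true
  storeless (c ⨟ c′)           = storeless c ∧ storeless c′
  storeless (cond _ c c′)      = storeless c ∧ storeless c′
  storeless (loop _ c)         = storeless c

  opaque
    unfolding exec

    unstored : ∀ c t → T (storeless c) → mem (exec c t) ≡ mem t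
    unstored (ins (_ ≔ _))      t _ = refl
    unstored (ins (_ ≔ʳ _))     t _ = refl
    unstored (ins (add _ _ _))  t _ = refl
    unstored (ins (sub _ _ _))  t _ = refl
    unstored (ins (mul _ _ _))  t _ = refl
    unstored (ins (div _ _ _))  t _ = refl
    unstored (ins (load _ _))   t _ = refl
    unstored (c ⨟ c′) t p with p₁ , p₂ ← ∧-split {storeless c} p =
      trans (unstored c′ (exec c t) p₂) (unstored c t p₁)
    unstored (cond r c c′) t p with p₁ , p₂ ← ∧-split {storeless c} p =
      branch-elim (λ t′ → mem t′ ≡ mem t) (reg t r) (λ _ → unstored c t p₁) (λ _ → unstored c′ t p₂)
    unstored (loop r c) t p = iter-preserves mem (λ t → unstored c t p) (reg t r) t

  clear : ℕ → Code
  clear zero     = skip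
  clear (suc n)  = ins ((10 + n) ≔ 0) ⨟ clear n

  opaque
    unfolding exec

    cleared : ∀ n t r → r < n → reg (exec (clear n) t) (10 + r) ≡ 0
    cleared (suc n) t r r< with r ≟ n
    ... | yes refl = trans (above n (effect ((10 + n) ≔ 0) t) n ≤-refl) (put-same (reg t) (10 + n) 0)
      where
      above : ∀ n t r → n ≤ r → reg (exec (clear n) t) (10 + r) ≡ reg t (10 + r)
      above zero t r _ = refl
      above (suc n) t r n< = trans (above n _ r (<⇒≤ n<)) (put-other (reg t) (10 + n) 0 (10 + r) (distinct n r n<))
        where
        distinct : ∀ n r → n < r → T (not (n ≡ᵇ r))
        distinct zero (suc r) _ = tt
        distinct (suc n) (suc r) n< = distinct n r (≤-pred n<)
    ... | no r≢n = cleared n _ r (≤∧≢⇒< (≤-pred r<) r≢n)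

    store-last : ∀ p q a b t → let u = exec (p ⨟ q) t; v = exec (p ⨟ q ⨟ ins (store a b)) t in
                 (∀ r → reg v r ≡ reg u r) × mem v ≡ mem u [ reg u a ↦ reg u b ]
    store-last p q a b t = (λ _ → refl) , refl

  -- The main counter minus one is j * M + e, where the rows j from n on are the right vectors. As
  -- the counter falls, the whole table is filled before the first left vector reads it. The
  -- truncated difference of n and j is nonzero for left rows only, and j * d is the address of row
  -- j on either side.
  preCode tallyPre actPre actCode tallyCode mainCode : Code
  preCode =
    ins (sub 10 7 2) ⨟ ins (div 11 10 5) ⨟ ins (mul 12 11 5) ⨟ ins (sub 10 10 12) ⨟
    ins (mul 12 11 1) ⨟ ins (sub 11 0 11) ⨟ ins (22 ≔ʳ 1)
  tallyPre = ins (add 19 19 18) ⨟ ins (add 19 19 10)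
  actPre = ins (add 20 20 6) ⨟ ins (load 23 20)
  actCode =
    actPre ⨟ cond 11 (cond 21 (ins (add 9 9 23)) (ins (add 8 8 23))) (ins (add 23 23 2) ⨟ ins (store 20 23))
  tallyCode = tallyPre ⨟ cond 19 skip actCode
  mainCode = preCode ⨟ loop 22 walkCode ⨟ tallyCode ⨟ clear 22

  Stored : ∀ {d} → (ℕ → ℕ) → ℕ → Vec (Fin 2) d → Set
  Stored M a []        = ⊤
  Stored M a (x ∷ xs)  = M a ≡ toℕ x × Stored M (suc a) xs

  -- Registers hold natural numbers, so positive and negative contributions are collected apart.
  net : State → ℤ
  net t = + reg t 8 -ᶻ + reg t 9

  -- The first three fields serve correctness; the last two bound the growth per round and serve the
  -- running time.
  record Tallied (ρ : Role) (p : Ctl × ℕ) (base : ℕ) (t t′ : State) : Set where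
    constructor tallied
    field
      net-gain   : net t′ ≡ net t +ᶻ pick ρ (gain (λ κ → + mem t (κ + base)) p) 0ℤ
      table-hit  : ∀ κ → + mem t′ (κ + base) ≡ + mem t (κ + base) +ᶻ pick ρ 0ℤ (hit κ p)
      below      : ∀ a → a < base → mem t′ a ≡ mem t a
      mem-grows  : ∀ a → mem t′ a ≤ suc (mem t a)
      gains-grow : ∀ b → (∀ a → mem t a ≤ b) → reg t′ 8 ≤ reg t 8 + b × reg t′ 9 ≤ reg t 9 + b

  ≡ᵇ-+ʳ : ∀ m n b → (m + b ≡ᵇ n + b) ≡ (m ≡ᵇ n)
  ≡ᵇ-+ʳ m n zero rewrite +-identityʳ m | +-identityʳ n = refl
  ≡ᵇ-+ʳ m n (suc b) rewrite +-suc m b | +-suc n b = ≡ᵇ-+ʳ m n b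

  +-gain : ∀ a b m → + (a + m) -ᶻ + b ≡ (+ a -ᶻ + b) +ᶻ 1ℤ *ᶻ + m
  +-gain a b m = trans (cong (_-ᶻ + b) (ℤ.pos-+ a m)) (e (+ a) (+ b) (+ m))
    where
    e : ∀ a b m → (a +ᶻ m) -ᶻ b ≡ (a -ᶻ b) +ᶻ 1ℤ *ᶻ m
    e = solve-∀ᶻ

  +-loss : ∀ a b m → + a -ᶻ + (b + m) ≡ (+ a -ᶻ + b) +ᶻ -1ℤ *ᶻ + m
  +-loss a b m = trans (cong (+ a -ᶻ_) (ℤ.pos-+ b m)) (e (+ a) (+ b) (+ m))
    where
    e : ∀ a b m → a -ᶻ (b +ᶻ m) ≡ (a -ᶻ b) +ᶻ -1ℤ *ᶻ m
    e = solve-∀ᶻ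

  module _ {p : Ctl × ℕ} {base : ℕ} {t t′ : State} where

    private
      σ = proj₁ p
      T₀ : ℕ → ℤ
      T₀ κ = + mem t (κ + base)

    gain-undone : ∀ {u} → undone p ≡ u → gain T₀ p ≡ branch u 0ℤ (sign (sg σ) *ᶻ T₀ (key σ))
    gain-undone eq = cong (λ u → branch u 0ℤ (sign (sg σ) *ᶻ T₀ (key σ))) eq

    hit-undone : ∀ {u} κ → undone p ≡ u → hit κ p ≡ branch u 0ℤ (indicator (key σ ≡ᵇ κ))
    hit-undone κ eq = cong (λ u → branch u 0ℤ (indicator (key σ ≡ᵇ κ))) eq

    same-net : reg t′ 8 ≡ reg t 8 → reg t′ 9 ≡ reg t 9 → net t′ ≡ net t +ᶻ 0ℤ
    same-net r₈ r₉ = trans (cong₂ (λ a b → + a -ᶻ + b) r₈ r₉) (sym (ℤ.+-identityʳ (net t)))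

    same-table : mem t′ ≡ mem t → ∀ κ → + mem t′ (κ + base) ≡ T₀ κ +ᶻ 0ℤ
    same-table eq κ = trans (cong (λ M → + M (κ + base)) eq) (sym (ℤ.+-identityʳ (T₀ κ)))

    grows-same : ∀ {x y} b → x ≡ y → x ≤ y + b
    grows-same b refl = m≤m+n _ b

    tallied-none : ∀ ρ u → undone p ≡ suc u → mem t′ ≡ mem t → reg t′ 8 ≡ reg t 8 → reg t′ 9 ≡ reg t 9 → Tallied ρ p base t t′
    tallied-none ρ u eq m≡ r₈ r₉ = tallied
      (trans (same-net r₈ r₉) (cong (net t +ᶻ_) (sym (proj₁ (idle ρ)))))
      (λ κ → trans (same-table m≡ κ) (cong (T₀ κ +ᶻ_) (sym (proj₂ (idle ρ) κ))))
      (λ a _ → cong (λ M → M a) m≡) (λ a → ≤-trans (≤-reflexive (cong (λ M → M a) m≡)) (n≤1+n _))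
      (λ b _ → grows-same b r₈ , grows-same b r₉)
      where
      idle : ∀ ρ → pick ρ (gain T₀ p) 0ℤ ≡ 0ℤ × (∀ κ → pick ρ 0ℤ (hit κ p) ≡ 0ℤ)
      idle left   = gain-undone eq , λ _ → refl
      idle right  = refl , λ κ → hit-undone κ eq

    tallied-left : undone p ≡ 0 → mem t′ ≡ mem t →
      (sg σ ≢ 0 × reg t′ 8 ≡ reg t 8 × reg t′ 9 ≡ reg t 9 + mem t (key σ + base)) ⊎
      (sg σ ≡ 0 × reg t′ 8 ≡ reg t 8 + mem t (key σ + base) × reg t′ 9 ≡ reg t 9) → Tallied left p base t t′
    tallied-left eq m≡ gains = tallied
      (trans (net-change gains) (cong (net t +ᶻ_) (sym (gain-undone eq))))
      (same-table m≡) (λ a _ → cong (λ M → M a) m≡) (λ a → ≤-trans (≤-reflexive (cong (λ M → M a) m≡)) (n≤1+n _))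
      (λ b le → grow b le gains)
      where
      negative : ∀ x → x ≢ 0 → -1ℤ ≡ sign x
      negative zero    x≢0 = contradiction refl x≢0
      negative (suc x) _   = refl
      net-change : _ → net t′ ≡ net t +ᶻ sign (sg σ) *ᶻ T₀ (key σ)
      net-change (inj₁ (s , r₈ , r₉)) = trans (cong₂ (λ a b → + a -ᶻ + b) r₈ r₉)
        (trans (+-loss (reg t 8) (reg t 9) _) (cong (λ z → net t +ᶻ z *ᶻ T₀ (key σ)) (negative (sg σ) s)))
      net-change (inj₂ (s , r₈ , r₉)) = trans (cong₂ (λ a b → + a -ᶻ + b) r₈ r₉)
        (trans (+-gain (reg t 8) (reg t 9) _) (cong (λ z → net t +ᶻ sign z *ᶻ T₀ (key σ)) (sym s)))
      grow : ∀ b → (∀ a → mem t a ≤ b) → _ → reg t′ 8 ≤ reg t 8 + b × reg t′ 9 ≤ reg t 9 + b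
      grow b le (inj₁ (_ , r₈ , r₉)) = grows-same b r₈ , ≤-trans (≤-reflexive r₉) (+-monoʳ-≤ (reg t 9) (le _))
      grow b le (inj₂ (_ , r₈ , r₉)) = ≤-trans (≤-reflexive r₈) (+-monoʳ-≤ (reg t 8) (le _)) , grows-same b r₉

    tallied-right : undone p ≡ 0 → mem t′ ≡ mem t [ key σ + base ↦ mem t (key σ + base) + 1 ] →
                    reg t′ 8 ≡ reg t 8 → reg t′ 9 ≡ reg t 9 → Tallied right p base t t′
    tallied-right eq m≡ r₈ r₉ = tallied (same-net r₈ r₉)
      (λ κ → trans (table κ) (cong (T₀ κ +ᶻ_) (sym (hit-undone κ eq))))
      (λ a a< → elsewhere (≢⇒≡ᵇ-false λ eq → <⇒≢ (<-≤-trans a< (m≤n+m base (key σ))) (sym eq)))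
      grows (λ b _ → grows-same b r₈ , grows-same b r₉)
      where
      A = key σ + base
      here : mem t′ A ≡ mem t A + 1
      here = trans (cong (λ M → M A) m≡) (put-same (mem t) A (mem t A + 1))
      elsewhere : ∀ {a} → (A ≡ᵇ a) ≡ false → mem t′ a ≡ mem t a
      elsewhere {a} ne = trans (cong (λ M → M a) m≡) (cong (λ b → if b then mem t A + 1 else mem t a) ne)
      table : ∀ κ → + mem t′ (κ + base) ≡ T₀ κ +ᶻ indicator (key σ ≡ᵇ κ)
      table κ with key σ ≡ᵇ κ in eq
      ... | true rewrite sym (≡ᵇ⇒≡ (key σ) κ (subst T (sym eq) tt)) = trans (cong +_ here) (ℤ.pos-+ (mem t A) 1)
      ... | false = trans (cong +_ (elsewhere (trans (≡ᵇ-+ʳ (key σ) κ base) eq))) (sym (ℤ.+-identityʳ (T₀ κ)))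
      grows : ∀ a → mem t′ a ≤ suc (mem t a)
      grows a with A ≟ a
      ... | yes refl = ≤-reflexive (trans here (+-comm (mem t A) 1))
      ... | no neq = ≤-trans (≤-reflexive (elsewhere (≢⇒≡ᵇ-false neq))) (n≤1+n _)

  module Main (s-1 : ℕ) where
    open Walk s-1
    open Refine s-1
    open Rep

    opened : ∀ ρ {σ e t} → Rep ρ (σ , e) t → Rep ρ (open-block ρ σ e) (exec (cond 13 skip blockCode) t)
    opened ρ {σ} {e} {t} h =
      by-branch-last (Rep ρ) 13 skip blockCode t (r₁₃ h) (skipped h (runs skip t tt)) (block-rep ρ h)
      where
      skipped : ∀ {p t t′} → Rep ρ p t → Run skip t t′ → Rep ρ p t′
      skipped (rep r₂ r₃ r₄ r₁₀ r₁₁ r₁₃ r₁₄ r₁₅ r₁₆ r₁₇ r₁₈ r₁₉ r₂₀ r₂₁) h =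
        rep (val h 2) (trans (val h 3) r₃) (trans (val h 4) r₄) (trans (val h 10) r₁₀) (subst (IsRole ρ) (sym (val h 11)) r₁₁)
          (trans (val h 13) r₁₃) (trans (val h 14) r₁₄) (trans (val h 15) r₁₅) (trans (val h 16) r₁₆) (trans (val h 17) r₁₇)
          (trans (val h 18) r₁₈) (trans (val h 19) r₁₉) (trans (val h 20) r₂₀) (trans (val h 21) r₂₁)

    next-address : ∀ t → reg t 2 ≡ 1 → reg (exec coordCode t) 12 ≡ suc (reg t 12)
    next-address t r₂ =
      in-sequence (λ u → reg u 12 ≡ suc (reg t 12)) readCode (consumePre ⨟ cond 25 (ins (sub 21 2 21)) skip ⨟ keyCode) t
        (trans (unwritten (consumePre ⨟ cond 25 (ins (sub 21 2 21)) skip ⨟ keyCode) (exec readCode t) 12 tt)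
          (by-zero-after (λ u → reg u 12 ≡ suc (reg t 12)) readPre 23 (ins (24 ≔ʳ 17)) (ins (24 ≔ʳ 16)) t
            (λ _ → trans (val (runs (readPre ⨟ ins (24 ≔ʳ 17)) t tt) 12) next)
            (λ _ → trans (val (runs (readPre ⨟ ins (24 ≔ʳ 16)) t tt) 12) next)))
      where
      next : reg t 12 + reg t 2 ≡ suc (reg t 12)
      next = trans (cong (λ z → reg t 12 + z) r₂) (+-comm (reg t 12) 1)

    count-down : Code
    count-down = ins (2 ≔ 1) ⨟ ins (sub 22 22 2)

    counted : ∀ ρ {p t t′} → Rep ρ p t → Run count-down t t′ → Rep ρ p t′
    counted ρ (rep r₂ r₃ r₄ r₁₀ r₁₁ r₁₃ r₁₄ r₁₅ r₁₆ r₁₇ r₁₈ r₁₉ r₂₀ r₂₁) h =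
      rep (val h 2) (trans (val h 3) r₃) (trans (val h 4) r₄) (trans (val h 10) r₁₀) (subst (IsRole ρ) (sym (val h 11)) r₁₁)
        (trans (val h 13) r₁₃) (trans (val h 14) r₁₄) (trans (val h 15) r₁₅) (trans (val h 16) r₁₆) (trans (val h 17) r₁₇)
        (trans (val h 18) r₁₈) (trans (val h 19) r₁₉) (trans (val h 20) r₂₀) (trans (val h 21) r₂₁)

    walk-rep : ∀ ρ {d} (xs : Vec (Fin 2) d) p t → Rep ρ p t → Stored (mem t) (reg t 12) xs →
               Rep ρ (walk ρ xs p) (iter d (exec (round 22 walkCode)) t)
    walk-rep ρ [] p t h _ = h
    walk-rep ρ (x ∷ xs) p@(σ , e) t h (r₂₃ , rest) =
      walk-rep ρ xs (walk-coord (toℕ x) (open-block ρ σ e)) (exec (round 22 walkCode) t) after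
        (subst₂ (λ M a → Stored M a xs) (sym (unstored (round 22 walkCode) t tt)) (sym moved) rest)
      where
      u v : State
      u = exec (cond 13 skip blockCode) t
      v = exec walkCode t
      h′ : Rep ρ (open-block ρ σ e) u
      h′ = opened ρ h
      same : reg u 12 ≡ reg t 12
      same = unwritten (cond 13 skip blockCode) t 12 tt
      after : Rep ρ (walk-coord (toℕ x) (open-block ρ σ e)) (exec (round 22 walkCode) t)
      after = in-sequence (Rep ρ (walk-coord (toℕ x) (open-block ρ σ e))) walkCode count-down t
        (counted ρ (in-sequence (Rep ρ (walk-coord (toℕ x) (open-block ρ σ e))) (cond 13 skip blockCode) coordCode t
            (coord-rep ρ h′ (trans (cong₂ (λ M a → M a) (unstored (cond 13 skip blockCode) t tt) same) r₂₃)))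
          (runs count-down v tt))
      moved : reg (exec (round 22 walkCode) t) 12 ≡ suc (reg t 12)
      moved = in-sequence (λ y → reg y 12 ≡ suc (reg t 12)) walkCode count-down t
        (trans (val (runs count-down v tt) 12)
          (in-sequence (λ y → reg y 12 ≡ suc (reg t 12)) (cond 13 skip blockCode) coordCode t
            (trans (next-address u (r₂ h′)) (cong suc same))))

    tally : ∀ ρ {p t base} → Rep ρ p t → reg t 6 ≡ base → Tallied ρ p base t (exec tallyCode t)
    tally ρ {p@(σ , e)} {t} {base} h r₆ = by-zero-after (Tallied ρ p base t) tallyPre 19 skip actCode t
      (λ ne → idle (undone p) refl (λ z → ne (trans done z)))
      (λ z → in-sequence (Tallied ρ p base t) tallyPre actCode t
        (by-role (Tallied ρ p base t) ρ actPre (cond 21 (ins (add 9 9 23)) (ins (add 8 8 23))) (ins (add 23 23 2) ⨟ ins (store 20 23)) u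
          (subst (IsRole ρ) (sym (trans (unwritten actPre u 11 tt) (val run₁ 11))) (r₁₁ h))
          (act ρ (trans (sym done) z))))
      where
      u : State
      u = exec tallyPre t
      run₁ : Run tallyPre t u
      run₁ = runs tallyPre t tt
      mem₁ : mem u ≡ mem t
      mem₁ = unstored tallyPre t tt
      done : reg u 19 ≡ undone p
      done = trans (val run₁ 19) (r₁₉ h ⟨+⟩ r₁₈ h ⟨+⟩ r₁₀ h)
      address : reg u 20 + reg u 6 ≡ key σ + base
      address = trans (val run₁ 20) (r₂₀ h) ⟨+⟩ trans (val run₁ 6) r₆
      cell₁ : mem u (reg u 20 + reg u 6) ≡ mem t (key σ + base)
      cell₁ = cong₂ (λ M a → M a) mem₁ address
      idle : ∀ v → undone p ≡ v → undone p ≢ 0 → Tallied ρ p base t (exec (tallyPre ⨟ skip) t)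
      idle zero    eq ne = contradiction eq ne
      idle (suc v) eq _  = tallied-none ρ v eq (unstored (tallyPre ⨟ skip) t tt)
        (unwritten (tallyPre ⨟ skip) t 8 tt) (unwritten (tallyPre ⨟ skip) t 9 tt)
      act : ∀ ρ → undone p ≡ 0 → Tallied ρ p base t
        (exec (actPre ⨟ pick ρ (cond 21 (ins (add 9 9 23)) (ins (add 8 8 23))) (ins (add 23 23 2) ⨟ ins (store 20 23))) u)
      act left eq = by-zero-after (Tallied left p base t) actPre 21 (ins (add 9 9 23)) (ins (add 8 8 23)) u
        (λ ne → tallied-left eq (trans (unstored (actPre ⨟ ins (add 9 9 23)) u tt) mem₁)
          (inj₁ ((λ z → ne (trans flag z)) ,
                 trans (unwritten (actPre ⨟ ins (add 9 9 23)) u 8 tt) (val run₁ 8) ,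
                 trans (val (runs (actPre ⨟ ins (add 9 9 23)) u tt) 9) (val run₁ 9 ⟨+⟩ cell₁))))
        (λ z → tallied-left eq (trans (unstored (actPre ⨟ ins (add 8 8 23)) u tt) mem₁)
          (inj₂ (trans (sym flag) z ,
                 trans (val (runs (actPre ⨟ ins (add 8 8 23)) u tt) 8) (val run₁ 8 ⟨+⟩ cell₁) ,
                 trans (unwritten (actPre ⨟ ins (add 8 8 23)) u 9 tt) (val run₁ 9))))
        where
        flag : reg (exec actPre u) 21 ≡ sg σ
        flag = trans (unwritten actPre u 21 tt) (trans (val run₁ 21) (r₂₁ h))
      act right eq = tallied-right eq
        (trans (proj₂ last) (trans (cong₂ (λ M a → M [ a ↦ reg v 23 ]) (trans (unstored (actPre ⨟ ins (add 23 23 2)) u tt) mem₁) (trans (val run₂ 20) address))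
          (cong (λ x → mem t [ key σ + base ↦ x ]) (trans (val run₂ 23) (cell₁ ⟨+⟩ trans (val run₁ 2) (r₂ h))))))
        (trans (proj₁ last 8) (trans (val run₂ 8) (val run₁ 8)))
        (trans (proj₁ last 9) (trans (val run₂ 9) (val run₁ 9)))
        where
        v : State
        v = exec (actPre ⨟ ins (add 23 23 2)) u
        run₂ : Run (actPre ⨟ ins (add 23 23 2)) u v
        run₂ = runs (actPre ⨟ ins (add 23 23 2)) u tt
        last = store-last actPre (ins (add 23 23 2)) 20 23 u

-- Invariants of the main loop and its two phases

module MainLoop where

  import Data.Integer.Properties as ℤ
  import Data.List.Base as List
  import Data.List.Properties as List
  import Data.Vec.Base as Vec
  open Prelude
  open Machine
  open Sums
  open Decomposition
  open Parameters
  open Counting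
  open WalkCode
  open MainCode

  opaque
    unfolding exec

    loop-iterates : ∀ r c t → exec (loop r c) t ≡ iter (reg t r) (exec (round r c)) t
    loop-iterates r c t = refl

  tallied-transport : ∀ {ρ p base t t′ u u′} → mem u ≡ mem t → reg u 8 ≡ reg t 8 → reg u 9 ≡ reg t 9 →
    mem u′ ≡ mem t′ → reg u′ 8 ≡ reg t′ 8 → reg u′ 9 ≡ reg t′ 9 → Tallied ρ p base u u′ → Tallied ρ p base t t′
  tallied-transport {ρ} {p} {base} {state R M} {state R′ M′} {state Q .M} {state Q′ .M′} refl e₈ e₉ refl e₈′ e₉′ (tallied ng th bl mg gg) =
    tallied (trans (sym (cong₂ (λ a b → + a -ᶻ + b) e₈′ e₉′)) (trans ng (cong (λ z → z +ᶻ pick ρ (gain (λ κ → + M (κ + base)) p) 0ℤ) (cong₂ (λ a b → + a -ᶻ + b) e₈ e₉))))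
      th bl mg (λ b le → subst₂ (λ x y → x ≤ y + b) e₈′ e₈ (proj₁ (gg b le)) , subst₂ (λ x y → x ≤ y + b) e₉′ e₉ (proj₂ (gg b le)))

  Idle : State → Set
  Idle t = ∀ r → reg t (10 + r) ≡ 0

  record Fixed (n d : ℕ) (t : State) : Set where
    constructor fixed
    field
      r₀ : reg t 0 ≡ n
      r₁ : reg t 1 ≡ d
      r₂ : reg t 2 ≡ 1
      r₃ : reg t 3 ≡ suc (quotient d K)
      r₄ : reg t 4 ≡ base d
      r₅ : reg t 5 ≡ choices d
      r₆ : reg t 6 ≡ n * d + n * d

  tick : Code
  tick = ins (2 ≔ 1) ⨟ ins (sub 7 7 2)

  flat : ∀ {n d} → Vec (Vec (Fin 2) d) n → List ℕ
  flat w = Vec.toList (Vec.map toℕ (Vec.concat w))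

  flat-∷ : ∀ {n d} (x : Vec (Fin 2) d) (w : Vec (Vec (Fin 2) d) n) → flat (x ∷ w) ≡ Vec.toList (Vec.map toℕ x) List.++ flat w
  flat-∷ x w = go x
    where
    go : ∀ {d} (x : Vec (Fin 2) d) → Vec.toList (Vec.map toℕ (x Vec.++ Vec.concat w)) ≡ Vec.toList (Vec.map toℕ x) List.++ flat w
    go []      = refl
    go (a ∷ x) = cong (toℕ a ∷_) (go x)

  length-bits : ∀ {d} (x : Vec (Fin 2) d) → List.length (Vec.toList (Vec.map toℕ x)) ≡ d
  length-bits []      = refl
  length-bits (a ∷ x) = cong suc (length-bits x)

  length-flat : ∀ {n d} (w : Vec (Vec (Fin 2) d) n) → List.length (flat w) ≡ n * d
  length-flat w = length-bits (Vec.concat w)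

  nth-++ʳ : ∀ xs {ys} a → nth (xs List.++ ys) (List.length xs + a) ≡ nth ys a
  nth-++ʳ []       a = refl
  nth-++ʳ (x ∷ xs) a = nth-++ʳ xs a

  nth-beyond : ∀ xs a → nth xs (List.length xs + a) ≡ 0
  nth-beyond []       a = refl
  nth-beyond (x ∷ xs) a = nth-beyond xs a

  stored-shift : ∀ {d M M′} k a (x : Vec (Fin 2) d) → (∀ b → M′ (k + b) ≡ M b) → Stored M a x → Stored M′ (k + a) x
  stored-shift k a [] h _ = tt
  stored-shift {M = M} {M′} k a (x ∷ xs) h (p , q) =
    trans (h a) p , subst (λ b → Stored M′ b xs) (+-suc k a) (stored-shift k (suc a) xs h q)

  stored-cong : ∀ {d M M′} a (x : Vec (Fin 2) d) {top} → a + d ≤ top → (∀ b → b < top → M′ b ≡ M b) → Stored M a x → Stored M′ a x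
  stored-cong a [] le h _ = tt
  stored-cong {suc d} a (x ∷ xs) le h (p , q) =
    trans (h a (≤-trans (s≤s (m≤m+n a d)) le′)) p , stored-cong (suc a) xs le′ h q
    where le′ = ≤-trans (≤-reflexive (sym (+-suc a d))) le

  stored-prefix : ∀ {d} (x : Vec (Fin 2) d) ys → Stored (nth (Vec.toList (Vec.map toℕ x) List.++ ys)) 0 x
  stored-prefix [] ys = tt
  stored-prefix (a ∷ x) ys = refl , stored-shift 1 0 x (λ _ → refl) (stored-prefix x ys)

  stored-row : ∀ {n d} (w : Vec (Vec (Fin 2) d) n) ys j → j < n → Stored (nth (flat w List.++ ys)) (j * d) (row w j)
  stored-row {d = d} (x ∷ w) ys j j< = subst (λ l → Stored (nth l) (j * d) (row (x ∷ w) j))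
    (trans (sym (List.++-assoc (Vec.toList (Vec.map toℕ x)) (flat w) ys)) (cong (List._++ ys) (sym (flat-∷ x w)))) (go j j<)
    where
    go : ∀ j → j < suc _ → Stored (nth (Vec.toList (Vec.map toℕ x) List.++ (flat w List.++ ys))) (j * d) (row (x ∷ w) j)
    go zero    _         = stored-prefix x (flat w List.++ ys)
    go (suc j) (s≤s j<) = stored-shift d (j * d) (row w j)
      (λ b → trans (cong (λ k → nth (Vec.toList (Vec.map toℕ x) List.++ (flat w List.++ ys)) (k + b)) (sym (length-bits x)))
               (nth-++ʳ (Vec.toList (Vec.map toℕ x)) b))
      (stored-row w ys j j<)

  module Loop (n d : ℕ) where
    open Walk (quotient d K)
    open Refine (quotient d K)
    open Main (quotient d K)
    open Count d

    table : ℕ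
    table = n * d + n * d

    body : State → State
    body = exec (round 7 mainCode)

    record Inv (M₀ : ℕ → ℕ) (c : ℕ) (t : State) : Set where
      constructor inv
      field
        constants  : Fixed n d t
        idle       : Idle t
        counter    : reg t 7 ≡ c
        input-kept : ∀ a → a < table → mem t a ≡ M₀ a

    prepared : ∀ ρ {m t u} → Fixed n d t → Idle t → reg t 7 ≡ suc m → IsRole ρ (n ∸ quotient m M) → Run preCode t u →
               Rep ρ (initially , digit m M) u × reg u 12 ≡ quotient m M * d × reg u 22 ≡ d
    prepared ρ {m} {t} {u} (fixed r₀ r₁ r₂ r₃ r₄ r₅ r₆) id r₇ role h =
      rep (trans (val h 2) r₂) (trans (val h 3) r₃) (trans (val h 4) r₄)
        (evaluate h 10 (X :∸ ((X :/ var 5) :* var 5)) refl (x ⟨∸⟩ q ⟨*⟩ r₅))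
        (subst (IsRole ρ) (sym (evaluate h 11 (var 0 :∸ (X :/ var 5)) refl (r₀ ⟨∸⟩ q))) role)
        (trans (val h 13) (id 3)) (trans (val h 14) (id 4)) (trans (val h 15) (id 5)) (trans (val h 16) (id 6)) (trans (val h 17) (id 7))
        (trans (val h 18) (id 8)) (trans (val h 19) (id 9)) (trans (val h 20) (id 10)) (trans (val h 21) (id 11)) ,
      evaluate h 12 ((X :/ var 5) :* var 1) refl (q ⟨*⟩ r₁) ,
      trans (val h 22) r₁
      where
      X : Expr
      X = var 7 :∸ var 2
      x : reg t 7 ∸ reg t 2 ≡ m
      x = r₇ ⟨∸⟩ r₂
      q : quotient (reg t 7 ∸ reg t 2) (reg t 5) ≡ quotient m M
      q = x ⟨/⟩ r₅

    main-step : ∀ ρ (x : Vec (Fin 2) d) {M₀ m t} → Inv M₀ (suc m) t → IsRole ρ (n ∸ quotient m M) →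
                Stored (mem t) (quotient m M * d) x →
                Tallied ρ (leaf ρ x (digit m M)) table t (body t) × Inv M₀ m (body t)
    main-step ρ x {M₀} {m} {t} (inv fx@(fixed r₀ r₁ r₂ r₃ r₄ r₅ r₆) id r₇ kept) role stored =
      tallied-body ,
      inv (fixed (same 0 tt r₀) (same 1 tt r₁)
            (in-sequence (λ y → reg y 2 ≡ 1) mainCode tick t (val run₄ 2))
            (same 3 tt r₃) (same 4 tt r₄) (same 5 tt r₅) (same 6 tt r₆))
        idle
        (trans (countdown 7 mainCode t tt tt) (cong (_∸ 1) r₇))
        (λ a a< → trans (Tallied.below tallied-body a a<) (kept a a<))
      where
      p = leaf ρ x (digit m M)
      u₀ u₁ u₂ u₃ : State
      u₀ = exec preCode t
      u₁ = exec (loop 22 walkCode) u₀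
      u₂ = exec tallyCode u₁
      u₃ = exec (clear 22) u₂
      ready : Rep ρ (initially , digit m M) u₀ × reg u₀ 12 ≡ quotient m M * d × reg u₀ 22 ≡ d
      ready = prepared ρ fx id r₇ role (runs preCode t tt)
      mem₀ : mem u₀ ≡ mem t
      mem₀ = unstored preCode t tt
      mem₁ : mem u₁ ≡ mem t
      mem₁ = trans (unstored (loop 22 walkCode) u₀ tt) mem₀
      walked : Rep ρ p u₁
      walked = subst (Rep ρ p) (sym (trans (loop-iterates 22 walkCode u₀) (cong (λ k → iter k (exec (round 22 walkCode)) u₀) (proj₂ (proj₂ ready)))))
        (walk-rep ρ x (initially , digit m M) u₀ (proj₁ ready)
          (subst₂ (λ M a → Stored M a x) (sym mem₀) (sym (proj₁ (proj₂ ready))) stored))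
      before : ∀ r → T (not (writes (preCode ⨟ loop 22 walkCode) r)) → reg u₁ r ≡ reg t r
      before r w with w₁ , w₂ ← ∨-false {writes preCode r} w =
        trans (unwritten (loop 22 walkCode) u₀ r w₂) (unwritten preCode t r w₁)
      run₄ : Run tick (exec mainCode t) (exec tick (exec mainCode t))
      run₄ = runs tick (exec mainCode t) tt
      unfold : ∀ (Q : State → Set) → Q (exec tick u₃) → Q (body t)
      unfold Q q = in-sequence Q mainCode tick t
        (in-sequence (λ u → Q (exec tick u)) preCode (loop 22 walkCode ⨟ tallyCode ⨟ clear 22) t
          (in-sequence (λ u → Q (exec tick u)) (loop 22 walkCode) (tallyCode ⨟ clear 22) u₀
            (in-sequence (λ u → Q (exec tick u)) tallyCode (clear 22) u₁ q)))
      tallied-body : Tallied ρ p table t (body t)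
      tallied-body = unfold (Tallied ρ p table t)
        (tallied-transport mem₁ (before 8 tt) (before 9 tt)
          (sym (trans (unstored tick u₃ tt) (unstored (clear 22) u₂ tt)))
          (sym (trans (unwritten tick u₃ 8 tt) (unwritten (clear 22) u₂ 8 tt)))
          (sym (trans (unwritten tick u₃ 9 tt) (unwritten (clear 22) u₂ 9 tt)))
          (tally ρ walked (trans (before 6 tt) r₆)))
      same : ∀ r {v} → T (not (writes (round 7 mainCode) r)) → reg t r ≡ v → reg (body t) r ≡ v
      same r w eq = trans (unwritten (round 7 mainCode) t r w) eq
      idle : Idle (body t)
      idle r with r <? 22
      ... | yes r< = unfold (λ u → reg u (10 + r) ≡ 0) (trans (unwritten tick u₃ (10 + r) tt) (cleared 22 u₂ r r<))
      -- Registers from 32 on are never written. Spelling the number as 10 + (22 + _) lets `writes`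
      -- evaluate to false.
      ... | no r≥ = subst (λ r → reg (body t) (10 + r) ≡ 0) (m+[n∸m]≡n (≮⇒≥ r≥))
        (trans (unwritten (round 7 mainCode) t (10 + (22 + (r ∸ 22))) tt)
          (trans (cong (λ r → reg t (10 + r)) (m+[n∸m]≡n (≮⇒≥ r≥))) (id r)))

    module _ (u v : Vec (Vec (Fin 2) d) n) where

      M₀ : ℕ → ℕ
      M₀ = mem (input u v)

      stored-left : ∀ j → j < n → Stored M₀ (j * d) (row u j)
      stored-left j j< = stored-row u (flat v) j j<

      stored-right : ∀ j → j < n → Stored M₀ ((n + j) * d) (row v j)
      stored-right j j< = subst (λ a → Stored M₀ a (row v j)) (sym (*-distribʳ-+ d n j))
        (stored-shift (n * d) (j * d) (row v j)
          (λ b → trans (cong (λ k → nth (flat u List.++ flat v) (k + b)) (sym (length-flat u))) (nth-++ʳ (flat u) b))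
          (subst (λ l → Stored (nth l) (j * d) (row v j)) (List.++-identityʳ (flat v)) (stored-row v [] j j<)))

      empty-table : ∀ κ → M₀ (κ + table) ≡ 0
      empty-table κ = trans (cong (nth (flat u List.++ flat v)) (trans (+-comm κ table) (cong (_+ κ) (sym all)))) (nth-beyond (flat u List.++ flat v) κ)
        where
        all : List.length (flat u List.++ flat v) ≡ table
        all = trans (List.length-++ (flat u)) (cong₂ _+_ (length-flat u) (length-flat v))

      stored-kept : ∀ {c t} j (x : Vec (Fin 2) d) → Inv M₀ c t → j < n + n → Stored M₀ (j * d) x → Stored (mem t) (j * d) x
      stored-kept j x i j< = stored-cong (j * d) x
        (≤-trans (≤-reflexive (+-comm (j * d) d)) (≤-trans (*-monoˡ-≤ d j<) (≤-reflexive (*-distribʳ-+ d n n))))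
        (Inv.input-kept i)

      -- Positivity of M is read off from the fact that the counter has a value below n * M.
      quotient< : ∀ {m} → m < n * M → 1 ≤ M × quotient m M < n
      quotient< {m} = go M
        where
        go : ∀ M → m < n * M → 1 ≤ M × quotient m M < n
        go zero lt = contradiction (≤-trans lt (≤-reflexive (*-zeroʳ n))) λ ()
        go (suc M) lt = s≤s z≤n , m<n*o⇒m/o<n lt

      quotient-shift : ∀ c → 1 ≤ M → quotient (n * M + c) M ≡ n + quotient c M
      quotient-shift c = go M
        where
        go : ∀ M → 1 ≤ M → quotient (n * M + c) M ≡ n + quotient c M
        go (suc M) _ = trans (+-distrib-/-∣ˡ c (n∣m*n n)) (cong (_+ c / suc M) (m*n/n≡m n (suc M)))

      digit-shift : ∀ c → 1 ≤ M → digit (n * M + c) M ≡ digit c M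
      digit-shift c 1≤M = trans (cong (λ q → n * M + c ∸ q * M) (quotient-shift c 1≤M))
        (trans (cong (n * M + c ∸_) (*-distribʳ-+ M n (quotient c M))) ([m+n]∸[m+o]≡n∸o (n * M) c (quotient c M * M)))

      entry : State → ℕ → ℤ
      entry t κ = + mem t (κ + table)

      right-step : ∀ {c t} → c < n * M → Inv M₀ (suc (n * M + c)) t →
        Tallied right (leaf right (row v (quotient c M)) (digit c M)) table t (body t) × Inv M₀ (n * M + c) (body t)
      right-step {c} {t} c< i = subst (λ e → Tallied right (leaf right (row v (quotient c M)) e) table t (body t) × Inv M₀ (n * M + c) (body t))
        (digit-shift c 1≤M)
        (main-step right (row v (quotient c M)) i (trans (cong (n ∸_) q≡) (m≤n⇒m∸n≡0 (m≤m+n n (quotient c M))))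
          (stored-kept (quotient (n * M + c) M) (row v (quotient c M)) i
            (≤-trans (≤-reflexive (cong suc q≡)) (+-monoʳ-< n q<))
            (subst (λ j → Stored M₀ (j * d) (row v (quotient c M))) (sym q≡) (stored-right (quotient c M) q<))))
        where
        1≤M = proj₁ (quotient< c<)
        q< = proj₂ (quotient< c<)
        q≡ = quotient-shift c 1≤M

      left-step : ∀ {c t} → c < n * M → Inv M₀ (suc c) t →
        Tallied left (leaf left (row u (quotient c M)) (digit c M)) table t (body t) × Inv M₀ c (body t)
      left-step {c} {t} c< i =
        main-step left (row u (quotient c M)) i (λ z → <⇒≱ q< (m∸n≡0⇒m≤n z))
          (stored-kept (quotient c M) (row u (quotient c M)) i (≤-trans q< (m≤m+n n n)) (stored-left (quotient c M) q<))
        where q< = proj₂ (quotient< c<)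

      right-phase : ∀ c t → c ≤ n * M → Inv M₀ (n * M + c) t → let t′ = iter c body t in
        Inv M₀ (n * M) t′ × net t′ ≡ net t ×
        (∀ κ → entry t′ κ ≡ entry t κ +ᶻ ∑ c (λ i → hit κ (leaf right (row v (quotient i M)) (digit i M))))
      right-phase zero t _ i = subst (λ c → Inv M₀ c t) (+-identityʳ (n * M)) i , refl , λ κ → sym (ℤ.+-identityʳ (entry t κ))
      right-phase (suc c) t c< i = proj₁ ih , trans (proj₁ (proj₂ ih)) (trans (Tallied.net-gain tl) (ℤ.+-identityʳ (net t))) ,
        λ κ → trans (proj₂ (proj₂ ih) κ) (trans (cong (_+ᶻ ∑ c (hits κ)) (Tallied.table-hit tl κ)) (ℤ.+-assoc (entry t κ) (hits κ c) (∑ c (hits κ))))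
        where
        hits : ℕ → ℕ → ℤ
        hits κ i = hit κ (leaf right (row v (quotient i M)) (digit i M))
        step = right-step c< (subst (λ c → Inv M₀ c t) (+-suc (n * M) c) i)
        tl = proj₁ step
        ih = right-phase c (body t) (<⇒≤ c<) (proj₂ step)

      gain-cong : ∀ {f g : ℕ → ℤ} p → (∀ κ → f κ ≡ g κ) → gain f p ≡ gain g p
      gain-cong p h = cong (λ z → branch (undone p) 0ℤ (sign (sg (proj₁ p)) *ᶻ z)) (h (key (proj₁ p)))

      -- Left rounds do not change the table, so every gain can be expressed by the entries at the
      -- start of the phase.
      left-phase : ∀ c t → c ≤ n * M → Inv M₀ c t → let t′ = iter c body t in
        Inv M₀ 0 t′ × net t′ ≡ net t +ᶻ ∑ c (λ i → gain (entry t) (leaf left (row u (quotient i M)) (digit i M)))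
      left-phase zero t _ i = i , sym (ℤ.+-identityʳ (net t))
      left-phase (suc c) t c< i = proj₁ ih , trans (proj₂ ih) (trans (cong₂ _+ᶻ_ (Tallied.net-gain tl)
          (∑-cong c (λ i _ → gain-cong (leaf left (row u (quotient i M)) (digit i M)) (λ κ → trans (Tallied.table-hit tl κ) (ℤ.+-identityʳ (entry t κ))))))
        (ℤ.+-assoc (net t) (gains c) (∑ c gains)))
        where
        gains : ℕ → ℤ
        gains i = gain (entry t) (leaf left (row u (quotient i M)) (digit i M))
        step = left-step c< i
        tl = proj₁ step
        ih = left-phase c (body t) (<⇒≤ c<) (proj₂ step)

      iter-+ : ∀ a b t → iter (a + b) body t ≡ iter b body (iter a body t)
      iter-+ zero    b t = refl
      iter-+ (suc a) b t = iter-+ a b (body t)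

      count : ∀ t → Inv M₀ (n * M + n * M) t → net t ≡ 0ℤ → (∀ κ → mem t (κ + table) ≡ 0) →
              net (iter (n * M + n * M) body t) ≡ + #OV u v
      count t i net₀ table₀ = begin
        net (iter (n * M + n * M) body t)   ≡⟨ cong net (iter-+ (n * M) (n * M) t) ⟩
        net (iter (n * M) body t₁)          ≡⟨ proj₂ (left-phase (n * M) t₁ ≤-refl (proj₁ first)) ⟩
        net t₁ +ᶻ G                         ≡⟨ cong (_+ᶻ G) (trans (proj₁ (proj₂ first)) net₀) ⟩
        0ℤ +ᶻ G                             ≡⟨ ℤ.+-identityˡ G ⟩
        G                                   ≡⟨ ∑-cong (n * M) (λ i _ → gain-cong (leaf left (row u (quotient i M)) (digit i M)) tabled) ⟩
        ∑ (n * M) (λ i → gain H (leaf left (row u (quotient i M)) (digit i M)))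
          ≡⟨ ∑-product n M (λ i e → gain H (leaf left (row u i) e)) ⟩
        ∑ n (λ i → ∑ M λ e → gain H (leaf left (row u i) e))
          ≡⟨ gain-total n (row u) (row v) ⟩
        ∑ n (λ i → ∑ n λ j → indicator (orthogonal (row u i) (row v j)))
          ≡⟨ #OV-total u v ⟨
        + #OV u v ∎
        where
        open ≡-Reasoning
        t₁ = iter (n * M) body t
        first = right-phase (n * M) t ≤-refl i
        G = ∑ (n * M) (λ i → gain (entry t₁) (leaf left (row u (quotient i M)) (digit i M)))
        H : ℕ → ℤ
        H κ = ∑ n λ j → ∑ M λ e → hit κ (leaf right (row v j) e)
        tabled : ∀ κ → entry t₁ κ ≡ H κ
        tabled κ = trans (proj₂ (proj₂ first) κ) (trans (cong (_+ᶻ ∑ (n * M) (λ i → hit κ (leaf right (row v (quotient i M)) (digit i M)))) (cong +_ (table₀ κ)))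
          (trans (ℤ.+-identityˡ _) (∑-product n M (λ j e → hit κ (leaf right (row v j) e)))))

-- The complete program and its correctness

module Algorithm where

  import Data.Integer.Properties as ℤ
  open Prelude
  open Machine
  open Sums
  open Decomposition
  open Parameters
  open Counting
  open WalkCode
  open MainCode
  open MainLoop

  -- Register 5 is multiplied K times by 2B² and d times by 126, register 23 d times by 100; the
  -- division comes last, so that only one rounding occurs. The constant K is a literal of the
  -- program. The auxiliary registers are reset because the main loop expects them to be zero.
  setup₁ setup₂ setup₃ squareCode powerCode setupCode algorithm : Code
  setup₁ =
    ins (2 ≔ 1) ⨟ ins (3 ≔ K) ⨟ ins (22 ≔ʳ 3) ⨟ ins (div 3 1 3) ⨟ ins (add 3 3 2) ⨟ ins (add 4 3 2) ⨟ ins (5 ≔ 1)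
  squareCode = ins (mul 5 5 4) ⨟ ins (mul 5 5 4) ⨟ ins (add 5 5 5)
  setup₂ = ins (23 ≔ 1) ⨟ ins (24 ≔ 126) ⨟ ins (25 ≔ 100) ⨟ ins (22 ≔ʳ 1)
  powerCode = ins (mul 5 5 24) ⨟ ins (mul 23 23 25)
  setup₃ =
    ins (div 5 5 23) ⨟ ins (23 ≔ 0) ⨟ ins (24 ≔ 0) ⨟ ins (25 ≔ 0) ⨟
    ins (mul 6 0 1) ⨟ ins (add 6 6 6) ⨟ ins (mul 7 0 5) ⨟ ins (add 7 7 7)
  setupCode = setup₁ ⨟ loop 22 squareCode ⨟ setup₂ ⨟ loop 22 powerCode ⨟ setup₃
  algorithm = setupCode ⨟ loop 7 mainCode ⨟ ins (sub 0 8 9)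

  squares : ∀ k t → reg (iter k (exec (round 22 squareCode)) t) 5 ≡ reg t 5 * (2 * (reg t 4 * reg t 4)) ^ k
  squares zero t = sym (*-identityʳ (reg t 5))
  squares (suc k) t = begin
    reg (iter k (exec (round 22 squareCode)) t′) 5               ≡⟨ squares k t′ ⟩
    reg t′ 5 * (2 * (reg t′ 4 * reg t′ 4)) ^ k                   ≡⟨ cong₂ (λ x b → x * (2 * (b * b)) ^ k) (val step 5) (val step 4) ⟩
    (reg t 5 * b * b + reg t 5 * b * b) * (2 * (b * b)) ^ k      ≡⟨ e (reg t 5) b ((2 * (b * b)) ^ k) ⟩
    reg t 5 * (2 * (b * b)) ^ suc k ∎
    where
    open ≡-Reasoning
    t′ : State
    t′ = exec (round 22 squareCode) t
    b = reg t 4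
    step : Run (round 22 squareCode) t t′
    step = runs (round 22 squareCode) t tt
    e : ∀ x b y → (x * b * b + x * b * b) * y ≡ x * (2 * (b * b) * y)
    e = solve-∀

  powers : ∀ k t → reg (iter k (exec (round 22 powerCode)) t) 5 ≡ reg t 5 * reg t 24 ^ k ×
                   reg (iter k (exec (round 22 powerCode)) t) 23 ≡ reg t 23 * reg t 25 ^ k
  powers zero t = sym (*-identityʳ (reg t 5)) , sym (*-identityʳ (reg t 23))
  powers (suc k) t =
    trans (proj₁ (powers k t′)) (trans (cong₂ (λ x y → x * y ^ k) (val step 5) (val step 24)) (*-assoc (reg t 5) (reg t 24) (reg t 24 ^ k))) ,
    trans (proj₂ (powers k t′)) (trans (cong₂ (λ x y → x * y ^ k) (val step 23) (val step 25)) (*-assoc (reg t 23) (reg t 25) (reg t 25 ^ k)))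
    where
    t′ : State
    t′ = exec (round 22 powerCode) t
    step : Run (round 22 powerCode) t t′
    step = runs (round 22 powerCode) t tt

  record Setup (n d : ℕ) (t t′ : State) : Set where
    constructor setup
    field
      constants : Fixed n d t′
      idle      : Idle t′
      counter   : reg t′ 7 ≡ n * choices d + n * choices d
      gain₀     : reg t′ 8 ≡ 0
      loss₀     : reg t′ 9 ≡ 0
      same-mem  : mem t′ ≡ mem t

  module Stages (t : State) where
    t₁ t₂ t₃ t₄ t₅ : State
    t₁ = exec setup₁ t
    t₂ = exec (loop 22 squareCode) t₁
    t₃ = exec setup₂ t₂
    t₄ = exec (loop 22 powerCode) t₃
    t₅ = exec setup₃ t₄

    staged : ∀ (Q : State → Set) → Q t₅ → Q (exec setupCode t)
    staged Q q =
      in-sequence Q setup₁ (loop 22 squareCode ⨟ setup₂ ⨟ loop 22 powerCode ⨟ setup₃) t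
        (in-sequence Q (loop 22 squareCode) (setup₂ ⨟ loop 22 powerCode ⨟ setup₃) t₁
          (in-sequence Q setup₂ (loop 22 powerCode ⨟ setup₃) t₂
            (in-sequence Q (loop 22 powerCode) setup₃ t₃ q)))

    module _ {n d : ℕ} (r₀ : reg t 0 ≡ n) (r₁ : reg t 1 ≡ d) (zeros : ∀ r → reg t (2 + r) ≡ 0) where

      run₁ : Run setup₁ t t₁
      run₁ = runs setup₁ t tt
      run₃ : Run setup₂ t₂ t₃
      run₃ = runs setup₂ t₂ tt
      run₅ : Run setup₃ t₄ t₅
      run₅ = runs setup₃ t₄ tt
      s : ℕ
      s = suc (quotient d K)
      s-eq : reg t₁ 3 ≡ s
      s-eq = trans (val run₁ 3) (trans (cong (λ d → quotient d K + 1) r₁) (+-comm (quotient d K) 1))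
      B-eq : reg t₁ 4 ≡ base d
      B-eq = trans (val run₁ 4) (trans (cong (λ d → quotient d K + 1 + 1) r₁) (trans (cong (_+ 1) (+-comm (quotient d K) 1)) (+-comm s 1)))
      counter₁ : reg t₁ 22 ≡ K
      counter₁ = val run₁ 22
      kept : ∀ r {x} → T (not (writes setup₁ r)) → T (not (writes (loop 22 squareCode) r)) → T (not (writes setup₂ r)) →
             T (not (writes (loop 22 powerCode) r)) → reg t r ≡ x → reg t₄ r ≡ x
      kept r w₁ w₂ w₃ w₄ eq =
        trans (unwritten (loop 22 powerCode) t₃ r w₄) (trans (unwritten setup₂ t₂ r w₃)
          (trans (unwritten (loop 22 squareCode) t₁ r w₂) (trans (unwritten setup₁ t r w₁) eq)))
      prefactor-eq : reg t₂ 5 ≡ prefactor d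
      prefactor-eq = begin
        reg t₂ 5                                                     ≡⟨ cong (λ u → reg u 5) (loop-iterates 22 squareCode t₁) ⟩
        reg (iter (reg t₁ 22) (exec (round 22 squareCode)) t₁) 5     ≡⟨ squares (reg t₁ 22) t₁ ⟩
        reg t₁ 5 * (2 * (reg t₁ 4 * reg t₁ 4)) ^ reg t₁ 22           ≡⟨ cong₂ (λ x k → x * (2 * (reg t₁ 4 * reg t₁ 4)) ^ k) (val run₁ 5) counter₁ ⟩
        1 * (2 * (reg t₁ 4 * reg t₁ 4)) ^ K                          ≡⟨ +-identityʳ _ ⟩
        (2 * (reg t₁ 4 * reg t₁ 4)) ^ K                              ≡⟨ cong (λ b → (2 * (b * b)) ^ K) B-eq ⟩
        prefactor d                                                  ∎
        where open ≡-Reasoning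
      counter₃ : reg t₃ 22 ≡ d
      counter₃ = trans (val run₃ 22) (trans (unwritten (loop 22 squareCode) t₁ 1 tt) (trans (val run₁ 1) r₁))
      power₄ : reg t₄ 5 ≡ prefactor d * 126 ^ d × reg t₄ 23 ≡ 100 ^ d
      power₄ =
        trans (cong (λ u → reg u 5) unrolled) (trans (proj₁ (powers (reg t₃ 22) t₃))
          (trans (cong₂ (λ x y → x * y ^ reg t₃ 22) (trans (val run₃ 5) prefactor-eq) (val run₃ 24)) (cong (λ k → prefactor d * 126 ^ k) counter₃))) ,
        trans (cong (λ u → reg u 23) unrolled) (trans (proj₂ (powers (reg t₃ 22) t₃))
          (trans (cong₂ (λ x y → x * y ^ reg t₃ 22) (val run₃ 23) (val run₃ 25)) (trans (+-identityʳ _) (cong (100 ^_) counter₃))))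
        where
        unrolled : t₄ ≡ iter (reg t₃ 22) (exec (round 22 powerCode)) t₃
        unrolled = loop-iterates 22 powerCode t₃
      down : ∀ c w k r → w ≡ k → T (not (writes c 22)) → reg r 22 ≡ w → reg (iter k (exec (round 22 c)) r) 22 ≡ 0
      down c zero    .zero    r refl p eq = eq
      down c (suc w) .(suc w) r refl p eq = down c w w (exec (round 22 c) r) refl p (trans (countdown 22 c r p tt) (cong (_∸ 1) eq))
      one : reg t₄ 2 ≡ 1
      one = trans (cong (λ u → reg u 2) (loop-iterates 22 powerCode t₃)) (stay (reg t₃ 22) t₃
              (trans (unwritten setup₂ t₂ 2 tt) (trans (cong (λ u → reg u 2) (loop-iterates 22 squareCode t₁)) (stay′ (reg t₁ 22) t₁ (val run₁ 2)))))
        where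
        stay : ∀ k r → reg r 2 ≡ 1 → reg (iter k (exec (round 22 powerCode)) r) 2 ≡ 1
        stay zero r eq = eq
        stay (suc k) r eq = stay k _ (val (runs (round 22 powerCode) r tt) 2)
        stay′ : ∀ k r → reg r 2 ≡ 1 → reg (iter k (exec (round 22 squareCode)) r) 2 ≡ 1
        stay′ zero r eq = eq
        stay′ (suc k) r eq = stay′ k _ (val (runs (round 22 squareCode) r tt) 2)
      M-eq : quotient (reg t₄ 5) (reg t₄ 23) ≡ choices d
      M-eq = cong₂ quotient (proj₁ power₄) (proj₂ power₄)

      counter-empty : reg t₄ 22 ≡ 0
      counter-empty = trans (cong (λ u → reg u 22) (loop-iterates 22 powerCode t₃)) (down powerCode (reg t₃ 22) (reg t₃ 22) t₃ refl tt refl)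

      idle₅ : Idle t₅
      idle₅ 12 = trans (val run₅ 22) counter-empty
      idle₅ 13 = val run₅ 23
      idle₅ 14 = val run₅ 24
      idle₅ 15 = val run₅ 25
      idle₅ 0 = trans (val run₅ 10) (kept 10 tt tt tt tt (zeros 8))
      idle₅ 1 = trans (val run₅ 11) (kept 11 tt tt tt tt (zeros 9))
      idle₅ 2 = trans (val run₅ 12) (kept 12 tt tt tt tt (zeros 10))
      idle₅ 3 = trans (val run₅ 13) (kept 13 tt tt tt tt (zeros 11))
      idle₅ 4 = trans (val run₅ 14) (kept 14 tt tt tt tt (zeros 12))
      idle₅ 5 = trans (val run₅ 15) (kept 15 tt tt tt tt (zeros 13))
      idle₅ 6 = trans (val run₅ 16) (kept 16 tt tt tt tt (zeros 14))
      idle₅ 7 = trans (val run₅ 17) (kept 17 tt tt tt tt (zeros 15))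
      idle₅ 8 = trans (val run₅ 18) (kept 18 tt tt tt tt (zeros 16))
      idle₅ 9 = trans (val run₅ 19) (kept 19 tt tt tt tt (zeros 17))
      idle₅ 10 = trans (val run₅ 20) (kept 20 tt tt tt tt (zeros 18))
      idle₅ 11 = trans (val run₅ 21) (kept 21 tt tt tt tt (zeros 19))
      idle₅ (suc (suc (suc (suc (suc (suc (suc (suc (suc (suc (suc (suc (suc (suc (suc (suc r)))))))))))))))) =
        trans (val run₅ (26 + r)) (kept (26 + r) tt tt tt tt (zeros (24 + r)))

      set-up : Setup n d t (exec setupCode t)
      set-up = staged (Setup n d t) (setup
        (fixed (trans (val run₅ 0) r₀₄) (trans (val run₅ 1) r₁₄) (trans (val run₅ 2) one)
          (trans (val run₅ 3) (late 3 tt tt tt s-eq)) (trans (val run₅ 4) (late 4 tt tt tt B-eq)) (trans (val run₅ 5) M-eq)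
          (trans (val run₅ 6) (cong₂ _+_ nd nd)))
        idle₅ (trans (val run₅ 7) (cong₂ _+_ nM nM))
        (trans (val run₅ 8) (kept 8 tt tt tt tt (zeros 6))) (trans (val run₅ 9) (kept 9 tt tt tt tt (zeros 7)))
        (trans (unstored setup₃ t₄ tt) (trans (unstored (loop 22 powerCode) t₃ tt) (trans (unstored setup₂ t₂ tt)
          (trans (unstored (loop 22 squareCode) t₁ tt) (unstored setup₁ t tt))))))
        where
        r₀₄ : reg t₄ 0 ≡ n
        r₀₄ = kept 0 tt tt tt tt r₀
        r₁₄ : reg t₄ 1 ≡ d
        r₁₄ = kept 1 tt tt tt tt r₁
        late : ∀ r {x} → T (not (writes (loop 22 squareCode) r)) → T (not (writes setup₂ r)) →
               T (not (writes (loop 22 powerCode) r)) → reg t₁ r ≡ x → reg t₄ r ≡ x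
        late r w₂ w₃ w₄ eq = trans (unwritten (loop 22 powerCode) t₃ r w₄) (trans (unwritten setup₂ t₂ r w₃)
          (trans (unwritten (loop 22 squareCode) t₁ r w₂) eq))
        nd : reg t₄ 0 * reg t₄ 1 ≡ n * d
        nd = cong₂ _*_ r₀₄ r₁₄
        nM : reg t₄ 0 * quotient (reg t₄ 5) (reg t₄ 23) ≡ n * choices d
        nM = cong₂ _*_ r₀₄ M-eq

  -- The last instruction subtracts with truncation, which is exact because the net gain is a count
  -- and hence not negative.
  difference : ∀ a b {c} → + a -ᶻ + b ≡ + c → a ∸ b ≡ c
  difference a b {c} eq = trans (cong (_∸ b) (ℤ.+-injective (begin
    + a                      ≡⟨ ℤ.+-identityʳ (+ a) ⟨
    + a +ᶻ 0ℤ                ≡⟨ cong (λ z → + a +ᶻ z) (ℤ.+-inverseˡ (+ b)) ⟨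
    + a +ᶻ (- (+ b) +ᶻ + b)  ≡⟨ ℤ.+-assoc (+ a) (- (+ b)) (+ b) ⟨
    (+ a -ᶻ + b) +ᶻ + b      ≡⟨ cong (_+ᶻ + b) eq ⟩
    + (c + b)                ∎))) (m+n∸n≡m c b)
    where open ≡-Reasoning

  module Correct {n d : ℕ} (u v : Vec (Vec (Fin 2) d) n) where
    open Loop n d
    open Stages (input u v)

    ready : Setup n d (input u v) (exec setupCode (input u v))
    ready = set-up refl refl (λ _ → refl)

    module S = Setup ready

    start-inv : Inv (M₀ u v) (n * choices d + n * choices d) (exec setupCode (input u v))
    start-inv = inv S.constants S.idle S.counter (λ a _ → cong (λ M → M a) S.same-mem)

    correct : reg (exec algorithm (input u v)) 0 ≡ #OV u v
    correct = in-sequence (λ t → reg t 0 ≡ #OV u v) setupCode (loop 7 mainCode ⨟ ins (sub 0 8 9)) (input u v)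
      (in-sequence (λ t → reg t 0 ≡ #OV u v) (loop 7 mainCode) (ins (sub 0 8 9)) t
        (trans (val (runs (ins (sub 0 8 9)) (exec (loop 7 mainCode) t) tt) 0)
          (difference (reg (exec (loop 7 mainCode) t) 8) (reg (exec (loop 7 mainCode) t) 9) (trans (cong net (trans (loop-iterates 7 mainCode t) (cong (λ k → iter k body t) S.counter)))
            (count u v t start-inv (cong₂ (λ a b → + a -ᶻ + b) S.gain₀ S.loss₀)
              (λ κ → trans (cong (λ M → M (κ + table)) S.same-mem) (empty-table u v κ)))))))
      where t = exec setupCode (input u v)

-- Time of the setup and of one round of the main loop

module RunningTime where

  import Data.List.Base as List
  open Prelude
  open Machine
  open Sums
  open Decomposition
  open Parameters
  open Counting
  open WalkCode
  open MainCode
  open MainLoop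
  open Algorithm
  open Sizes

  -- A crude bound for all literals at once. The value 300 covers every piece except the one
  -- containing K; the largest sum, 1 + 126 + 100, occurs in `setup₂`.
  constantSum : Code → ℕ
  constantSum (ins (_ ≔ c))   = c
  constantSum (ins _)         = 0
  constantSum (c ⨟ c′)        = constantSum c + constantSum c′
  constantSum (cond _ c c′)   = constantSum c + constantSum c′
  constantSum (loop _ c)      = constantSum c

  constants-below : ∀ W c → constantSum c ≤ W → Constants W c
  constants-below W (ins (_ ≔ c))      le = le
  constants-below W (ins (_ ≔ʳ _))     le = tt
  constants-below W (ins (add _ _ _))  le = tt
  constants-below W (ins (sub _ _ _))  le = tt
  constants-below W (ins (mul _ _ _))  le = tt
  constants-below W (ins (div _ _ _))  le = tt
  constants-below W (ins (load _ _))   le = tt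
  constants-below W (ins (store _ _))  le = tt
  constants-below W (c ⨟ c′)           le =
    constants-below W c (m+n≤o⇒m≤o _ le) , constants-below W c′ (m+n≤o⇒n≤o (constantSum c) le)
  constants-below W (cond _ c c′)      le =
    constants-below W c (m+n≤o⇒m≤o _ le) , constants-below W c′ (m+n≤o⇒n≤o (constantSum c) le)
  constants-below W (loop _ c)         le = constants-below W c le

  inputEnv squareEnv powerEnv mainEnv walkEnv : Env
  inputEnv = env ((0 , 1) ∷ (0 , 1) ∷ []) (0 , 1)
  squareEnv = env ((0 , 1) ∷ (0 , 1) ∷ (0 , 1) ∷ (0 , 3) ∷ (0 , 3) ∷ (1 , 1) ∷ List.replicate 26 (0 , 1)) (0 , 1)
  powerEnv = env ((0 , 1) ∷ (0 , 1) ∷ (0 , 1) ∷ (0 , 3) ∷ (0 , 3) ∷ (1 , 1) ∷ List.replicate 17 (0 , 1) List.++ (1 , 1) ∷ List.replicate 8 (0 , 1)) (0 , 1)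
  mainEnv = env (List.replicate 10 (0 , 1)) (0 , 1)
  walkEnv = env (List.replicate 10 (0 , 1) List.++ List.replicate 22 (1 , 3)) (0 , 1)

  postCode : Code
  postCode = tallyCode ⨟ clear 22

  opaque
    bodyCost setupCost : ℕ
    bodyCost = timeSize preCode mainEnv + (weight (at (Env.regs walkEnv) 22) + timeSize (round 22 walkCode) walkEnv) +
      (timeSize postCode walkEnv + timeSize tick (execSize postCode walkEnv))
    setupCost = timeSize setup₁ inputEnv + (weight (at (Env.regs squareEnv) 22) + timeSize (round 22 squareCode) squareEnv) +
      (timeSize setup₂ squareEnv + (weight (at (Env.regs powerEnv) 22) + timeSize (round 22 powerCode) powerEnv) + timeSize setup₃ powerEnv)

  ℓ-positive : ∀ n → 1 ≤ ℓ n
  ℓ-positive n = s≤s z≤n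

  module Timing {W : ℕ} (W≥2 : 2 ≤ W) (W≥ : K + 300 ≤ W) where

    closed : ∀ c → T (constantSum c ≤ᵇ 300) → Constants W c
    closed c p = constants-below W c (≤-trans (≤ᵇ⇒≤ (constantSum c) 300 p) (≤-trans (m≤n+m 300 K) W≥))

    W-pos : ∀ n → 1 ≤ 1 * W ^ n
    W-pos n = ≤-trans (m^n>0 W {{>-nonZero (≤-trans (s≤s z≤n) W≥2)}} n) (≤-reflexive (sym (+-identityʳ _)))

    opaque
      unfolding bodyCost

      body-time : ∀ t → Fits 1 W mainEnv t →
        time (round 7 mainCode) t ≤ bodyCost * (suc (reg (exec preCode t) 22) * (ℓ (1 * W ^ (12 * reg (exec preCode t) 22)) + ℓ W))
      body-time t F = begin
        time (round 7 mainCode) t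
          ≡⟨ time-⨟ mainCode tick t ⟩
        time mainCode t + time tick (exec mainCode t)
          ≡⟨ cong₂ (λ x u → x + time tick u) (trans (time-⨟ preCode (loop 22 walkCode ⨟ postCode) t) (cong (λ z → time preCode t + z) (time-⨟ (loop 22 walkCode) postCode u₀)))
               (in-sequence (λ u → u ≡ exec postCode u₁) preCode (loop 22 walkCode ⨟ postCode) t
                 (in-sequence (λ u → u ≡ exec postCode u₁) (loop 22 walkCode) postCode u₀ refl)) ⟩
        (time preCode t + (time (loop 22 walkCode) u₀ + time postCode u₁)) + time tick (exec postCode u₁)
          ≤⟨ +-mono-≤ (+-mono-≤ (≤-trans (time≤ W≥2 ≤-refl preCode tt (closed preCode tt) F) (*-monoʳ-≤ a (+-monoˡ-≤ (ℓ W) (ℓ-positive Z))))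
               (+-mono-≤ (proj₂ walk) (time≤ W≥2 (W-pos (12 * r)) postCode tt (closed postCode tt) (proj₁ walk))))
               (time≤ W≥2 (W-pos (12 * r)) tick tt (closed tick tt) (exec-fits W≥2 (W-pos (12 * r)) postCode tt (closed postCode tt) (proj₁ walk))) ⟩
        (a * Λ + (suc r * (b * Λ) + c * Λ)) + e * Λ
          ≤⟨ m≤m+n _ ((a + c + e) * (r * Λ)) ⟩
        (a * Λ + (suc r * (b * Λ) + c * Λ)) + e * Λ + (a + c + e) * (r * Λ)
          ≡⟨ collect a b c e r Λ ⟩
        bodyCost * (suc r * Λ) ∎
        where
        open ≤-Reasoning
        u₀ u₁ : State
        u₀ = exec preCode t
        u₁ = exec (loop 22 walkCode) u₀
        r Z Λ a b c e : ℕ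
        r = reg u₀ 22
        Z = 1 * W ^ (12 * r)
        Λ = ℓ Z + ℓ W
        a = timeSize preCode mainEnv
        b = weight (at (Env.regs walkEnv) 22) + timeSize (round 22 walkCode) walkEnv
        c = timeSize postCode walkEnv
        e = timeSize tick (execSize postCode walkEnv)
        walk : Fits Z W walkEnv u₁ × time (loop 22 walkCode) u₀ ≤ suc r * (b * Λ)
        -- A coordinate enlarges Z by at most W ^ 12: with this exponent the comparison of `walkEnv`
        -- with its image under one round evaluates to true.
        walk = loop-fits W≥2 22 walkCode walkEnv 12 tt (closed walkCode tt) tt ≤-refl
          (⊑ᴱ-sound₀ W≥2 (execSize preCode mainEnv) walkEnv ≤-refl tt (exec-fits W≥2 ≤-refl preCode tt (closed preCode tt) F))
        collect : ∀ a b c e r l → (a * l + (suc r * (b * l) + c * l)) + e * l + (a + c + e) * (r * l) ≡ (a + b + (c + e)) * (suc r * l)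
        collect = solve-∀

    setup-constants : Constants W setup₁
    setup-constants = constants-below W setup₁ (≤-trans (≤-reflexive (sym (+-suc K 1))) (≤-trans (+-monoʳ-≤ K (≤ᵇ⇒≤ 2 300 tt)) W≥))

    opaque
      unfolding setupCost

      setup-time : ∀ t → Fits 1 W inputEnv t → let open Stages t; i = reg t₁ 22; d = reg t₃ 22 in
        time setupCode t ≤ setupCost * (suc (i + d) * (ℓ (1 * W ^ (8 * (i + d))) + ℓ W))
      setup-time t F = begin
        time setupCode t
          ≡⟨ trans (time-⨟ setup₁ _ t) (cong (λ z → time setup₁ t + z) (trans (time-⨟ (loop 22 squareCode) _ t₁) (cong (λ z → time (loop 22 squareCode) t₁ + z)
               (trans (time-⨟ setup₂ _ t₂) (cong (λ z → time setup₂ t₂ + z) (time-⨟ (loop 22 powerCode) setup₃ t₃)))))) ⟩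
        time setup₁ t + (time (loop 22 squareCode) t₁ + (time setup₂ t₂ + (time (loop 22 powerCode) t₃ + time setup₃ t₄)))
          ≤⟨ +-mono-≤ (≤-trans (time≤ W≥2 ≤-refl setup₁ tt setup-constants F) (*-monoʳ-≤ a₁ (+-monoˡ-≤ (ℓ W) (ℓ-positive Z))))
               (+-mono-≤ (≤-trans (proj₂ square) (*-mono-≤ (s≤s (m≤m+n i d)) (*-monoʳ-≤ a₂ Λ₁≤)))
                 (+-mono-≤ (≤-trans (time≤ W≥2 (W-pos (8 * i)) setup₂ tt (closed setup₂ tt) (proj₁ square)) (*-monoʳ-≤ a₃ Λ₁≤))
                   (+-mono-≤ (≤-trans (proj₂ power) (*-mono-≤ (s≤s (m≤n+m d i)) (≤-reflexive (cong (λ z → a₄ * (ℓ z + ℓ W)) Z₂≡))))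
                     (≤-trans (time≤ W≥2 Z₂≥1 setup₃ tt (closed setup₃ tt) (proj₁ power)) (≤-reflexive (cong (λ z → a₅ * (ℓ z + ℓ W)) Z₂≡)))))) ⟩
        a₁ * Λ + (suc (i + d) * (a₂ * Λ) + (a₃ * Λ + (suc (i + d) * (a₄ * Λ) + a₅ * Λ)))
          ≤⟨ m≤m+n _ ((a₁ + a₃ + a₅) * ((i + d) * Λ)) ⟩
        a₁ * Λ + (suc (i + d) * (a₂ * Λ) + (a₃ * Λ + (suc (i + d) * (a₄ * Λ) + a₅ * Λ))) + (a₁ + a₃ + a₅) * ((i + d) * Λ)
          ≡⟨ collect a₁ a₂ a₃ a₄ a₅ (i + d) Λ ⟩
        setupCost * (suc (i + d) * Λ) ∎
        where
        open ≤-Reasoning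
        open Stages t
        i d Z Λ a₁ a₂ a₃ a₄ a₅ : ℕ
        i = reg t₁ 22
        d = reg t₃ 22
        Z = 1 * W ^ (8 * (i + d))
        Λ = ℓ Z + ℓ W
        a₁ = timeSize setup₁ inputEnv
        a₂ = weight (at (Env.regs squareEnv) 22) + timeSize (round 22 squareCode) squareEnv
        a₃ = timeSize setup₂ squareEnv
        a₄ = weight (at (Env.regs powerEnv) 22) + timeSize (round 22 powerCode) powerEnv
        a₅ = timeSize setup₃ powerEnv
        square : Fits (1 * W ^ (8 * i)) W squareEnv t₂ × time (loop 22 squareCode) t₁ ≤ suc i * (a₂ * (ℓ (1 * W ^ (8 * i)) + ℓ W))
        square = loop-fits W≥2 22 squareCode squareEnv 8 tt (closed squareCode tt) tt ≤-refl
          (⊑ᴱ-sound₀ W≥2 (execSize setup₁ inputEnv) squareEnv ≤-refl tt (exec-fits W≥2 ≤-refl setup₁ tt setup-constants F))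
        Z₂≥1 : 1 ≤ 1 * W ^ (8 * i) * W ^ (8 * d)
        Z₂≥1 = *-mono-≤ (W-pos (8 * i)) (≤-trans (W-pos (8 * d)) (≤-reflexive (+-identityʳ _)))
        power : Fits (1 * W ^ (8 * i) * W ^ (8 * d)) W powerEnv t₄ ×
                time (loop 22 powerCode) t₃ ≤ suc d * (a₄ * (ℓ (1 * W ^ (8 * i) * W ^ (8 * d)) + ℓ W))
        power = loop-fits W≥2 22 powerCode powerEnv 8 tt (closed powerCode tt) tt (W-pos (8 * i))
          (⊑ᴱ-sound₀ W≥2 (execSize setup₂ squareEnv) powerEnv (W-pos (8 * i)) tt (exec-fits W≥2 (W-pos (8 * i)) setup₂ tt (closed setup₂ tt) (proj₁ square)))
        Z₂≡ : 1 * W ^ (8 * i) * W ^ (8 * d) ≡ Z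
        Z₂≡ = trans (*-assoc 1 (W ^ (8 * i)) (W ^ (8 * d))) (cong (1 *_) (trans (sym (^-distribˡ-+-* W (8 * i) (8 * d))) (cong (W ^_) (sym (*-distribˡ-+ 8 i d)))))
        Λ₁≤ : ℓ (1 * W ^ (8 * i)) + ℓ W ≤ Λ
        Λ₁≤ = +-monoˡ-≤ (ℓ W) (ℓ-mono (*-monoʳ-≤ 1 (^-monoʳ-≤ W {{>-nonZero (≤-trans (s≤s z≤n) W≥2)}} (*-monoʳ-≤ 8 (m≤m+n i d)))))
        collect : ∀ a b c e f r l → a * l + (suc r * (b * l) + (c * l + (suc r * (e * l) + f * l))) + (a + c + f) * (r * l) ≡ (a + b + (c + e + f)) * (suc r * l)
        collect = solve-∀

-- Size invariants over the whole run and the total time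

module TotalTime where

  import Data.List.Base as List
  import Data.Vec.Base as Vec
  open Prelude
  open Machine
  open Sums
  open Decomposition
  open Parameters
  open Counting
  open WalkCode
  open MainCode
  open MainLoop
  open Algorithm
  open Sizes
  open RunningTime

  -- With P rounds in all, a memory cell starts at no more than 1 and grows by at most 1 per round,
  -- so `tally-bound` is a bound for it. The gains and losses each grow by at most that per round,
  -- so its square bounds them. Adding all quantities makes every one of them at most W.
  tally-bound size-bound : ℕ → ℕ → ℕ
  tally-bound n d = suc (n * choices d + n * choices d)
  size-bound n d =
    (K + 300) + (n + (d + (base d + (choices d + ((n * d + n * d) + ((n * choices d + n * choices d) + tally-bound n d * tally-bound n d))))))

  module LoopTime {n d : ℕ} (u v : Vec (Vec (Fin 2) d) n) where
    open Loop n d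
    open Count d using (M)

    W : ℕ
    W = size-bound n d

    P V : ℕ
    P = n * M + n * M
    V = tally-bound n d * tally-bound n d

    private
      x₁ x₂ x₃ x₄ x₅ x₆ : ℕ
      x₆ = P + V
      x₅ = (n * d + n * d) + x₆
      x₄ = choices d + x₅
      x₃ = base d + x₄
      x₂ = d + x₃
      x₁ = n + x₂

    W≥ : K + 300 ≤ W
    W≥ = m≤m+n (K + 300) x₁
    W≥2 : 2 ≤ W
    W≥2 = ≤-trans (≤ᵇ⇒≤ 2 300 tt) (≤-trans (m≤n+m 300 K) W≥)
    n≤W : n ≤ W
    n≤W = ≤-trans (m≤m+n n x₂) (m≤n+m x₁ (K + 300))
    ≤x₁ : ∀ {x} → x ≤ x₂ → x ≤ W
    ≤x₁ p = ≤-trans (≤-trans p (m≤n+m x₂ n)) (m≤n+m x₁ (K + 300))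
    d≤W : d ≤ W
    d≤W = ≤x₁ (m≤m+n d x₃)
    ≤x₂ : ∀ {x} → x ≤ x₃ → x ≤ W
    ≤x₂ p = ≤x₁ (≤-trans p (m≤n+m x₃ d))
    base≤W : base d ≤ W
    base≤W = ≤x₂ (m≤m+n (base d) x₄)
    ≤x₃ : ∀ {x} → x ≤ x₄ → x ≤ W
    ≤x₃ p = ≤x₂ (≤-trans p (m≤n+m x₄ (base d)))
    M≤W : M ≤ W
    M≤W = ≤x₃ (m≤m+n M x₅)
    ≤x₄ : ∀ {x} → x ≤ x₅ → x ≤ W
    ≤x₄ p = ≤x₃ (≤-trans p (m≤n+m x₅ M))
    table≤W : table ≤ W
    table≤W = ≤x₄ (m≤m+n (n * d + n * d) x₆)
    ≤x₅ : ∀ {x} → x ≤ x₆ → x ≤ W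
    ≤x₅ p = ≤x₄ (≤-trans p (m≤n+m x₆ (n * d + n * d)))
    P≤W : P ≤ W
    P≤W = ≤x₅ (m≤m+n P V)
    V≤W : V ≤ W
    V≤W = ≤x₅ (m≤n+m V P)
    1≤W : 1 ≤ W
    1≤W = ≤-trans (s≤s z≤n) W≥2

    open Timing W≥2 W≥

    -- The growth allowed in the c rounds still to come is reserved in advance; a round uses up
    -- precisely its share.
    record Small (c : ℕ) (t : State) : Set where
      constructor small
      field
        mem-small  : ∀ a → mem t a + c ≤ suc P
        gain-small : reg t 8 + c * suc P ≤ V
        loss-small : reg t 9 + c * suc P ≤ V

    small-step : ∀ {ρ p c t} → Tallied ρ p table t (body t) → Small (suc c) t → Small c (body t)
    small-step {c = c} {t} tl (small m g l) = small
      (λ a → ≤-trans (+-monoˡ-≤ c (Tallied.mem-grows tl a)) (≤-trans (≤-reflexive (sym (+-suc (mem t a) c))) (m a)))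
      (≤-trans (+-monoˡ-≤ (c * suc P) (proj₁ grow)) (≤-trans (≤-reflexive (+-assoc (reg t 8) (suc P) (c * suc P))) g))
      (≤-trans (+-monoˡ-≤ (c * suc P) (proj₂ grow)) (≤-trans (≤-reflexive (+-assoc (reg t 9) (suc P) (c * suc P))) l))
      where
      grow : reg (body t) 8 ≤ reg t 8 + suc P × reg (body t) 9 ≤ reg t 9 + suc P
      grow = Tallied.gains-grow tl (suc P) (λ a → ≤-trans (m≤m+n (mem t a) (suc c)) (m a))

    fits-main : ∀ {c t} → c ≤ P → Inv (M₀ u v) c t → Small c t → Fits 1 W mainEnv t
    fits-main {c} {t} c≤ (inv (fixed r₀ r₁ r₂ r₃ r₄ r₅ r₆) id r₇ _) (small m g l) = fits regs (λ a → atW (≤-trans (m≤m+n (mem t a) c) (≤-trans (m a) sucP≤W)))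
      where
      atW : ∀ {x} → x ≤ W → x ≤ ⟦ 0 , 1 ⟧ 1 W
      atW p = ≤-trans p (≤-reflexive (sym (trans (+-identityʳ (W * 1)) (*-identityʳ W))))
      sucP≤W : suc P ≤ W
      sucP≤W = ≤-trans (m≤m*n (suc P) (suc P)) V≤W
      regs : ∀ r → reg t r ≤ ⟦ at (Env.regs mainEnv) r ⟧ 1 W
      regs 0 = atW (≤-trans (≤-reflexive r₀) n≤W)
      regs 1 = atW (≤-trans (≤-reflexive r₁) d≤W)
      regs 2 = atW (≤-trans (≤-reflexive r₂) 1≤W)
      regs 3 = atW (≤-trans (≤-reflexive r₃) (≤-trans (n≤1+n _) base≤W))
      regs 4 = atW (≤-trans (≤-reflexive r₄) base≤W)
      regs 5 = atW (≤-trans (≤-reflexive r₅) M≤W)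
      regs 6 = atW (≤-trans (≤-reflexive r₆) table≤W)
      regs 7 = atW (≤-trans (≤-reflexive r₇) (≤-trans c≤ P≤W))
      regs 8 = atW (≤-trans (m≤m+n (reg t 8) (c * suc P)) (≤-trans g V≤W))
      regs 9 = atW (≤-trans (m≤m+n (reg t 9) (c * suc P)) (≤-trans l V≤W))
      regs (suc (suc (suc (suc (suc (suc (suc (suc (suc (suc r)))))))))) = ≤-trans (≤-reflexive (id r)) z≤n

    any-step : ∀ {c t} → c < P → Inv (M₀ u v) (suc c) t → ∃[ ρ ] ∃[ p ] Tallied ρ p table t (body t) × Inv (M₀ u v) c (body t)
    any-step {c} {t} c< i with c <? n * M
    ... | yes lt = left , _ , left-step u v lt i
    ... | no ge = right , _ , proj₁ step , subst (λ c → Inv (M₀ u v) c (body t)) c≡ (proj₂ step)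
      where
      c≡ : n * M + (c ∸ n * M) ≡ c
      c≡ = m+[n∸m]≡n (≮⇒≥ ge)
      step = right-step u v {c ∸ n * M} (+-cancelˡ-< (n * M) _ _ (≤-trans (≤-reflexive (cong suc c≡)) c<))
               (subst (λ c → Inv (M₀ u v) (suc c) t) (sym c≡) i)

    X Y : ℕ
    Y = bodyCost * (suc d * (ℓ (1 * W ^ (12 * d)) + ℓ W))
    X = ℓ W + Y

    main-time : ∀ c t → c ≤ P → Inv (M₀ u v) c t → Small c t →
      loopTime 7 c body (time (round 7 mainCode)) t ≤ suc c * X × Inv (M₀ u v) 0 (iter c body t) × Small 0 (iter c body t)
    main-time zero t c≤ i s = ≤-trans (≤-trans (ℓ-mono {reg t 7} {W} (≤-trans (≤-reflexive (Inv.counter i)) z≤n)) (m≤m+n (ℓ W) Y)) (≤-reflexive (sym (+-identityʳ X))) , i , s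
    main-time (suc c) t c≤ i s = go (any-step c≤ i)
      where
      counts : reg (exec preCode t) 22 ≡ d
      counts = trans (val (runs preCode t tt) 22) (Fixed.r₁ (Inv.constants i))
      now : ℓ (reg t 7) + time (round 7 mainCode) t ≤ X
      now = +-mono-≤ (ℓ-mono {reg t 7} {W} (≤-trans (≤-reflexive (Inv.counter i)) (≤-trans c≤ P≤W)))
        (subst (λ r → time (round 7 mainCode) t ≤ bodyCost * (suc r * (ℓ (1 * W ^ (12 * r)) + ℓ W))) counts
          (body-time t (fits-main c≤ i s)))
      go : ∃[ ρ ] ∃[ p ] Tallied ρ p table t (body t) × Inv (M₀ u v) c (body t) →
        loopTime 7 (suc c) body (time (round 7 mainCode)) t ≤ suc (suc c) * X × Inv (M₀ u v) 0 (iter (suc c) body t) × Small 0 (iter (suc c) body t)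
      go (ρ , p , tl , i′) =
        ≤-trans (≤-reflexive (sym (+-assoc (ℓ (reg t 7)) (time (round 7 mainCode) t) (loopTime 7 c body (time (round 7 mainCode)) (body t))))) (+-mono-≤ now (proj₁ rest)) , proj₂ rest
        where rest = main-time c (body t) (<⇒≤ c≤) i′ (small-step tl s)

    open Correct u v

    bits≤1 : ∀ a → M₀ u v a ≤ 1
    bits≤1 a = go (flat u List.++ flat v) (all-++ (flat-bits u) (flat-bits v)) a
      where
      Bits : List ℕ → Set
      Bits []       = ⊤
      Bits (x ∷ xs) = x ≤ 1 × Bits xs
      all-++ : ∀ {xs ys} → Bits xs → Bits ys → Bits (xs List.++ ys)
      all-++ {[]} _ q = q
      all-++ {x ∷ xs} (p , ps) q = p , all-++ ps q
      bits : ∀ {d} (x : Vec (Fin 2) d) → Bits (Vec.toList (Vec.map toℕ x))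
      bits [] = tt
      bits (zero ∷ x) = z≤n , bits x
      bits (suc zero ∷ x) = ≤-refl , bits x
      flat-bits : ∀ (w : Vec (Vec (Fin 2) d) n) → Bits (flat w)
      flat-bits w = bits (Vec.concat w)
      go : ∀ xs → Bits xs → ∀ a → nth xs a ≤ 1
      go [] _ a = z≤n
      go (x ∷ xs) (p , _) zero = p
      go (x ∷ xs) (_ , p) (suc a) = go xs p a

    total-time : time algorithm (input u v) ≤
      setupCost * (suc (K + d) * (ℓ (1 * W ^ (8 * (K + d))) + ℓ W)) + (suc P * X + 4 * (1 + ℓ W))
    total-time = begin
      time algorithm (input u v)
        ≡⟨ trans (time-⨟ setupCode (loop 7 mainCode ⨟ ins (sub 0 8 9)) (input u v)) (cong (λ z → time setupCode (input u v) + z) (time-⨟ (loop 7 mainCode) (ins (sub 0 8 9)) t)) ⟩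
      time setupCode (input u v) + (time (loop 7 mainCode) t + time (ins (sub 0 8 9)) (exec (loop 7 mainCode) t))
        ≤⟨ +-mono-≤ set (+-mono-≤ (≤-trans (≤-reflexive (trans (time-loop 7 mainCode t) (cong (λ c → loopTime 7 c body (time (round 7 mainCode)) t) S.counter))) (proj₁ run-main))
             -- Both operands have size `(0 , 1)` and hence weight 2, which gives the factor 4; the
             -- 1 beside `ℓ W` is the length of Z = 1.
             (time≤ W≥2 ≤-refl (ins (sub 0 8 9)) tt tt
               (subst (Fits 1 W mainEnv) (sym (trans (loop-iterates 7 mainCode t) (cong (λ c → iter c body t) S.counter)))
                 (fits-main z≤n (proj₁ (proj₂ run-main)) (proj₂ (proj₂ run-main)))))) ⟩
      setupCost * (suc (K + d) * (ℓ (1 * W ^ (8 * (K + d))) + ℓ W)) + (suc P * X + 4 * (1 + ℓ W)) ∎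
      where
      open ≤-Reasoning
      t : State
      t = exec setupCode (input u v)
      run-main : loopTime 7 P body (time (round 7 mainCode)) t ≤ suc P * X × Inv (M₀ u v) 0 (iter P body t) × Small 0 (iter P body t)
      run-main = main-time P t ≤-refl start-inv (small
        (λ a → +-monoˡ-≤ P (≤-trans (≤-reflexive (cong (λ M → M a) S.same-mem)) (bits≤1 a)))
        (≤-trans (≤-reflexive (cong (_+ P * suc P) S.gain₀)) (*-monoˡ-≤ (suc P) (n≤1+n P)))
        (≤-trans (≤-reflexive (cong (_+ P * suc P) S.loss₀)) (*-monoˡ-≤ (suc P) (n≤1+n P))))
      initial : Fits 1 W inputEnv (input u v)
      initial = fits regs (λ a → atW (≤-trans (bits≤1 a) 1≤W))
        where
        atW : ∀ {x} → x ≤ W → x ≤ ⟦ 0 , 1 ⟧ 1 W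
        atW p = ≤-trans p (≤-reflexive (sym (trans (+-identityʳ (W * 1)) (*-identityʳ W))))
        regs : ∀ r → reg (input u v) r ≤ ⟦ at (Env.regs inputEnv) r ⟧ 1 W
        regs 0 = atW n≤W
        regs 1 = atW d≤W
        regs (suc (suc r)) = z≤n
      set : time setupCode (input u v) ≤ setupCost * (suc (K + d) * (ℓ (1 * W ^ (8 * (K + d))) + ℓ W))
      set = subst₂ (λ i j → time setupCode (input u v) ≤ setupCost * (suc (i + j) * (ℓ (1 * W ^ (8 * (i + j))) + ℓ W)))
        (Stages.counter₁ (input u v) {n} {d} refl refl (λ _ → refl)) (Stages.counter₃ (input u v) {n} {d} refl refl (λ _ → refl))
        (setup-time (input u v) initial)

-- Polynomial overhead and the final bound

module Asymptotics where

  import Data.Integer.Base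
  import Data.Integer.Properties as ℤ
  open import Data.Rational.Unnormalised.Base as ℚᵘ using (ℚᵘ; mkℚᵘ; *≤*; ↥_; ↧ₙ_; _/_)
  open Prelude hiding (_/_)
  open Machine
  open Sums
  open Parameters
  open Algorithm
  open RunningTime
  open TotalTime

  n<2^n : ∀ n → n < 2 ^ n
  n<2^n zero    = s≤s z≤n
  n<2^n (suc n) = begin-strict
    suc n              ≤⟨ n<2^n n ⟩
    2 ^ n              <⟨ m<m+n (2 ^ n) (m^n>0 2 n) ⟩
    2 ^ n + 2 ^ n      ≡⟨ cong (λ z → 2 ^ n + z) (+-identityʳ (2 ^ n)) ⟨
    2 ^ suc n          ∎
    where open ≤-Reasoning

  n≤2^⌈log₂n⌉ : ∀ n → n ≤ 2 ^ ⌈log₂ n ⌉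
  n≤2^⌈log₂n⌉ n = go n n ≤-refl
    where
    half : ∀ n → n ≤ 2 * ⌈ n /2⌉
    half zero           = z≤n
    half (suc zero)     = s≤s z≤n
    half (suc (suc n))  = ≤-trans (s≤s (s≤s (half n))) (≤-reflexive (sym (*-suc 2 ⌈ n /2⌉)))
    go : ∀ b n → n ≤ b → n ≤ 2 ^ ⌈log₂ n ⌉
    go b zero _ = z≤n
    go b (suc zero) _ = s≤s z≤n
    go (suc b) (suc (suc n)) (s≤s le) = begin
      suc (suc n)                        ≤⟨ half (suc (suc n)) ⟩
      2 * suc ⌈ n /2⌉                    ≤⟨ *-monoʳ-≤ 2 (go b (suc ⌈ n /2⌉) (≤-trans (s≤s (⌈n/2⌉≤n n)) le)) ⟩
      2 ^ suc ⌈log₂ suc ⌈ n /2⌉ ⌉        ≡⟨ cong (λ e → 2 ^ suc e) (⌈log₂⌈n/2⌉⌉≡⌈log₂n⌉∸1 (suc (suc n))) ⟩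
      2 ^ suc (⌈log₂ suc (suc n) ⌉ ∸ 1)  ≡⟨ cong (2 ^_) (m+[n∸m]≡n (⌈log₂⌉-mono-≤ {2} {suc (suc n)} (s≤s (s≤s z≤n)))) ⟩
      2 ^ ⌈log₂ suc (suc n) ⌉            ∎
      where open ≤-Reasoning

  scale : ℕ → ℕ → ℕ
  scale n d = 1 + d + ⌈log₂ n ⌉

  module Magnitude (D : ℕ) (D≥1 : 1 ≤ D) where

    -- A bound a * D for the binary logarithm of x. It composes under sums, products and constant
    -- powers, which is all that is needed for the length of W to be linear in D.
    record _≼_ (x a : ℕ) : Set where
      constructor magnitude
      field power : x ≤ 2 ^ (a * D)
    open _≼_ public

    ≼-≤ : ∀ {x y a} → x ≤ y → y ≼ a → x ≼ a
    ≼-≤ p (magnitude q) = magnitude (≤-trans p q)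

    ≼-exponent : ∀ {x y a} → x ≤ 2 ^ y → y ≤ a * D → x ≼ a
    ≼-exponent p q = magnitude (≤-trans p (^-monoʳ-≤ 2 q))

    ≼-constant : ∀ c → c ≼ c
    ≼-constant c = ≼-exponent (<⇒≤ (n<2^n c)) (m≤m*n c D {{>-nonZero D≥1}})

    ≼-* : ∀ {x y a b} → x ≼ a → y ≼ b → (x * y) ≼ (a + b)
    ≼-* {a = a} {b} (magnitude p) (magnitude q) = magnitude (≤-trans (*-mono-≤ p q)
      (≤-reflexive (trans (sym (^-distribˡ-+-* 2 (a * D) (b * D))) (cong (2 ^_) (sym (*-distribʳ-+ D a b))))))

    ≼-^ : ∀ {x a} k → x ≼ a → (x ^ k) ≼ (k * a)
    ≼-^ zero    p = magnitude ≤-refl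
    ≼-^ (suc k) p = ≼-* p (≼-^ k p)

    ≼-+ : ∀ {x y a b} → x ≼ a → y ≼ b → (x + y) ≼ (1 + (a + b))
    ≼-+ {x} {y} {a} {b} (magnitude p) (magnitude q) = magnitude (begin
      x + y                                   ≤⟨ +-mono-≤ (≤-trans p (^-monoʳ-≤ 2 (*-monoˡ-≤ D (m≤m+n a b)))) (≤-trans q (^-monoʳ-≤ 2 (*-monoˡ-≤ D (m≤n+m b a)))) ⟩
      2 ^ ((a + b) * D) + 2 ^ ((a + b) * D)   ≡⟨ cong (λ z → 2 ^ ((a + b) * D) + z) (+-identityʳ (2 ^ ((a + b) * D))) ⟨
      2 ^ (1 + (a + b) * D)                   ≤⟨ ^-monoʳ-≤ 2 (+-monoˡ-≤ ((a + b) * D) D≥1) ⟩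
      2 ^ ((1 + (a + b)) * D)                 ∎)
      where open ≤-Reasoning

  opaque
    -- The numbers follow the shape of the bounds: an addition costs 1, `base` has magnitude 4, and
    -- 7 comes from 126 ≤ 2 ^ 7.
    prefactor-magnitude choices-magnitude tally-magnitude size-magnitude : ℕ
    prefactor-magnitude = K * (2 + (4 + 4))
    choices-magnitude = prefactor-magnitude + 7
    tally-magnitude = 1 + (1 + (1 + ((1 + choices-magnitude) + (1 + choices-magnitude))))
    size-magnitude =
      1 + ((K + 300) + (1 + (1 + (1 + (1 + (1 + (4 + (1 + (choices-magnitude + (1 + ((1 + (2 + 2)) +
        (1 + ((1 + ((1 + choices-magnitude) + (1 + choices-magnitude))) + (tally-magnitude + tally-magnitude))))))))))))))

    size-bound-magnitude : ∀ n d → size-bound n d ≤ 2 ^ (size-magnitude * scale n d)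
    size-bound-magnitude n d = power
      (≼-+ (≼-constant (K + 300)) (≼-+ n≼ (≼-+ d≼ (≼-+ base≼ (≼-+ choices≼ (≼-+ (≼-+ (≼-* n≼ d≼) (≼-* n≼ d≼))
        (≼-+ P≼ (≼-* tally≼ tally≼))))))))
      where
      D : ℕ
      D = scale n d
      open Magnitude (scale n d) (s≤s z≤n)
      n≼ : n ≼ 1
      n≼ = ≼-exponent (n≤2^⌈log₂n⌉ n) (≤-trans (m≤n+m ⌈log₂ n ⌉ (1 + d)) (≤-reflexive (sym (+-identityʳ D))))
      d≤D : d ≤ D
      d≤D = ≤-trans (n≤1+n d) (m≤m+n (1 + d) ⌈log₂ n ⌉)
      d≼ : d ≼ 1
      d≼ = ≼-exponent (<⇒≤ (n<2^n d)) (≤-trans d≤D (≤-reflexive (sym (+-identityʳ D))))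
      base≼ : base d ≼ 4
      base≼ = ≼-+ (≼-constant 2) (≼-≤ (quotient≤ d K) d≼)
      prefactor≼ : prefactor d ≼ prefactor-magnitude
      prefactor≼ = ≼-^ K (≼-* (≼-constant 2) (≼-* base≼ base≼))
      126^≼ : (126 ^ d) ≼ 7
      126^≼ = ≼-exponent (≤-trans (^-monoˡ-≤ d (≤ᵇ⇒≤ 126 (2 ^ 7) tt)) (≤-reflexive (^-*-assoc 2 7 d))) (*-monoʳ-≤ 7 d≤D)
      choices≼ : choices d ≼ choices-magnitude
      choices≼ = ≼-≤ (quotient≤ (prefactor d * 126 ^ d) (100 ^ d)) (≼-* prefactor≼ 126^≼)
      P≼ : (n * choices d + n * choices d) ≼ (1 + ((1 + choices-magnitude) + (1 + choices-magnitude)))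
      P≼ = ≼-+ (≼-* n≼ choices≼) (≼-* n≼ choices≼)
      tally≼ : tally-bound n d ≼ tally-magnitude
      tally≼ = ≼-+ (≼-constant 1) P≼

  -- `α * D` bounds the length of W; the others are the coefficients of the setup, of one main round
  -- and of the final subtraction.
  α c₁ c₂ c₃ : ℕ
  α = suc size-magnitude
  c₁ = setupCost * (suc K * (1 + 8 * suc K * α + α))
  c₂ = α + bodyCost * (1 + 12 * 1 * α + α)
  c₃ = 4 * (1 + α)

  module Polynomial (n d : ℕ) where

    D L : ℕ
    D = scale n d
    L = ℓ (size-bound n d)

    D≥1 : 1 ≤ D
    D≥1 = s≤s z≤n

    instance
      D≢0 : NonZero D
      D≢0 = >-nonZero D≥1

    L≤ : L ≤ α * D
    L≤ = ≤-trans (ℓ-least (size-magnitude * D) (≤-<-trans (size-bound-magnitude n d) (^-monoʳ-< 2 (s≤s (s≤s z≤n)) {size-magnitude * D} {suc (size-magnitude * D)} ≤-refl)))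
      (+-monoˡ-≤ (size-magnitude * D) D≥1)

    d≤D : d ≤ D
    d≤D = ≤-trans (n≤1+n d) (m≤m+n (suc d) ⌈log₂ n ⌉)

    sucd≤D : suc d ≤ D
    sucd≤D = m≤m+n (suc d) ⌈log₂ n ⌉

    -- Two linear quantities multiply here: the exponent and the length of W.
    power-length : ∀ c e b → e ≤ b * D → ℓ (1 * size-bound n d ^ (c * e)) + L ≤ (1 + c * b * α + α) * (D * D)
    power-length c e b e≤ = begin
      ℓ (1 * size-bound n d ^ (c * e)) + L      ≤⟨ +-mono-≤ (≤-trans (≤-reflexive (cong ℓ (+-identityʳ (size-bound n d ^ (c * e))))) (ℓ-^ (size-bound n d) (c * e))) L≤ ⟩
      suc (c * e * L) + α * D                   ≤⟨ +-mono-≤ (s≤s (*-mono-≤ (*-monoʳ-≤ c e≤) L≤)) (*-monoʳ-≤ α (m≤m*n D D)) ⟩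
      suc (c * (b * D) * (α * D)) + α * (D * D) ≤⟨ +-monoˡ-≤ (α * (D * D)) (+-monoˡ-≤ (c * (b * D) * (α * D)) (*-mono-≤ D≥1 D≥1)) ⟩
      D * D + c * (b * D) * (α * D) + α * (D * D) ≡⟨ collect c b α D ⟩
      (1 + c * b * α + α) * (D * D) ∎
      where
      open ≤-Reasoning
      collect : ∀ c b a D → D * D + c * (b * D) * (a * D) + a * (D * D) ≡ (1 + c * b * a + a) * (D * D)
      collect = solve-∀

    -- At most of the order of D rounds of an inner loop, each handling numbers of length of the
    -- order of D².
    cube : ℕ
    cube = D * (D * D)

    D≤cube : D ≤ cube
    D≤cube = m≤m*n D (D * D) {{m*n≢0 D D}}

    bounded-time : ∀ P → setupCost * (suc (K + d) * (ℓ (1 * size-bound n d ^ (8 * (K + d))) + L)) +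
        (suc (P + P) * (L + bodyCost * (suc d * (ℓ (1 * size-bound n d ^ (12 * d)) + L))) + 4 * (1 + L)) ≤
      (c₁ + (2 * c₂ + c₃)) * (cube * suc P)
    bounded-time P = begin
      setupCost * (suc (K + d) * (ℓ (1 * size-bound n d ^ (8 * (K + d))) + L)) +
        (suc (P + P) * (L + bodyCost * (suc d * (ℓ (1 * size-bound n d ^ (12 * d)) + L))) + 4 * (1 + L))
        ≤⟨ +-mono-≤ (*-monoʳ-≤ setupCost (*-mono-≤ K+d≤ (power-length 8 (K + d) (suc K) (≤-trans (n≤1+n (K + d)) K+d≤))))
             (+-mono-≤ (*-mono-≤ (≤-trans (n≤1+n (suc (P + P))) (≤-reflexive (twice P)))
               (+-mono-≤ L≤ (*-monoʳ-≤ bodyCost (*-mono-≤ sucd≤D (power-length 12 d 1 (≤-trans d≤D (≤-reflexive (sym (+-identityʳ D)))))))))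
               (*-monoʳ-≤ 4 (+-mono-≤ D≥1 L≤))) ⟩
      setupCost * (suc K * D * ((1 + 8 * suc K * α + α) * (D * D))) +
        (2 * suc P * (α * D + bodyCost * (D * ((1 + 12 * 1 * α + α) * (D * D)))) + 4 * (D + α * D))
        ≡⟨ e₁ setupCost (suc K) (1 + 8 * suc K * α + α) P α bodyCost (1 + 12 * 1 * α + α) D ⟩
      c₁ * cube + (2 * suc P * (α * D + bodyCost * (1 + 12 * 1 * α + α) * cube) + c₃ * D)
        ≤⟨ +-mono-≤ (*-monoʳ-≤ c₁ (m≤m*n cube (suc P)))
             (+-mono-≤ (*-monoʳ-≤ (2 * suc P) (+-monoˡ-≤ (bodyCost * (1 + 12 * 1 * α + α) * cube) (*-monoʳ-≤ α D≤cube)))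
               (*-monoʳ-≤ c₃ (≤-trans D≤cube (m≤m*n cube (suc P))))) ⟩
      c₁ * (cube * suc P) + (2 * suc P * (α * cube + bodyCost * (1 + 12 * 1 * α + α) * cube) + c₃ * (cube * suc P))
        ≡⟨ e₂ c₁ P α (bodyCost * (1 + 12 * 1 * α + α)) c₃ cube ⟩
      (c₁ + (2 * c₂ + c₃)) * (cube * suc P) ∎
      where
      open ≤-Reasoning
      K+d≤ : suc (K + d) ≤ suc K * D
      K+d≤ = begin
        suc (K + d)    ≡⟨ +-suc K d ⟨
        K + suc d      ≤⟨ +-mono-≤ (m≤m*n K D) sucd≤D ⟩
        K * D + D      ≡⟨ +-comm (K * D) D ⟩
        suc K * D      ∎
      twice : ∀ p → suc (suc (p + p)) ≡ 2 * suc p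
      twice = solve-∀
      e₁ : ∀ s k x p a b y D → s * (k * D * (x * (D * D))) + (2 * suc p * (a * D + b * (D * (y * (D * D)))) + 4 * (D + a * D)) ≡
           s * (k * x) * (D * (D * D)) + (2 * suc p * (a * D + b * y * (D * (D * D))) + 4 * (1 + a) * D)
      e₁ = solve-∀
      e₂ : ∀ c p a b f z → c * (z * suc p) + (2 * suc p * (a * z + b * z) + f * (z * suc p)) ≡ (c + (2 * (a + b) + f)) * (z * suc p)
      e₂ = solve-∀

  time-bound : ℕ → ℕ → ℕ
  time-bound n d = (c₁ + (2 * c₂ + c₃)) * (Polynomial.cube n d * suc (n * choices d))

  prefactor≤ : ∀ n d → prefactor d ≤ 8 ^ K * scale n d ^ (K + K)
  prefactor≤ n d = begin
    (2 * (base d * base d)) ^ K      ≤⟨ ^-monoˡ-≤ K (*-monoʳ-≤ 2 (*-mono-≤ base≤ base≤)) ⟩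
    (2 * ((2 * D) * (2 * D))) ^ K    ≡⟨ cong (_^ K) (e D) ⟩
    (8 * (D * D)) ^ K                ≡⟨ ^-distribʳ-* K 8 (D * D) ⟩
    8 ^ K * (D * D) ^ K              ≡⟨ cong (8 ^ K *_) (trans (^-distribʳ-* K D D) (sym (^-distribˡ-+-* D K K))) ⟩
    8 ^ K * D ^ (K + K)              ∎
    where
    open ≤-Reasoning
    D : ℕ
    D = scale n d
    e : ∀ D → 2 * ((2 * D) * (2 * D)) ≡ 8 * (D * D)
    e = solve-∀
    base≤ : base d ≤ 2 * D
    base≤ = begin
      suc (suc (quotient d K))   ≤⟨ s≤s (s≤s (quotient≤ d K)) ⟩
      suc (suc d)                ≤⟨ s≤s (m≤n+m (suc d) d) ⟩
      suc d + suc d              ≡⟨ cong (λ z → suc d + z) (+-identityʳ (suc d)) ⟨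
      2 * suc d                  ≤⟨ *-monoʳ-≤ 2 (m≤m+n (suc d) ⌈log₂ n ⌉) ⟩
      2 * D                      ∎

  time-bound≤ : ∀ n d → 1 ≤ n →
    time-bound n d * 100 ^ d ≤ (c₁ + (2 * c₂ + c₃)) * suc (8 ^ K) * scale n d ^ (3 + (K + K)) * (n * 126 ^ d)
  time-bound≤ n d 1≤n = begin
    c * (cube * suc (n * choices d)) * 100 ^ d                 ≡⟨ e₁ c cube (n * choices d) (100 ^ d) ⟩
    -- The assumption n ≥ 1 absorbs the additive one, as 100 ^ d ≤ n * 126 ^ d. In the other summand
    -- the rounding in `choices d` only helps.
    c * cube * (100 ^ d + n * choices d * 100 ^ d)             ≤⟨ *-monoʳ-≤ (c * cube) (+-mono-≤ (≤-trans (≤-reflexive (sym (+-identityʳ (100 ^ d)))) (*-mono-≤ 1≤n (^-monoˡ-≤ d (≤ᵇ⇒≤ 100 126 tt))))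
                                                                    (≤-trans (≤-reflexive (*-assoc n (choices d) (100 ^ d))) (*-monoʳ-≤ n (quotient*≤ (prefactor d * 126 ^ d) (100 ^ d))))) ⟩
    c * cube * (n * 126 ^ d + n * (prefactor d * 126 ^ d))     ≡⟨ e₂ (c * cube) n (126 ^ d) (prefactor d) ⟩
    c * cube * suc (prefactor d) * (n * 126 ^ d)               ≤⟨ *-monoˡ-≤ (n * 126 ^ d) (*-monoʳ-≤ (c * cube) (+-mono-≤ (m^n>0 D (K + K)) (prefactor≤ n d))) ⟩
    c * cube * (D ^ (K + K) + 8 ^ K * D ^ (K + K)) * (n * 126 ^ d) ≡⟨ cong (_* (n * 126 ^ d)) (e₃ c D (D ^ (K + K)) (8 ^ K)) ⟩
    c * suc (8 ^ K) * D ^ (3 + (K + K)) * (n * 126 ^ d) ∎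
    where
    open ≤-Reasoning
    open Polynomial n d
    c : ℕ
    c = c₁ + (2 * c₂ + c₃)
    e₁ : ∀ c z x y → c * (z * suc x) * y ≡ c * z * (y + x * y)
    e₁ = solve-∀
    e₂ : ∀ c n x p → c * (n * x + n * (p * x)) ≡ c * suc p * (n * x)
    e₂ = solve-∀
    e₃ : ∀ c D x y → c * (D * (D * D)) * (x + y * x) ≡ c * suc y * (D * (D * (D * x)))
    e₃ = solve-∀

  -- Unnormalised fractions are never reduced, so numerator and denominator are the literal powers.
  power-fraction : ∀ d → ↥ (((+ 126) / 100) ^ℚ d) ≡ + (126 ^ d) × ↧ₙ (((+ 126) / 100) ^ℚ d) ≡ 100 ^ d
  power-fraction zero = refl , refl
  power-fraction (suc d) with ((+ 126) / 100) ^ℚ d | power-fraction d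
  ... | mkℚᵘ .(+ (126 ^ d)) b | refl , eq = sym (ℤ.pos-* 126 (126 ^ d)) , cong (100 *_) eq

  ≤-fraction : ∀ x c n q a b → ↥ q ≡ + a → ↧ₙ q ≡ b → x * b ≤ c * (n * a) →
               (+ x) / 1 ℚᵘ.≤ ((+ c) / 1) ℚᵘ.* (((+ n) / 1) ℚᵘ.* q)
  ≤-fraction x c n (mkℚᵘ _ b-1) a b refl refl le = *≤* (subst₂ Data.Integer.Base._≤_
    (trans (ℤ.pos-* x b) (cong (λ z → + x Data.Integer.Base.* + z) (sym (trans (+-identityʳ _) (+-identityʳ _)))))
    (trans (ℤ.pos-* c (n * a)) (trans (cong (+ c Data.Integer.Base.*_) (ℤ.pos-* n a)) (sym (ℤ.*-identityʳ _))))
    (+≤+ le))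

  counting-orthogonal-vectors : ∃[ P ] ∃[ T ] (P Solves#OVInTime T)
      × (T ∈Õ λ n d → ((+ n) / 1) ℚᵘ.* (((+ 126) / 100) ^ℚ d))
  counting-orthogonal-vectors = ⌜ algorithm ⌝ , time-bound ,
    (λ n d u v → exec algorithm (input u v) , time algorithm (input u v) ,
      halts algorithm (input u v) tt , Correct.correct u v ,
      ≤-trans (LoopTime.total-time u v) (Polynomial.bounded-time n d (n * choices d))) ,
    (c₁ + (2 * c₂ + c₃)) * suc (8 ^ K) , 3 + (K + K) ,
    λ n d 1≤n → ≤-fraction (time-bound n d) _ n (((+ 126) / 100) ^ℚ d) (126 ^ d) (100 ^ d)
      (proj₁ (power-fraction d)) (proj₂ (power-fraction d)) (time-bound≤ n d 1≤n)

open import Data.Integer.Base using (+_)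
open import Data.Nat.Base using (ℕ)
open import Data.Product.Base using (_×_; ∃-syntax)
open import Data.Rational.Unnormalised.Base using (_*_; _/_)

theorem1p2 : ∃[ P ] ∃[ T ] (P Solves#OVInTime T)
    × (T ∈Õ λ n d → ((+ n) / 1) * (((+ 126) / 100) ^ℚ d))
theorem1p2 = Asymptotics.counting-orthogonal-vectors
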